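{- Let $t\ge 1212\,\Gamma\ell$ be a free time, and let $p_t\in[0,1]$ be such that $\Pr(F_t=0\mid I_t)\le p_t$ almost surely. Then $$\mathbb{E}[V_tT_tF_t]\ge\Big(c_t-\varepsilon_t-p_t-\frac2k\Big)\frac{\mathrm{OPT}_{RO}}{|RO|},$$ where $\varepsilon_t=(a_1+3)\frac{\Gamma\ell}{t}+\sqrt{10\ln k}\sqrt{\frac{2n}{tk}}$.
   Context: Model (Bursty Adversary plus Random Order). Integers $n,k$ are given, $k$ is the knapsack size, and the window length is $\ell=\frac{n\ln k}{k}$ (assumed to be a positive integer). $\mathbb{W}$ is the partition of $[n]$ into consecutive disjoint windows $\{1,\dots,\ell\},\{\ell+1,\dots,2\ell\},\dots$. The time steps are partitioned into adversarial times $Adv$ and random-order times $RO=[n]\setminus Adv$, where $Adv$ is contained in the union of a fixed family $\mathbb{W}^{adv}\subseteq\mathbb{W}$ of at most $\Gamma$ windows. There are fixed items $(v_1,w_1),\dots,(v_{|RO|},w_{|RO|})$ with $v_i>0$, $w_i\in(0,1]$, $\sum_i w_i\ge k$, all value densities $v_i/w_i$ distinct, indexed so that $v_1/w_1>v_2/w_2>\dots$. The indices $(I_t)_{t\in RO}$ form a uniformly random bijection $RO\to\{1,\dots,|RO|\}$, and at $t\in RO$ the item is $(V_t,W_t)=(v_{I_t},w_{I_t})$. At $t\in Adv$ the item $(V_t,W_t)$ with $V_t\ge0$, $W_t\in[0,1]$ is arbitrary and may depend adaptively on the algorithm's past behavior and on the $I_t$'s. $\mathrm{OPT}_{RO}=\max\{\sum_iv_ix_i:\sum_iw_ix_i\le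 k,\ x\in[0,1]^{|RO|}\}$. Standing assumptions: $k\ge 80$, $n/2\ge k$, $\Gamma\ge\sqrt{k}$, $\Gamma\ell/n\le 1/2$. Algorithm. For $t\in[n]$ let $\mathbb{W}_t=\{B\cap[t]:B\in\mathbb{W},B\cap[t]\ne\emptyset\}$, $c_t=1-\frac{4\Gamma\ell}{t}$, $a_1=601$. $LP_t$: maximize $\sum_{t'\le t}V_{t'}X_{t'}$ s.t. $\sum_{t'\le t}W_{t'}X_{t'}\le c_t\frac{t}{n}k$, $\sum_{t'\in B}W_{t'}X_{t'}\le a_1\frac{\ell}{n}k$ for all $B\in\mathbb{W}_t$, $X\in[0,1]^t$. At time $t$ the algorithm computes an optimal solution $X^t$ of $LP_t$ and lets $T_t=\mathbf{1}(X^t_t>0)$. It sets $X^{alg}_t=1$ if $T_t=1$, $\sum_{t'<t}W_{t'}X^{alg}_{t'}\le k-1$, and $\sum_{t'\in B_{last}}W_{t'}X^{alg}_{t'}\le a_4\frac{\ell}{n}k-1$, where $B_{last}$ is the last window of $\mathbb{W}_{t-1}$; otherwise $X^{alg}_t=0$. Here $a_4$ is a fixed constant with $a_4\ge 2e^6a_3$, $a_3=4000$. $F_t$ is the indicator that both of these last two budget conditions hold at time $t$ (so $X^{alg}_t=T_tF_t$). A time is free if it lies in no window of $\mathbb{W}^{adv}$ (free times are random-order times). -}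

module Defs where

open import Algebra.Bundles using (CommutativeRing; module Semiring)
import Algebra.Definitions.RawSemiring as RawSemiringDefs
open import Algebra.Structures using (IsCommutativeRing)
open import Data.Bool.Base using (Bool; _∧_; if_then_else_)
open import Data.Fin.Base as Fin using (Fin; toℕ; fromℕ<)
import Data.Fin.Properties as Fin
open import Data.Fin.Subset using (Subset; _∈_; _∉_; ∁; ∣_∣)
open import Data.Fin.Subset.Properties using (x∉p⇒x∈∁p)
open import Data.Nat.Base as ℕ using (ℕ; suc; pred; NonZero; _!)
open import Data.Nat.Divisibility using (∣-refl)
import Data.Nat.DivMod as ℕ
import Data.Nat.Properties as ℕ
open import Data.Product.Base using (∃; _×_; _,_; proj₁)
open import Function.Base using (_∘_)
open import Function.Bundles using (_↔_; module Inverse)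
open import Level using (0ℓ)
open import Relation.Binary.Definitions using (Decidable)
import Relation.Binary.Construct.StrictToNonStrict as StrictToNonStrict
open import Relation.Binary.PropositionalEquality using (_≡_; _≢_; sym; trans; cong; subst)
open import Relation.Binary.Structures using (IsStrictTotalOrder)
open import Relation.Nullary.Decidable using (⌊_⌋; _×-dec_)
import Relation.Unary as U

------------------------------------------------------------------------
-- The real numbers

-- The standard library has no real numbers, so they are taken axiomatically,
-- as a complete ordered field (unique up to isomorphism in classical
-- mathematics).  The order is a decidable total order: the classical reals
-- are meant.

record RealNumbers : Set₁ where
  infix  4 _<_
  infixl 6 _+_
  infixl 7 _*_ _/_
  infix  8 -_
  infix  9 _⁻¹

  field
    ℝ       : Set
    _+_ _*_ : ℝ → ℝ → ℝ
    -_ _⁻¹  : ℝ → ℝ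
    0# 1#   : ℝ
    _<_     : ℝ → ℝ → Set
    isCommutativeRing  : IsCommutativeRing _≡_ _+_ _*_ -_ 0# 1#
    -- 0# ⁻¹ is an unspecified real.
    ⁻¹-inverseʳ        : ∀ x → x ≢ 0# → x * x ⁻¹ ≡ 1#
    isStrictTotalOrder : IsStrictTotalOrder _≡_ _<_
    0<1                : 0# < 1#
    +-monoˡ-<          : ∀ z {x y} → x < y → x + z < y + z
    *-pos              : ∀ {x y} → 0# < x → 0# < y → 0# < x * y

  commutativeRing : CommutativeRing 0ℓ 0ℓ
  commutativeRing = record { isCommutativeRing = isCommutativeRing }

  open CommutativeRing commutativeRing public using (_-_; semiring)
  open RawSemiringDefs (Semiring.rawSemiring semiring) public using (_^_; sum) renaming (_×_ to _⋆_)
  open StrictToNonStrict _≡_ _<_ public using (_≤_; decidable′)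
  open IsStrictTotalOrder isStrictTotalOrder public using (compare; _≟_; _<?_)

  infix 4 _≤?_
  _≤?_ : Decidable _≤_
  _≤?_ = decidable′ compare

  _/_ : ℝ → ℝ → ℝ
  x / y = x * y ⁻¹

  fromℕ : ℕ → ℝ
  fromℕ m = m ⋆ 1#

  IsUpperBound : (ℝ → Set) → ℝ → Set
  IsUpperBound P u = ∀ x → P x → x ≤ u

  IsSupremum : (ℝ → Set) → ℝ → Set
  IsSupremum P s = IsUpperBound P s × (∀ u → IsUpperBound P u → s ≤ u)

  IsMaximum : (ℝ → Set) → ℝ → Set
  IsMaximum P m = P m × IsUpperBound P m

  _⟶_ : (ℕ → ℝ) → ℝ → Set
  a ⟶ x = ∀ δ → 0# < δ → ∃ λ M → ∀ m → M ℕ.≤ m → (x - δ < a m) × (a m < x + δ)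

  field
    complete : (P : ℝ → Set) → ∃ P → ∃ (IsUpperBound P) → ∃ (IsSupremum P)

  -- These functions exist, uniquely on the stated domains, in every complete
  -- ordered field; off those domains √ and ln are unspecified.
  field
    √_ exp ln : ℝ → ℝ
    √-nonneg   : ∀ {x} → 0# ≤ x → 0# ≤ √ x
    √-square   : ∀ {x} → 0# ≤ x → √ x * √ x ≡ x
    exp-series : ∀ x →
      (λ m → sum {m} (λ i → x ^ toℕ i / fromℕ (toℕ i !))) ⟶ exp x
    exp-ln     : ∀ {x} → 0# < x → exp (ln x) ≡ x

  infix 9 √_

  𝟙 : Bool → ℝ
  𝟙 b = if b then 1# else 0#

  sumOver : ∀ {m} {P : Fin m → Set} → U.Decidable P → (Fin m → ℝ) → ℝ
  sumOver P? f = sum λ s → 𝟙 ⌊ P? s ⌋ * f s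

------------------------------------------------------------------------
-- Windows

-- Times 1, …, n are represented by Fin n, so that s : Fin n is the time
-- suc (toℕ s); the windows are numbered 0, …, ⌈n/ℓ⌉ - 1, and the last one may
-- be shorter than ℓ.

module Windows (n ℓ : ℕ) .{{_ : NonZero ℓ}} where

  #windows : ℕ
  #windows = (n ℕ.+ pred ℓ) ℕ./ ℓ

  toℕ/ℓ<#windows : (s : Fin n) → toℕ s ℕ./ ℓ ℕ.< #windows
  toℕ/ℓ<#windows s = subst (ℕ._≤ #windows) s+ℓ/ℓ (ℕ./-monoˡ-≤ ℓ s+ℓ≤)
    where
    s+ℓ/ℓ : (toℕ s ℕ.+ ℓ) ℕ./ ℓ ≡ suc (toℕ s ℕ./ ℓ)
    s+ℓ/ℓ = trans (ℕ.+-distrib-/-∣ʳ (toℕ s) ∣-refl)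
           (trans (cong (toℕ s ℕ./ ℓ ℕ.+_) (ℕ.n/n≡1 ℓ)) (ℕ.+-comm _ 1))

    s+ℓ≤ : toℕ s ℕ.+ ℓ ℕ.≤ n ℕ.+ pred ℓ
    s+ℓ≤ = subst (λ j → toℕ s ℕ.+ j ℕ.≤ n ℕ.+ pred ℓ) (ℕ.suc-pred ℓ)
             (subst (ℕ._≤ n ℕ.+ pred ℓ) (sym (ℕ.+-suc (toℕ s) (pred ℓ)))
               (ℕ.+-monoˡ-≤ (pred ℓ) (Fin.toℕ<n s)))

  window : Fin n → Fin #windows
  window s = fromℕ< (toℕ/ℓ<#windows s)

------------------------------------------------------------------------
-- The model and the algorithm

module Model (R : RealNumbers) where
  open RealNumbers R

  record FiniteProbabilitySpace : Set where
    field
      size          : ℕ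
      weight        : Fin size → ℝ
      weight-nonneg : ∀ ω → 0# ≤ weight ω
      weight-total  : sum weight ≡ 1#

    Ω : Set
    Ω = Fin size

    𝔼 : (Ω → ℝ) → ℝ
    𝔼 f = sum λ ω → weight ω * f ω

    Pr : (Ω → Bool) → ℝ
    Pr A = 𝔼 (𝟙 ∘ A)

    -- Meaningful when Pr B is positive.
    Pr[_∣_] : (Ω → Bool) → (Ω → Bool) → ℝ
    Pr[ A ∣ B ] = Pr (λ ω → A ω ∧ B ω) / Pr B

  -- The knapsack size k is a real number.  For an integer k ≥ 2 the equation
  -- ℓ = n ln k / k has no solution in positive integers n, ℓ (ln k is
  -- irrational), so restricting k to integers would leave no instance at all.
  record Instance : Set where
    field
      n ℓ Γ      : ℕ
      k          : ℝ
      {{ℓ-nonZero}} : NonZero ℓ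
      ℓ-def      : fromℕ ℓ ≡ fromℕ n * ln k / k
      80≤k       : fromℕ 80 ≤ k
      k≤n/2      : k ≤ fromℕ n / fromℕ 2
      √k≤Γ       : √ k ≤ fromℕ Γ
      Γℓ/n≤1/2   : fromℕ Γ * fromℕ ℓ / fromℕ n ≤ 1# / fromℕ 2

    open Windows n ℓ public

    field
      Adv        : Subset n
      𝕎adv       : Subset #windows
      ∣𝕎adv∣≤Γ   : ∣ 𝕎adv ∣ ℕ.≤ Γ
      Adv⊆⋃𝕎adv  : ∀ {s} → s ∈ Adv → window s ∈ 𝕎adv

    RO : Subset n
    RO = ∁ Adv

    N : ℕ
    N = ∣ RO ∣

    field
      v w        : Fin N → ℝ
      v-pos      : ∀ i → 0# < v i
      w-pos      : ∀ i → 0# < w i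
      w≤1        : ∀ i → w i ≤ 1#
      k≤Σw       : k ≤ sum w
      v/w-decr   : ∀ {i j} → i Fin.< j → v j / w j < v i / w i

    a₁ : ℝ
    a₁ = fromℕ 601

    a₃ : ℝ
    a₃ = fromℕ 4000

    field
      a₄         : ℝ
      2e⁶a₃≤a₄   : fromℕ 2 * exp (fromℕ 6) * a₃ ≤ a₄

    Free : Fin n → Set
    Free s = window s ∉ 𝕎adv

    free⇒RO : ∀ {s} → Free s → s ∈ RO
    free⇒RO s-free = x∉p⇒x∈∁p λ s∈Adv → s-free (Adv⊆⋃𝕎adv s∈Adv)

    -- The values of the fractional knapsack problem over the
    -- random-order items.
    KnapsackValue : ℝ → Set
    KnapsackValue z = ∃ λ (x : Fin N → ℝ) →
      (∀ i → 0# ≤ x i × x i ≤ 1#) ×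
      (sum (λ i → w i * x i) ≤ k) ×
      (z ≡ sum (λ i → v i * x i))

    IsOPT-RO : ℝ → Set
    IsOPT-RO = IsMaximum KnapsackValue

    -- Bijections from random-order times to items.
    Arrival : Set
    Arrival = (∃ λ (s : Fin n) → s ∈ RO) ↔ Fin N

    itemAt : Arrival → ∀ {s} → s ∈ RO → Fin N
    itemAt σ s∈RO = Inverse.to σ (_ , s∈RO)

    timeOf : Arrival → Fin N → Fin n
    timeOf σ i = proj₁ (Inverse.from σ i)

    -- σ and τ are the same bijection, i.e. every item arrives at the
    -- same time in both.
    same : Arrival → Arrival → Bool
    same σ τ = ⌊ Fin.all? (λ i → timeOf σ i Fin.≟ timeOf τ i) ⌋

    time : Fin n → ℝ
    time t = fromℕ (suc (toℕ t))

    ℓ/n : ℝ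
    ℓ/n = fromℕ ℓ / fromℕ n

    c : Fin n → ℝ
    c t = 1# - fromℕ 4 * fromℕ Γ * fromℕ ℓ / time t

    ε : Fin n → ℝ
    ε t = (a₁ + fromℕ 3) * (fromℕ Γ * fromℕ ℓ / time t)
        + √ (fromℕ 10 * ln k) * √ (fromℕ 2 * fromℕ n / (time t * k))

    -- LP_t for the item sequence (V , W).  A vector indexed by t' ≤ t is
    -- represented by a function on Fin n whose entries after t are ignored.
    -- The window constraints run over the windows of the times s ≤ t, which
    -- are exactly those meeting {1, …, t}.
    module LP (V W : Fin n → ℝ) (t : Fin n) where

      record Feasible (X : Fin n → ℝ) : Set where
        field
          budget        : sumOver (Fin._≤? t) (λ s → W s * X s)
                            ≤ c t * (time t / fromℕ n) * k
          window-budget : ∀ s → s Fin.≤ t →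
            sumOver (λ s' → (s' Fin.≤? t) ×-dec (window s' Fin.≟ window s))
                    (λ s' → W s' * X s')
              ≤ a₁ * ℓ/n * k
          box           : ∀ s → s Fin.≤ t → 0# ≤ X s × X s ≤ 1#

      value : (Fin n → ℝ) → ℝ
      value X = sumOver (Fin._≤? t) (λ s → V s * X s)

      Optimal : (Fin n → ℝ) → Set
      Optimal X = Feasible X × (∀ Y → Feasible Y → value Y ≤ value X)

    -- B_last is the window of the time preceding t, cut off before t; at the
    -- first time there is no earlier s and both sums are empty.
    budgetsAllow : (Fin n → ℝ) → (Fin n → Bool) → Fin n → Bool
    budgetsAllow W Xalg t =
        ⌊ sumOver (Fin._<? t) (λ s → W s * 𝟙 (Xalg s)) ≤? k - 1# ⌋
      ∧ ⌊ sumOver (λ s → (s Fin.<? t) ×-dec (toℕ s ℕ./ ℓ ℕ.≟ pred (toℕ t) ℕ./ ℓ))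
                  (λ s → W s * 𝟙 (Xalg s))
            ≤? a₄ * ℓ/n * k - 1# ⌋

  -- A joint run of the adversary and the algorithm.  V, W at adversarial times
  -- and the chosen LP optima are arbitrary random variables on a common
  -- probability space with the arrival order I; this includes every adaptive
  -- dependence on I and on the algorithm's behaviour, and every
  -- tie-breaking rule between optimal solutions.
  record Execution (inst : Instance) : Set where
    open Instance inst
    field
      space : FiniteProbabilitySpace

    open FiniteProbabilitySpace space public

    field
      I         : Ω → Arrival
      I-uniform : ∀ σ → Pr (λ ω → same (I ω) σ) ≡ 1# / fromℕ (N !)

      V W   : Ω → Fin n → ℝ
      V-RO  : ∀ ω {s} (s∈RO : s ∈ RO) → V ω s ≡ v (itemAt (I ω) s∈RO)
      W-RO  : ∀ ω {s} (s∈RO : s ∈ RO) → W ω s ≡ w (itemAt (I ω) s∈RO)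
      V-Adv : ∀ ω {s} → s ∈ Adv → 0# ≤ V ω s
      W-Adv : ∀ ω {s} → s ∈ Adv → 0# ≤ W ω s × W ω s ≤ 1#

      -- X ω t is the solution computed for LP_t.  For small t, c t is negative
      -- and LP_t is infeasible; X ω t is then left arbitrary.
      X         : Ω → Fin n → (Fin n → ℝ)
      X-optimal : ∀ ω t → ∃ (LP.Feasible (V ω) (W ω) t) →
                  LP.Optimal (V ω) (W ω) t (X ω t)

      Xalg      : Ω → Fin n → Bool

    T : Ω → Fin n → Bool
    T ω t = ⌊ 0# <? X ω t t ⌋

    F : Ω → Fin n → Bool
    F ω t = budgetsAllow (W ω) (Xalg ω) t

    field
      -- F ω t involves Xalg ω s for s < t only, so this determines Xalg
      -- recursively.
      Xalg-rule : ∀ ω t → Xalg ω t ≡ T ω t ∧ F ω t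

    -- The event that item i arrives at the random-order time s.
    arrives : ∀ {s} → s ∈ RO → Fin N → Ω → Bool
    arrives s∈RO i ω = ⌊ itemAt (I ω) s∈RO Fin.≟ i ⌋

{-# OPTIONS --safe #-}

-- Condition on the item i that arrives at t.  If the LP leaves it out, then by
-- an exchange argument one of two budgets is used up by denser items: either
-- the window of t, which is free and therefore holds random-order items only,
-- or the whole budget, of which the adversarial windows can take at most
-- Γ a₁ (ℓ/n) k.  In both cases the denser items that arrived before t are much
-- heavier than expected.  Their total weight satisfies a Chernoff bound: for
-- distinct items j the indicators of arriving in a fixed set of times are
-- negatively correlated (exchange two items), so that the moment generating
-- function is at most that of independent indicators.  Hence an item i whose
-- denser items weigh less than (c t - ε t) k is left out with probability at
-- most 2/k, and by the greedy bound for the fractional knapsack problem these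
-- items are worth at least (c t - ε t) OPT.

module Submission where

open import Defs
import Algebra.Definitions.RawSemiring as RawSemiringDefs
open import Algebra.Bundles using (CommutativeRing; module Semiring)
import Algebra.Properties.Ring
import Algebra.Properties.Semiring.Mult
import Algebra.Properties.Semiring.Sum
import Algebra.Solver.Ring
open import Algebra.Solver.Ring.AlmostCommutativeRing
  using (AlmostCommutativeRing; fromCommutativeRing; _-Raw-AlmostCommutative⟶_)
open import Data.Bool.Base using (Bool; true; false; _∧_; not)
open import Data.Fin.Base as Fin using (Fin; zero; suc; toℕ; fromℕ<)
open import Data.Fin.Permutation as Perm using (Permutation′; _⟨$⟩ʳ_; _⟨$⟩ˡ_; transpose)
import Data.Fin.Properties as Fin
open import Data.Fin.Subset using (Subset; _∈_; _∉_; ∣_∣)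
open import Data.Fin.Subset.Properties using (_∈?_; x∉p⇒x∈∁p; ∣∁p∣≡n∸∣p∣; ∣p∣≤n; drop-there)
open import Data.Integer.Base as ℤ using (ℤ; +0; +[1+_]; -[1+_])
import Data.Integer.Properties as ℤ
open import Data.Maybe.Base using (Maybe; just; nothing)
open import Data.Nat.Base as ℕ using (ℕ; zero; suc; _!)
import Data.Nat.DivMod as ℕ
import Data.Nat.Properties as ℕ
open import Data.Product.Base using (∃; _×_; _,_; proj₁; proj₂)
open import Data.Sum.Base using (_⊎_; inj₁; inj₂; [_,_]′)
open import Data.Vec.Base using ([]; _∷_; there)
open import Data.Vec.Properties.WithK using ([]=-irrelevant)
open import Function.Base using (_∘_; id)
open import Function.Bundles using (Inverse)
open import Function.Construct.Composition using (_↔-∘_)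
open import Level using (0ℓ)
import Relation.Binary.Construct.StrictToNonStrict as StrictToNonStrict
open import Relation.Binary.Bundles using (StrictPartialOrder)
open import Relation.Binary.Definitions using (tri<; tri≈; tri>)
open import Relation.Binary.PropositionalEquality hiding (J)
open import Relation.Binary.Structures using (IsStrictTotalOrder)
open import Relation.Nullary using (¬_; Dec; yes; no; contradiction)
open import Relation.Nullary.Decidable using (⌊_⌋; _×-dec_)

-- The ledger behind `ε t`: put e = Γℓ/t and M = (t/n)k, and let D be the square-root term of `ε t`.
-- Since ℓk/n = ln k, the Γ window budgets of 601 ln k amount to 601 e M, and `c t` costs another 4
-- e M; so an exhausted overall budget forces denser items of weight at least (1 - 605 e) M to
-- arrive before t. For an item whose denser items weigh at most θk, where θ = c t - ε t = 1 - 608 e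
-- - D, the expected weight of those arriving before t is at most (θ + 3 e) M = (1 - 605 e - D) M:
-- the 3 in `a₁ + 3` pays for the random order having possibly only n - Γℓ times. The remaining gap
-- is D M, and D²M = 20 ln k brings the tail down to 1/k. In the window of t an expectation of at
-- most 2 ln k faces a cap of 601 ln k, which gives the other 1/k. Conditioning on the item at t is
-- done by multiplying with its indicator, so all bounds are linear in expectations. The exponential
-- is used only at nonnegative arguments, through two one-step inequalities read off from its power
-- series.

first-failure : ∀ {m} {P : Fin m → Set} → (∀ i → Dec (P i)) →
                (∀ i → P i) ⊎ ∃ λ g → ¬ P g × (∀ j → j Fin.< g → P j)
first-failure {zero}  P? = inj₁ λ ()
first-failure {suc m} P? with P? zero
... | no ¬p = inj₂ (zero , ¬p , λ _ ())
... | yes p with first-failure (P? ∘ suc)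
...   | inj₁ all = inj₁ λ { zero → p ; (suc i) → all i }
...   | inj₂ (g , ¬pg , before) =
    inj₂ (suc g , ¬pg , λ { zero _ → p ; (suc j) (ℕ.s<s j<g) → before j j<g })

-- Ordered-field arithmetic, with a ring solver over integer coefficients.

module OrderedField (R : RealNumbers) where
  open RealNumbers R
  open CommutativeRing commutativeRing public
    using (+-assoc; +-comm; +-identityˡ; +-identityʳ; -‿inverseʳ; *-assoc; *-comm; *-identityˡ; *-identityʳ;
           distribˡ; distribʳ; zeroˡ; zeroʳ)
  open Algebra.Properties.Ring (CommutativeRing.ring commutativeRing) public
    using (-‿distribˡ-*; -‿distribʳ-*; -‿involutive; -0#≈0#; -‿+-comm)
  open Algebra.Properties.Semiring.Mult semiring using (×-homo-+; ×1-homo-*)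

  fromℕ-+ : ∀ m n → fromℕ (m ℕ.+ n) ≡ fromℕ m + fromℕ n
  fromℕ-+ = ×-homo-+ 1#

  fromℕ-* : ∀ m n → fromℕ (m ℕ.* n) ≡ fromℕ m * fromℕ n
  fromℕ-* = ×1-homo-*

  -- A separate clause for 1 makes the numeral 1 of the solver denote 1# itself.
  fromℤ : ℤ → ℝ
  fromℤ (ℤ.+ 1)  = 1#
  fromℤ (ℤ.+ m)  = fromℕ m
  fromℤ -[1+ m ] = - fromℕ (suc m)

  fromℤ-+ : ∀ m → fromℤ (ℤ.+ m) ≡ fromℕ m
  fromℤ-+ 0             = refl
  fromℤ-+ 1             = sym (+-identityʳ 1#)
  fromℤ-+ (suc (suc m)) = refl

  fromℤ-neg : ∀ i → fromℤ (ℤ.- i) ≡ - fromℤ i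
  fromℤ-neg +0       = sym -0#≈0#
  fromℤ-neg +[1+ m ] = cong -_ (sym (fromℤ-+ (suc m)))
  fromℤ-neg -[1+ m ] = trans (fromℤ-+ (suc m)) (sym (-‿involutive _))

  fromℤ-⊖ : ∀ m n → fromℤ (m ℤ.⊖ n) ≡ fromℕ m - fromℕ n
  fromℤ-⊖ m n with ℕ.<-≤-connex n m
  ... | inj₁ n<m = trans (cong fromℤ (ℤ.⊖-≥ (ℕ.<⇒≤ n<m))) (trans (fromℤ-+ (m ℕ.∸ n))
                     (minus (trans (sym (fromℕ-+ (m ℕ.∸ n) n))
                         (cong fromℕ (ℕ.m∸n+n≡m (ℕ.<⇒≤ n<m))))))
    where
    minus : ∀ {x y z} → x + y ≡ z → x ≡ z - y
    minus {x} {y} refl =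
        sym (trans (+-assoc x y (- y)) (trans (cong (x +_) (-‿inverseʳ y)) (+-identityʳ x)))
  ... | inj₂ m≤n =
      trans (cong fromℤ (ℤ.⊖-≤ m≤n))
      (trans (fromℤ-neg (ℤ.+ (n ℕ.∸ m))) (trans (cong -_ (fromℤ-+ (n ℕ.∸ m)))
                     (minus (trans (sym (fromℕ-+ (n ℕ.∸ m) m)) (cong fromℕ (ℕ.m∸n+n≡m m≤n))))))
    where
    minus : ∀ {x y z} → x + y ≡ z → - x ≡ y - z
    minus {x} {y} refl =
        sym (trans (cong (λ u → y + - u) (+-comm x y)) (trans (cong (y +_) (sym (-‿+-comm y x)))
      (trans (sym (+-assoc y (- y) (- x)))
          (trans (cong (_+ - x) (-‿inverseʳ y)) (+-identityˡ (- x))))))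

  fromℤ-homo-+ : ∀ i j → fromℤ (i ℤ.+ j) ≡ fromℤ i + fromℤ j
  fromℤ-homo-+ (ℤ.+ m)    (ℤ.+ n)    =
      trans (fromℤ-+ (m ℕ.+ n)) (trans (fromℕ-+ m n) (sym (cong₂ _+_ (fromℤ-+ m) (fromℤ-+ n))))
  fromℤ-homo-+ (ℤ.+ m)    -[1+ n ] =
      trans (fromℤ-⊖ m (suc n)) (cong (_- fromℕ (suc n)) (sym (fromℤ-+ m)))
  fromℤ-homo-+ -[1+ m ] (ℤ.+ n)    =
      trans (fromℤ-⊖ n (suc m)) (trans (+-comm _ _) (cong (- fromℕ (suc m) +_) (sym (fromℤ-+ n))))
  fromℤ-homo-+ -[1+ m ] -[1+ n ] = trans (cong (-_ ∘ fromℕ ∘ suc) (sym (ℕ.+-suc m n)))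
                                     (trans (cong -_ (fromℕ-+ (suc m) (suc n)))
                                         (sym (-‿+-comm _ _)))

  fromℤ-homo-* : ∀ i j → fromℤ (i ℤ.* j) ≡ fromℤ i * fromℤ j
  fromℤ-homo-* (ℤ.+ m) (ℤ.+ n) = trans (cong fromℤ (sym (ℤ.pos-* m n)))
    (trans (fromℤ-+ (m ℕ.* n)) (trans (fromℕ-* m n) (sym (cong₂ _*_ (fromℤ-+ m) (fromℤ-+ n)))))
  fromℤ-homo-* (ℤ.+ m) -[1+ n ] = trans (cong fromℤ (sym (ℤ.neg-distribʳ-* (ℤ.+ m) (ℤ.+ suc n))))
    (trans (fromℤ-neg (ℤ.+ m ℤ.* ℤ.+ suc n))
        (trans (cong -_
        (trans (fromℤ-homo-* (ℤ.+ m) (ℤ.+ suc n)) (cong (fromℤ (ℤ.+ m) *_) (fromℤ-+ (suc n)))))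
        (-‿distribʳ-* _ _)))
  fromℤ-homo-* -[1+ m ] (ℤ.+ n) = trans (cong fromℤ (sym (ℤ.neg-distribˡ-* (ℤ.+ suc m) (ℤ.+ n))))
    (trans (fromℤ-neg (ℤ.+ suc m ℤ.* ℤ.+ n))
        (trans (cong -_
        (trans (fromℤ-homo-* (ℤ.+ suc m) (ℤ.+ n)) (cong (_* fromℤ (ℤ.+ n)) (fromℤ-+ (suc m)))))
        (-‿distribˡ-* _ _)))
  fromℤ-homo-* -[1+ m ] -[1+ n ] =
      trans (fromℤ-+ (suc m ℕ.* suc n)) (trans (fromℕ-* (suc m) (suc n))
    (trans (sym (-‿involutive _)) (trans (cong -_ (-‿distribʳ-* _ _)) (-‿distribˡ-* _ _))))

  private
    almostRing : AlmostCommutativeRing 0ℓ 0ℓ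
    almostRing = fromCommutativeRing commutativeRing

    morphism : CommutativeRing.rawRing ℤ.+-*-commutativeRing -Raw-AlmostCommutative⟶ almostRing
    morphism = record
      { ⟦_⟧    = fromℤ
      ; +-homo = fromℤ-homo-+
      ; *-homo = fromℤ-homo-*
      ; -‿homo = fromℤ-neg
      ; 0-homo = refl
      ; 1-homo = refl
      }

    coeff≟ : ∀ i j → Maybe (fromℤ i ≡ fromℤ j)
    coeff≟ i j with i ℤ.≟ j
    ... | yes i≡j = just (cong fromℤ i≡j)
    ... | no  _   = nothing

  open Algebra.Solver.Ring
      (CommutativeRing.rawRing ℤ.+-*-commutativeRing) almostRing morphism coeff≟ public
    using (solve; Polynomial; con; _:+_; _:*_; _:-_; :-_; _:=_)

  num : ∀ {n} → ℕ → Polynomial n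
  num m = con (ℤ.+ m)

  open IsStrictTotalOrder isStrictTotalOrder public
    using (isStrictPartialOrder; <-resp-≈) renaming (trans to <-trans; irrefl to <-irrefl)

  private
    module Weak = StrictToNonStrict _≡_ _<_

  ≤-refl : ∀ {x} → x ≤ x
  ≤-refl = inj₂ refl

  ≤-reflexive : ∀ {x y} → x ≡ y → x ≤ y
  ≤-reflexive = inj₂

  <⇒≤ : ∀ {x y} → x < y → x ≤ y
  <⇒≤ = inj₁

  ≤-trans : ∀ {x y z} → x ≤ y → y ≤ z → x ≤ z
  ≤-trans = Weak.trans isEquivalence <-resp-≈ <-trans

  <-≤-trans : ∀ {x y z} → x < y → y ≤ z → x < z
  <-≤-trans = Weak.<-≤-trans <-trans (proj₁ <-resp-≈)

  ≤-<-trans : ∀ {x y z} → x ≤ y → y < z → x < z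
  ≤-<-trans = Weak.≤-<-trans sym <-trans (proj₂ <-resp-≈)

  ≤-antisym : ∀ {x y} → x ≤ y → y ≤ x → x ≡ y
  ≤-antisym = Weak.antisym isEquivalence <-trans <-irrefl

  ≤-total : ∀ x y → x ≤ y ⊎ y ≤ x
  ≤-total = Weak.total compare

  ≮⇒≥ : ∀ {x y} → ¬ x < y → y ≤ x
  ≮⇒≥ {x} {y} x≮y with compare x y
  ... | tri< x<y _ _ = contradiction x<y x≮y
  ... | tri≈ _ x≡y _ = ≤-reflexive (sym x≡y)
  ... | tri> _ _ y<x = <⇒≤ y<x

  ≰⇒> : ∀ {x y} → ¬ x ≤ y → y < x
  ≰⇒> {x} {y} x≰y with compare x y
  ... | tri< x<y _ _ = contradiction (<⇒≤ x<y) x≰y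
  ... | tri≈ _ x≡y _ = contradiction (≤-reflexive x≡y) x≰y
  ... | tri> _ _ y<x = y<x

  <⇒≱ : ∀ {x y} → x < y → ¬ y ≤ x
  <⇒≱ x<y y≤x = <-irrefl refl (<-≤-trans x<y y≤x)

  -- Inequalities are proved by certificates: the difference of the two sides
  -- is written as a visibly nonnegative expression d.
  ≤-cert : ∀ {x y} d → 0# ≤ d → x + d ≡ y → x ≤ y
  ≤-cert {x} d (inj₁ 0<d) refl =
    <⇒≤ (subst₂ _<_ (+-identityˡ x) (+-comm d x) (+-monoˡ-< x 0<d))
  ≤-cert {x} d (inj₂ refl) refl = ≤-reflexive (sym (+-identityʳ x))

  <-cert : ∀ {x y} d → 0# < d → x + d ≡ y → x < y
  <-cert {x} d 0<d refl = subst₂ _<_ (+-identityˡ x) (+-comm d x) (+-monoˡ-< x 0<d)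

  x<y⇒0<y-x : ∀ {x y} → x < y → 0# < y - x
  x<y⇒0<y-x {x} {y} x<y = subst (_< y - x) (-‿inverseʳ x) (+-monoˡ-< (- x) x<y)

  x≤y⇒0≤y-x : ∀ {x y} → x ≤ y → 0# ≤ y - x
  x≤y⇒0≤y-x (inj₁ x<y)      = <⇒≤ (x<y⇒0<y-x x<y)
  x≤y⇒0≤y-x {x} (inj₂ refl) = ≤-reflexive (sym (-‿inverseʳ x))

  +-mono-≤ : ∀ {x y u v} → x ≤ y → u ≤ v → x + u ≤ y + v
  +-mono-≤ {x} {y} {u} {v} (inj₁ x<y) (inj₁ u<v) = <⇒≤ (<-trans (+-monoˡ-< u x<y)
    (subst₂ _<_ (+-comm u y) (+-comm v y) (+-monoˡ-< y u<v)))
  +-mono-≤ {u = u} (inj₁ x<y) (inj₂ refl) = <⇒≤ (+-monoˡ-< u x<y)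
  +-mono-≤ {x} {_} {u} {v} (inj₂ refl) (inj₁ u<v) =
    <⇒≤ (subst₂ _<_ (+-comm u x) (+-comm v x) (+-monoˡ-< x u<v))
  +-mono-≤ (inj₂ refl) (inj₂ refl) = ≤-refl

  +-nonneg : ∀ {x y} → 0# ≤ x → 0# ≤ y → 0# ≤ x + y
  +-nonneg 0≤x 0≤y = subst (_≤ _) (+-identityˡ 0#) (+-mono-≤ 0≤x 0≤y)

  +-pos : ∀ {x y} → 0# < x → 0# ≤ y → 0# < x + y
  +-pos {x} {y} 0<x 0≤y = <-≤-trans 0<x (≤-cert y 0≤y refl)

  *-nonneg : ∀ {x y} → 0# ≤ x → 0# ≤ y → 0# ≤ x * y
  *-nonneg (inj₁ 0<x) (inj₁ 0<y)          = <⇒≤ (*-pos 0<x 0<y)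
  *-nonneg {y = y} (inj₂ refl) _          = ≤-reflexive (sym (zeroˡ y))
  *-nonneg {x = x} (inj₁ _) (inj₂ refl)   = ≤-reflexive (sym (zeroʳ x))

  0≤1 : 0# ≤ 1#
  0≤1 = <⇒≤ 0<1

  *-monoˡ-≤ : ∀ {z x y} → 0# ≤ z → x ≤ y → z * x ≤ z * y
  *-monoˡ-≤ {z} {x} {y} 0≤z x≤y = ≤-cert (z * (y - x)) (*-nonneg 0≤z (x≤y⇒0≤y-x x≤y))
    (solve 3 (λ x y z → z :* x :+ z :* (y :- x) := z :* y) refl x y z)

  *-monoʳ-≤ : ∀ {z x y} → 0# ≤ z → x ≤ y → x * z ≤ y * z
  *-monoʳ-≤ {z} {x} {y} 0≤z x≤y = subst₂ _≤_ (*-comm z x) (*-comm z y) (*-monoˡ-≤ 0≤z x≤y)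

  *-mono-≤ : ∀ {x y u v} → 0# ≤ x → 0# ≤ u → x ≤ y → u ≤ v → x * u ≤ y * v
  *-mono-≤ 0≤x 0≤u x≤y u≤v = ≤-trans (*-monoˡ-≤ 0≤x u≤v) (*-monoʳ-≤ (≤-trans 0≤u u≤v) x≤y)

  x*y≤x : ∀ {x y} → 0# ≤ x → y ≤ 1# → x * y ≤ x
  x*y≤x {x} {y} 0≤x y≤1 = subst (x * y ≤_) (*-identityʳ x) (*-monoˡ-≤ 0≤x y≤1)

  *-monoˡ-< : ∀ {z x y} → 0# < z → x < y → z * x < z * y
  *-monoˡ-< {z} {x} {y} 0<z x<y = <-cert (z * (y - x)) (*-pos 0<z (x<y⇒0<y-x x<y))
    (solve 3 (λ x y z → z :* x :+ z :* (y :- x) := z :* y) refl x y z)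

  *-cancelˡ-≤ : ∀ {z x y} → 0# < z → z * x ≤ z * y → x ≤ y
  *-cancelˡ-≤ 0<z zx≤zy = ≮⇒≥ λ y<x → <⇒≱ (*-monoˡ-< 0<z y<x) zx≤zy

  square-nonneg : ∀ x → 0# ≤ x * x
  square-nonneg x with ≤-total 0# x
  ... | inj₁ 0≤x = *-nonneg 0≤x 0≤x
  ... | inj₂ x≤0 = subst (0# ≤_) (solve 1 (λ x → (num 0 :- x) :* (num 0 :- x) := x :* x) refl x)
    (*-nonneg (x≤y⇒0≤y-x x≤0) (x≤y⇒0≤y-x x≤0))

  pos⇒≢0 : ∀ {x} → 0# < x → x ≢ 0#
  pos⇒≢0 0<x x≡0 = <-irrefl (sym x≡0) 0<x

  x*y⁻¹≡1 : ∀ {x} → 0# < x → x * x ⁻¹ ≡ 1#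
  x*y⁻¹≡1 {x} 0<x = ⁻¹-inverseʳ x (pos⇒≢0 0<x)

  ⁻¹-pos : ∀ {x} → 0# < x → 0# < x ⁻¹
  ⁻¹-pos {x} 0<x = ≰⇒> λ x⁻¹≤0 →
      <⇒≱ 0<1 (subst₂ _≤_ (x*y⁻¹≡1 0<x) (zeroʳ x) (*-monoˡ-≤ (<⇒≤ 0<x) x⁻¹≤0))

  /-*-cancel : ∀ {y} x → 0# < y → x / y * y ≡ x
  /-*-cancel {y} x 0<y =
      trans (*-assoc x (y ⁻¹) y) (trans (cong (x *_) (trans (*-comm (y ⁻¹) y) (x*y⁻¹≡1 0<y)))
      (*-identityʳ x))

  /-pos : ∀ {x y} → 0# < x → 0# < y → 0# < x / y
  /-pos 0<x 0<y = *-pos 0<x (⁻¹-pos 0<y)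

  /-nonneg : ∀ {x y} → 0# ≤ x → 0# < y → 0# ≤ x / y
  /-nonneg 0≤x 0<y = *-nonneg 0≤x (<⇒≤ (⁻¹-pos 0<y))

  *≡⇒≡/ : ∀ {x y z} → 0# < y → x * y ≡ z → x ≡ z / y
  *≡⇒≡/ {x} {y} 0<y refl =
      sym (trans (*-assoc x y (y ⁻¹)) (trans (cong (x *_) (x*y⁻¹≡1 0<y)) (*-identityʳ x)))

  fromℕ-nonneg : ∀ m → 0# ≤ fromℕ m
  fromℕ-nonneg zero    = ≤-refl
  fromℕ-nonneg (suc m) = +-nonneg 0≤1 (fromℕ-nonneg m)

  fromℕ-pos : ∀ {m} → 0 ℕ.< m → 0# < fromℕ m
  fromℕ-pos {suc m} _ = +-pos 0<1 (fromℕ-nonneg m)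

  fromℕ-mono-≤ : ∀ {m n} → m ℕ.≤ n → fromℕ m ≤ fromℕ n
  fromℕ-mono-≤ {m} {n} m≤n = ≤-cert (fromℕ (n ℕ.∸ m)) (fromℕ-nonneg (n ℕ.∸ m))
    (trans (sym (fromℕ-+ m (n ℕ.∸ m))) (cong fromℕ (ℕ.m+[n∸m]≡n m≤n)))

  infixl 6 _⊓_
  _⊓_ : ℝ → ℝ → ℝ
  x ⊓ y with x ≤? y
  ... | yes _ = x
  ... | no  _ = y

  ⊓≤ˡ : ∀ x y → x ⊓ y ≤ x
  ⊓≤ˡ x y with x ≤? y
  ... | yes _  = ≤-refl
  ... | no x≰y = <⇒≤ (≰⇒> x≰y)

  ⊓≤ʳ : ∀ x y → x ⊓ y ≤ y
  ⊓≤ʳ x y with x ≤? y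
  ... | yes x≤y = x≤y
  ... | no  _   = ≤-refl

  ⊓-pos : ∀ {x y} → 0# < x → 0# < y → 0# < x ⊓ y
  ⊓-pos {x} {y} 0<x 0<y with x ≤? y
  ... | yes _ = 0<x
  ... | no  _ = 0<y

  strictPartialOrder : StrictPartialOrder 0ℓ 0ℓ 0ℓ
  strictPartialOrder = record { isStrictPartialOrder = isStrictPartialOrder }

  module ≤-Reasoning where
    open import Relation.Binary.Reasoning.StrictPartialOrder strictPartialOrder public

-- Finite sums, products and indicators.

module FiniteSums (R : RealNumbers) where
  open RealNumbers R
  open OrderedField R
  open Algebra.Properties.Semiring.Sum semiring public
    using (sum-replicate-zero; ∑-distrib-+; ∑-comm; *-distribˡ-sum; *-distribʳ-sum)
    renaming (sum-cong-≗ to sum-cong)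
  open RawSemiringDefs (Semiring.rawSemiring semiring) public using (product)

  sum-mono : ∀ {n} {f g : Fin n → ℝ} → (∀ i → f i ≤ g i) → sum f ≤ sum g
  sum-mono {zero}  f≤g = ≤-refl
  sum-mono {suc n} f≤g = +-mono-≤ (f≤g zero) (sum-mono (f≤g ∘ suc))

  sum-nonneg : ∀ {n} {f : Fin n → ℝ} → (∀ i → 0# ≤ f i) → 0# ≤ sum f
  sum-nonneg {zero}  0≤f = ≤-refl
  sum-nonneg {suc n} 0≤f = +-nonneg (0≤f zero) (sum-nonneg (0≤f ∘ suc))

  sum-zero : ∀ {n} {f : Fin n → ℝ} → (∀ i → f i ≡ 0#) → sum f ≡ 0#
  sum-zero {n} f≡0 = trans (sum-cong f≡0) (sum-replicate-zero n)

  sum-const : ∀ n c → sum {n} (λ _ → c) ≡ fromℕ n * c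
  sum-const zero    c = sym (zeroˡ c)
  sum-const (suc n) c = trans (cong₂ _+_ (sym (*-identityˡ c)) (sum-const n c))
      (sym (distribʳ c 1# (fromℕ n)))

  sum-single : ∀ {n} {f : Fin n → ℝ} i → (∀ j → j ≢ i → f j ≡ 0#) → sum f ≡ f i
  sum-single {f = f} zero    f≡0 = trans (cong (f zero +_) (sum-zero (λ j → f≡0 (suc j) λ ())))
      (+-identityʳ _)
  sum-single {f = f} (suc i) f≡0 = trans (cong₂ _+_ (f≡0 zero λ ())
    (sum-single i (λ j j≢i → f≡0 (suc j) (j≢i ∘ Fin.suc-injective)))) (+-identityˡ _)

  term≤sum : ∀ {n} {f : Fin n → ℝ} → (∀ i → 0# ≤ f i) → ∀ i → f i ≤ sum f
  term≤sum {f = f} 0≤f zero    = ≤-cert _ (sum-nonneg (0≤f ∘ suc)) refl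
  term≤sum {f = f} 0≤f (suc i) = ≤-trans (term≤sum (0≤f ∘ suc) i) (≤-cert _ (0≤f zero) (+-comm _ _))

  𝟙-nonneg : ∀ b → 0# ≤ 𝟙 b
  𝟙-nonneg true  = 0≤1
  𝟙-nonneg false = ≤-refl

  𝟙≤1 : ∀ b → 𝟙 b ≤ 1#
  𝟙≤1 true  = ≤-refl
  𝟙≤1 false = 0≤1

  𝟙-∧ : ∀ a b → 𝟙 (a ∧ b) ≡ 𝟙 a * 𝟙 b
  𝟙-∧ true  b = sym (*-identityˡ (𝟙 b))
  𝟙-∧ false b = sym (zeroˡ (𝟙 b))

  𝟙-yes : ∀ {P : Set} (P? : Dec P) → P → 𝟙 ⌊ P? ⌋ ≡ 1#
  𝟙-yes (yes _) p = refl
  𝟙-yes (no ¬p) p = contradiction p ¬p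

  𝟙-no : ∀ {P : Set} (P? : Dec P) → ¬ P → 𝟙 ⌊ P? ⌋ ≡ 0#
  𝟙-no (yes p) ¬p = contradiction p ¬p
  𝟙-no (no _)  ¬p = refl

  𝟙-⇔ : ∀ {P Q : Set} (P? : Dec P) (Q? : Dec Q) → (P → Q) → (Q → P) → 𝟙 ⌊ P? ⌋ ≡ 𝟙 ⌊ Q? ⌋
  𝟙-⇔ (yes p) Q? f g = sym (𝟙-yes Q? (f p))
  𝟙-⇔ (no ¬p) Q? f g = sym (𝟙-no Q? (¬p ∘ g))

  𝟙-*-mono : ∀ {P : Set} (P? : Dec P) {x y} → (P → x ≤ y) → 𝟙 ⌊ P? ⌋ * x ≤ 𝟙 ⌊ P? ⌋ * y
  𝟙-*-mono (yes p) x≤y        = *-monoˡ-≤ 0≤1 (x≤y p)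
  𝟙-*-mono (no _)  {x} {y} _ = ≤-reflexive (trans (zeroˡ x) (sym (zeroˡ y)))

  𝟙-*-≤ : ∀ {P : Set} (P? : Dec P) {x y} → 0# ≤ y → (P → x ≤ y) → 𝟙 ⌊ P? ⌋ * x ≤ y
  𝟙-*-≤ (yes p) {x} 0≤y x≤y = ≤-trans (≤-reflexive (*-identityˡ x)) (x≤y p)
  𝟙-*-≤ (no _)  {x} 0≤y _   = ≤-trans (≤-reflexive (zeroˡ x)) 0≤y

  ⌊⌋-true : ∀ {P : Set} (P? : Dec P) → ⌊ P? ⌋ ≡ true → P
  ⌊⌋-true (yes p) _ = p

  ⌊⌋-false : ∀ {P : Set} (P? : Dec P) → ⌊ P? ⌋ ≡ false → ¬ P
  ⌊⌋-false (no ¬p) _ = ¬p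

  sum-δ : ∀ {n} (f : Fin n → ℝ) i → sum (λ j → 𝟙 ⌊ i Fin.≟ j ⌋ * f j) ≡ f i
  sum-δ f i = trans
    (sum-single i (λ j j≢i → trans (cong (_* f j) (𝟙-no (i Fin.≟ j) (j≢i ∘ sym))) (zeroˡ (f j))))
    (trans (cong (_* f i) (𝟙-yes (i Fin.≟ i) refl)) (*-identityˡ (f i)))

  count≤1 : ∀ {n} (P : Fin n → Bool) → (∀ i j → P i ≡ true → P j ≡ true → i ≡ j) → sum (𝟙 ∘ P) ≤ 1#
  count≤1 {zero}  P unique = 0≤1
  count≤1 {suc n} P unique with P zero in P0
  ... | false = subst (_≤ 1#) (sym (+-identityˡ _)) (count≤1 (P ∘ suc) λ i j Pi Pj →
      Fin.suc-injective (unique (suc i) (suc j) Pi Pj))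
  ... | true  = ≤-reflexive (trans (cong (1# +_) (sum-zero rest)) (+-identityʳ 1#))
    where
    rest : ∀ i → 𝟙 (P (suc i)) ≡ 0#
    rest i with P (suc i) in Psi
    ... | false = refl
    ... | true  with () ← unique zero (suc i) P0 Psi

  -- Double counting: every counted index lies in the fibre of its label `h i`, and each of the `m`
  -- fibres holds at most one counted index. The labels used later are arrival times and residues
  -- modulo `ℓ`.
  count≤ : ∀ {n m} (P : Fin n → Bool) (h : Fin n → ℕ) → (∀ i → P i ≡ true → h i ℕ.< m) →
           (∀ i j → P i ≡ true → P j ≡ true → h i ≡ h j → i ≡ j) → sum (𝟙 ∘ P) ≤ fromℕ m
  count≤ {n} {m} P h h<m h-inj = begin
    sum (𝟙 ∘ P)                          ≤⟨ sum-mono fibre ⟩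
    sum (λ i → sum (λ r → 𝟙 (Q i r)))    ≡⟨ ∑-comm (λ i r → 𝟙 (Q i r)) ⟩
    sum (λ r → sum (λ i → 𝟙 (Q i r)))    ≤⟨ sum-mono (λ r → count≤1 (λ i → Q i r) (unique r)) ⟩
    sum {m} (λ _ → 1#)                   ≡⟨ trans (sum-const m 1#) (*-identityʳ (fromℕ m)) ⟩
    fromℕ m                              ∎
    where
    open ≤-Reasoning
    Q : Fin n → Fin m → Bool
    Q i r = P i ∧ ⌊ h i ℕ.≟ toℕ r ⌋
    Q-true : ∀ i r → Q i r ≡ true → P i ≡ true × h i ≡ toℕ r
    Q-true i r Qir with P i
    ... | true = refl , ⌊⌋-true (h i ℕ.≟ toℕ r) Qir
    unique : ∀ r i j → Q i r ≡ true → Q j r ≡ true → i ≡ j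
    unique r i j Qi Qj with Q-true i r Qi | Q-true j r Qj
    ... | Pi , hi | Pj , hj = h-inj i j Pi Pj (trans hi (sym hj))
    fibre : ∀ i → 𝟙 (P i) ≤ sum (λ r → 𝟙 (Q i r))
    fibre i with P i in Pi
    ... | false = sum-nonneg {m} (λ r → ≤-refl)
    ... | true  = ≤-trans
      (≤-reflexive (sym (𝟙-yes (h i ℕ.≟ toℕ r₀) (sym (Fin.toℕ-fromℕ< (h<m i Pi))))))
      (term≤sum (λ r → 𝟙-nonneg ⌊ h i ℕ.≟ toℕ r ⌋) r₀)
      where r₀ = fromℕ< (h<m i Pi)

  sum-linear : ∀ {m} a (f : Fin m → ℝ) b (h : Fin m → ℝ) → sum (λ i → a * f i + b * h i)
      ≡ a * sum f + b * sum h
  sum-linear a f b h = trans (∑-distrib-+ (λ i → a * f i) (λ i → b * h i))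
      (sym (cong₂ _+_ (*-distribˡ-sum a f) (*-distribˡ-sum b h)))

  product-nonneg : ∀ {n} {f : Fin n → ℝ} → (∀ i → 0# ≤ f i) → 0# ≤ product f
  product-nonneg {zero}  0≤f = 0≤1
  product-nonneg {suc n} 0≤f = *-nonneg (0≤f zero) (product-nonneg (0≤f ∘ suc))

  product-mono : ∀ {n} {f g : Fin n → ℝ} → (∀ i → 0# ≤ f i) → (∀ i → f i ≤ g i) → product f
      ≤ product g
  product-mono {zero}  0≤f f≤g = ≤-refl
  product-mono {suc n} 0≤f f≤g =
    *-mono-≤ (0≤f zero) (product-nonneg (0≤f ∘ suc)) (f≤g zero)
        (product-mono (0≤f ∘ suc) (f≤g ∘ suc))

  product-cong : ∀ {m} {f h : Fin m → ℝ} → (∀ l → f l ≡ h l) → product f ≡ product h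
  product-cong {zero}  f≡h = refl
  product-cong {suc m} f≡h = cong₂ _*_ (f≡h zero) (product-cong (f≡h ∘ suc))

  product≥1 : ∀ {k} {x : Fin k → ℝ} → (∀ l → 0# ≤ x l) → 1# ≤ product (λ l → 1# + x l)
  product≥1 {zero}  0≤x = ≤-refl
  product≥1 {suc k} {x} 0≤x = subst (_≤ (1# + x zero) * product (λ l → 1# + x (suc l)))
      (*-identityˡ 1#)
    (*-mono-≤ 0≤1 0≤1 (≤-cert (x zero) (0≤x zero) refl) (product≥1 (0≤x ∘ suc)))

-- Exponential inequalities from the power series.

module Exponential (R : RealNumbers) where
  open RealNumbers R
  open OrderedField R
  open FiniteSums R

  ⟶-const : ∀ c → (λ _ → c) ⟶ c
  ⟶-const c δ 0<δ = 0 , λ _ _ →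
      <-cert δ 0<δ (solve 2 (λ c δ → c :- δ :+ δ := c) refl c δ)
    , <-cert δ 0<δ refl

  ⟶-suc : ∀ {a x} → a ⟶ x → (a ∘ suc) ⟶ x
  ⟶-suc a⟶x δ 0<δ with a⟶x δ 0<δ
  ... | M , near = M , λ m M≤m → near (suc m) (ℕ.m≤n⇒m≤1+n M≤m)

  ⟶-+* : ∀ {a b x y c} → 0# ≤ c → a ⟶ x → b ⟶ y → (λ m → a m + c * b m) ⟶ (x + c * y)
  ⟶-+* {a} {b} {x} {y} {c} 0≤c a⟶x b⟶y δ 0<δ with a⟶x η 0<η | b⟶y η 0<η
    where
    0<1+c : 0# < 1# + c
    0<1+c = +-pos 0<1 0≤c
    -- The errors of the two sequences add up to `η + c * η`, which is `δ`.
    η = δ / (1# + c)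
    0<η : 0# < η
    0<η = /-pos 0<δ 0<1+c
  ... | M₁ , near₁ | M₂ , near₂ = M₁ ℕ.⊔ M₂ , λ m M≤m →
    let lo₁ , hi₁ = near₁ m (ℕ.≤-trans (ℕ.m≤m⊔n M₁ M₂) M≤m)
        lo₂ , hi₂ = near₂ m (ℕ.≤-trans (ℕ.m≤n⊔m M₁ M₂) M≤m)
    in <-cert (a m - (x - η) + c * (b m - (y - η)))
        (+-pos (x<y⇒0<y-x lo₁) (*-nonneg 0≤c (<⇒≤ (x<y⇒0<y-x lo₂))))
         (trans (cong (λ u → x + c * y - u + (a m - (x - η) + c * (b m - (y - η)))) (sym η-eq))
           (solve 6 (λ a b x y c η
               → x :+ c :* y :- η :* (num 1 :+ c) :+ (a :- (x :- η) :+ c :* (b :- (y :- η)))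
               := a :+ c :* b)
             refl (a m) (b m) x y c η))
     , <-cert (x + η - a m + c * (y + η - b m))
         (+-pos (x<y⇒0<y-x hi₁) (*-nonneg 0≤c (<⇒≤ (x<y⇒0<y-x hi₂))))
         (trans (solve 6 (λ a b x y c η → a :+ c :* b :+ (x :+ η :- a :+ c :* (y :+ η :- b))
             := x :+ c :* y :+ η :* (num 1 :+ c))
             refl (a m) (b m) x y c η) (cong (x + c * y +_) η-eq))
    where
    η = δ / (1# + c)
    η-eq : η * (1# + c) ≡ δ
    η-eq = /-*-cancel δ (+-pos 0<1 0≤c)

  ⟶-≤ : ∀ {a b x y} → (∀ m → a m ≤ b m) → a ⟶ x → b ⟶ y → x ≤ y
  ⟶-≤ {a} {b} {x} {y} a≤b a⟶x b⟶y = ≮⇒≥ absurd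
    where
    absurd : ¬ y < x
    absurd y<x with a⟶x δ 0<δ | b⟶y δ 0<δ
      where
      -- Half the gap, so that the neighbourhoods of `x` and `y` meet only at the midpoint.
      δ = (x - y) / fromℕ 2
      0<δ : 0# < δ
      0<δ = /-pos (x<y⇒0<y-x y<x) (fromℕ-pos {2} ℕ.z<s)
    ... | M₁ , near₁ | M₂ , near₂ = <-irrefl refl (<-trans (proj₁ (near₁ m (ℕ.m≤m⊔n M₁ M₂)))
          (≤-<-trans (a≤b m) (subst (b m <_) y+δ≡x-δ (proj₂ (near₂ m (ℕ.m≤n⊔m M₁ M₂))))))
      where
      m = M₁ ℕ.⊔ M₂
      δ = (x - y) / fromℕ 2
      y+δ≡x-δ : y + δ ≡ x - δ
      y+δ≡x-δ = trans (solve 3 (λ x y d → y :+ d := (y :+ d :* num 2) :- d) refl x y δ)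
        (trans (cong (λ u → y + u - δ) (/-*-cancel (x - y) (fromℕ-pos {2} ℕ.z<s)))
          (solve 3 (λ x y d → y :+ (x :- y) :- d := x :- d) refl x y δ))

  ^-nonneg : ∀ {x} → 0# ≤ x → ∀ i → 0# ≤ x ^ i
  ^-nonneg 0≤x zero    = 0≤1
  ^-nonneg 0≤x (suc i) = *-nonneg 0≤x (^-nonneg 0≤x i)

  ^-mono : ∀ {x y} → 0# ≤ x → x ≤ y → ∀ i → x ^ i ≤ y ^ i
  ^-mono 0≤x x≤y zero    = ≤-refl
  ^-mono 0≤x x≤y (suc i) = *-mono-≤ 0≤x (^-nonneg 0≤x i) x≤y (^-mono 0≤x x≤y i)

  -- Tangent bound for a power, with the slope at the left end. The induction multiplies by `x + y`
  -- and drops the second-order term in `y`.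
  ^-lower : ∀ {x y} → 0# ≤ x → 0# ≤ y → ∀ i →
            x ^ suc i + y * (fromℕ (suc i) * x ^ i) ≤ (x + y) ^ suc i
  ^-lower {x} {y} 0≤x 0≤y zero = ≤-reflexive
    (solve 2 (λ x y → x :* num 1 :+ y :* ((num 1 :+ num 0) :* num 1) := (x :+ y) :* num 1) refl x y)
  ^-lower {x} {y} 0≤x 0≤y (suc i) = ≤-trans
    (≤-cert (y * y * (fromℕ (suc i) * x ^ i))
        (*-nonneg (square-nonneg y) (*-nonneg (fromℕ-nonneg (suc i)) (^-nonneg 0≤x i)))
      (solve 4 (λ x y m p → x :* (x :* p) :+ y :* ((num 1 :+ m) :* (x :* p)) :+ y :* y :* (m :* p)
                          := (x :+ y) :* (x :* p :+ y :* (m :* p)))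
                              refl x y (fromℕ (suc i)) (x ^ i)))
    (*-monoˡ-≤ (+-nonneg 0≤x 0≤y) (^-lower 0≤x 0≤y i))

  -- The companion bound with the slope at the right end `x + y`, where it is largest.
  ^-upper : ∀ {x y} → 0# ≤ x → 0# ≤ y → ∀ i →
            (x + y) ^ suc i ≤ x ^ suc i + y * (fromℕ (suc i) * (x + y) ^ i)
  ^-upper {x} {y} 0≤x 0≤y zero = ≤-reflexive
    (solve 2 (λ x y → (x :+ y) :* num 1 := x :* num 1 :+ y :* ((num 1 :+ num 0) :* num 1)) refl x y)
  ^-upper {x} {y} 0≤x 0≤y (suc i) = ≤-trans
    (*-monoˡ-≤ (+-nonneg 0≤x 0≤y) (^-upper 0≤x 0≤y i))
    (≤-cert (y * ((x + y) ^ suc i - x ^ suc i))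
      (*-nonneg 0≤y (x≤y⇒0≤y-x (^-mono 0≤x (≤-cert y 0≤y refl) (suc i))))
      (solve 5 (λ x y m p q →
          (x :+ y) :* (x :* p :+ y :* (m :* q)) :+ y :* ((x :+ y) :* q :- x :* p)
                          := x :* (x :* p) :+ y :* ((num 1 :+ m) :* ((x :+ y) :* q)))
                              refl x y (fromℕ (suc i)) (x ^ i) ((x + y) ^ i)))

  expTerm : ℝ → ℕ → ℝ
  expTerm x i = x ^ i / fromℕ (i !)

  private
    0<i! : ∀ i → 0# < fromℕ (i !)
    0<i! i = fromℕ-pos (ℕ.1≤n! i)

    step : ∀ i → fromℕ (i !) ⁻¹ ≡ fromℕ (suc i) * fromℕ (suc i !) ⁻¹
    step i = sym (trans (*≡⇒≡/ (0<i! i) (trans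
      (solve 3 (λ s r f → s :* r :* f := s :* f :* r)
          refl (fromℕ (suc i)) (fromℕ (suc i !) ⁻¹) (fromℕ (i !)))
      (trans (cong (_* fromℕ (suc i !) ⁻¹) (sym (fromℕ-* (suc i) (i !))))
          (x*y⁻¹≡1 (0<i! (suc i))))))
      (*-identityˡ _))

    rescale : ∀ i a b y → a * fromℕ (suc i !) ⁻¹ + y * (b * fromℕ (i !) ⁻¹)
        ≡ (a + y * (fromℕ (suc i) * b)) * fromℕ (suc i !) ⁻¹
    rescale i a b y = trans (cong (λ r → a * fromℕ (suc i !) ⁻¹ + y * (b * r)) (step i))
      (solve 5 (λ a b y s r → a :* r :+ y :* (b :* (s :* r)) := (a :+ y :* (s :* b)) :* r)
          refl a b y (fromℕ (suc i)) (fromℕ (suc i !) ⁻¹))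

  -- Termwise form of `exp` being its own derivative: `suc i / (suc i) !` is `1 / i !`, so the slope
  -- of the term of degree `suc i` is the term of degree `i`.
  expTerm-lower : ∀ {x y} → 0# ≤ x → 0# ≤ y → ∀ i →
                  expTerm x (suc i) + y * expTerm x i ≤ expTerm (x + y) (suc i)
  expTerm-lower {x} {y} 0≤x 0≤y i =
      subst (_≤ expTerm (x + y) (suc i)) (sym (rescale i (x ^ suc i) (x ^ i) y))
    (*-monoʳ-≤ (<⇒≤ (⁻¹-pos (0<i! (suc i)))) (^-lower 0≤x 0≤y i))

  expTerm-upper : ∀ {x y} → 0# ≤ x → 0# ≤ y → ∀ i →
                  expTerm (x + y) (suc i) ≤ expTerm x (suc i) + y * expTerm (x + y) i
  expTerm-upper {x} {y} 0≤x 0≤y i =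
      subst (expTerm (x + y) (suc i) ≤_) (sym (rescale i (x ^ suc i) ((x + y) ^ i) y))
    (*-monoʳ-≤ (<⇒≤ (⁻¹-pos (0<i! (suc i)))) (^-upper 0≤x 0≤y i))

  expSum : ℝ → ℕ → ℝ
  expSum x m = sum {m} (λ i → expTerm x (toℕ i))

  private
    regroup : ∀ x y z m → expSum x (suc m) + y * expSum z m
              ≡ expTerm x 0 + sum {m} (λ i → expTerm x (suc (toℕ i)) + y * expTerm z (toℕ i))
    regroup x y z m = trans (+-assoc _ _ _) (cong (expTerm x 0 +_) (trans
      (cong (sum {m} (λ i → expTerm x (suc (toℕ i))) +_)
          (*-distribˡ-sum {m} y (λ i → expTerm z (toℕ i))))
      (sym (∑-distrib-+ {m} (λ i → expTerm x (suc (toℕ i))) (λ i → y * expTerm z (toℕ i))))))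

  -- With `exp-upper`, a substitute for the functional equation of `exp`. Because of the shift in
  -- degree, the factor of `y` is a partial sum one term shorter than the others; the limit does not
  -- see the difference.
  exp-lower : ∀ {x y} → 0# ≤ x → 0# ≤ y → exp x + y * exp x ≤ exp (x + y)
  exp-lower {x} {y} 0≤x 0≤y = ⟶-≤
    (λ m → subst (_≤ expSum (x + y) (suc m)) (sym (regroup x y x m))
             (+-mono-≤ (≤-refl {expTerm x 0}) (sum-mono {m} (λ i → expTerm-lower 0≤x 0≤y (toℕ i)))))
    (⟶-+* 0≤y (⟶-suc (exp-series x)) (exp-series x)) (⟶-suc (exp-series (x + y)))

  exp-upper : ∀ {x y} → 0# ≤ x → 0# ≤ y → exp (x + y) ≤ exp x + y * exp (x + y)
  exp-upper {x} {y} 0≤x 0≤y = ⟶-≤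
    (λ m → subst (expSum (x + y) (suc m) ≤_) (sym (regroup x y (x + y) m))
             (+-mono-≤ (≤-refl {expTerm x 0}) (sum-mono {m} (λ i → expTerm-upper 0≤x 0≤y (toℕ i)))))
    (⟶-suc (exp-series (x + y))) (⟶-+* 0≤y (⟶-suc (exp-series x)) (exp-series (x + y)))

  exp-0 : exp 0# ≤ 1#
  exp-0 = ⟶-≤ (λ m →
      ≤-reflexive (trans (cong₂ _+_ first (sum-zero {m} (λ i → rest (toℕ i)))) (+-identityʳ 1#)))
    (⟶-suc (exp-series 0#)) (⟶-const 1#)
    where
    first : expTerm 0# 0 ≡ 1#
    first = trans (cong (λ u → 1# * u ⁻¹) (+-identityʳ 1#)) (x*y⁻¹≡1 0<1)
    rest : ∀ i → expTerm 0# (suc i) ≡ 0#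
    rest i = trans (cong (_* fromℕ (suc i !) ⁻¹) (zeroˡ (0# ^ i))) (zeroˡ _)

  exp-nonneg : ∀ {x} → 0# ≤ x → 0# ≤ exp x
  exp-nonneg {x} 0≤x = ⟶-≤
    (λ m → sum-nonneg {m} (λ i → *-nonneg (^-nonneg 0≤x (toℕ i)) (<⇒≤ (⁻¹-pos (0<i! (toℕ i))))))
    (⟶-const 0#) (exp-series x)

  exp-mono : ∀ {x y} → 0# ≤ x → x ≤ y → exp x ≤ exp y
  exp-mono {x} {y} 0≤x x≤y =
      subst (exp x ≤_) (cong exp (solve 2 (λ x y → x :+ (y :- x) := y) refl x y))
    (≤-trans (≤-cert ((y - x) * exp x) (*-nonneg (x≤y⇒0≤y-x x≤y) (exp-nonneg 0≤x)) refl)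
        (exp-lower 0≤x (x≤y⇒0≤y-x x≤y)))

  -- Iterates `exp-lower` over the factors. The offset `z` will be `ln k`: it lets the factor
  -- `k = exp (ln k)` be absorbed without splitting an exponential of a sum.
  exp-product-lower : ∀ {n z} {x : Fin n → ℝ} → 0# ≤ z → (∀ i → 0# ≤ x i) →
                      product (λ i → 1# + x i) * exp z ≤ exp (z + sum x)
  exp-product-lower {zero}  {z} 0≤z 0≤x =
      ≤-reflexive (trans (*-identityˡ (exp z)) (cong exp (sym (+-identityʳ z))))
  exp-product-lower {suc n} {z} {x} 0≤z 0≤x = begin
    (1# + x₀) * product (λ i → 1# + x (suc i)) * exp z    ≡⟨ solve 3
        (λ a b c → (num 1 :+ a) :* b :* c := b :* c :+ a :* (b :* c)) refl x₀ _ _ ⟩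
    P * exp z + x₀ * (P * exp z)                          ≤⟨ +-mono-≤ ih (*-monoˡ-≤ (0≤x zero) ih) ⟩
    exp (z + S) + x₀ * exp (z + S)                        ≤⟨ exp-lower
        (+-nonneg 0≤z (sum-nonneg (0≤x ∘ suc))) (0≤x zero) ⟩
    exp (z + S + x₀)                                      ≡⟨ cong exp (solve 3
        (λ z s x → z :+ s :+ x := z :+ (x :+ s)) refl z S x₀) ⟩
    exp (z + sum x)                                       ∎
    where
    open ≤-Reasoning
    x₀ = x zero
    P = product (λ i → 1# + x (suc i))
    S = sum (x ∘ suc)
    ih = exp-product-lower 0≤z (0≤x ∘ suc)

  -- By 1/(1 - x) ≤ 1 + x + 2x² for 0 ≤ x ≤ 1/2.
  exp-product-upper : ∀ {n} {x : Fin n → ℝ} → (∀ i → 0# ≤ x i) → (∀ i → fromℕ 2 * x i ≤ 1#) →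
                      exp (sum x) ≤ product (λ i → 1# + (x i + fromℕ 2 * (x i * x i)))
  exp-product-upper {zero}  0≤x 2x≤1 = exp-0
  exp-product-upper {suc n} {x} 0≤x 2x≤1 = begin
    exp (x₀ + S)               ≡⟨ cong exp (+-comm x₀ S) ⟩
    E                          ≤⟨ ≤-cert (x₀ * x₀ * (1# - fromℕ 2 * x₀) * E)
                                    (*-nonneg (*-nonneg (square-nonneg x₀) (x≤y⇒0≤y-x (2x≤1 zero)))
                                        (exp-nonneg (+-nonneg 0≤S (0≤x zero))))
                                    (solve 2 (λ x e → e :+ x :* x :* (num 1 :- num 2 :* x) :* e
                                      := (num 1 :+ (x :+ num 2 :* (x :* x))) :* (e :- x :* e))
                                          refl x₀ E) ⟩
    u * (E - x₀ * E)           ≤⟨ *-monoˡ-≤ 0≤u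
        (≤-cert (exp S + x₀ * E - E) (x≤y⇒0≤y-x (exp-upper 0≤S (0≤x zero)))
                                    (solve 3 (λ x e s → e :- x :* e :+ (s :+ x :* e :- e) := s)
                                        refl x₀ E (exp S))) ⟩
    u * exp S                  ≤⟨ *-monoˡ-≤ 0≤u (exp-product-upper (0≤x ∘ suc) (2x≤1 ∘ suc)) ⟩
    u * product (λ i → 1# + (x (suc i) + fromℕ 2 * (x (suc i) * x (suc i)))) ∎
    where
    open ≤-Reasoning
    x₀ = x zero
    S = sum (x ∘ suc)
    E = exp (S + x₀)
    u = 1# + (x₀ + fromℕ 2 * (x₀ * x₀))
    0≤S : 0# ≤ S
    0≤S = sum-nonneg (0≤x ∘ suc)
    0≤u : 0# ≤ u
    0≤u = +-nonneg 0≤1 (+-nonneg (0≤x zero) (*-nonneg (fromℕ-nonneg 2) (square-nonneg x₀)))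

-- Action of a transposition on indices.

module _ {n} (i j : Fin n) where

  transpose-ˡ : transpose i j ⟨$⟩ʳ i ≡ j
  transpose-ˡ with i Fin.≟ i
  ... | yes _  = refl
  ... | no i≢i = contradiction refl i≢i

  transpose-ʳ : transpose i j ⟨$⟩ʳ j ≡ i
  transpose-ʳ with j Fin.≟ i
  ... | yes j≡i = j≡i
  ... | no _ with j Fin.≟ j
  ...   | yes _  = refl
  ...   | no j≢j = contradiction refl j≢j

  transpose-fixes : ∀ {k} → k ≢ i → k ≢ j → transpose i j ⟨$⟩ʳ k ≡ k
  transpose-fixes {k} k≢i k≢j with k Fin.≟ i
  ... | yes k≡i = contradiction k≡i k≢i
  ... | no _ with k Fin.≟ j
  ...   | yes k≡j = contradiction k≡j k≢j
  ...   | no _    = refl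

-- Linearity and monotonicity of expectation.

module Expectation (R : RealNumbers) (space : Model.FiniteProbabilitySpace R) where
  open RealNumbers R
  open OrderedField R
  open FiniteSums R
  open Model.FiniteProbabilitySpace space

  𝔼-cong : ∀ {f g : Ω → ℝ} → (∀ ω → f ω ≡ g ω) → 𝔼 f ≡ 𝔼 g
  𝔼-cong f≡g = sum-cong (λ ω → cong (weight ω *_) (f≡g ω))

  𝔼-mono : ∀ {f g : Ω → ℝ} → (∀ ω → f ω ≤ g ω) → 𝔼 f ≤ 𝔼 g
  𝔼-mono f≤g = sum-mono (λ ω → *-monoˡ-≤ (weight-nonneg ω) (f≤g ω))

  𝔼-nonneg : ∀ {f : Ω → ℝ} → (∀ ω → 0# ≤ f ω) → 0# ≤ 𝔼 f
  𝔼-nonneg 0≤f = sum-nonneg (λ ω → *-nonneg (weight-nonneg ω) (0≤f ω))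

  𝔼-+ : ∀ (f g : Ω → ℝ) → 𝔼 (λ ω → f ω + g ω) ≡ 𝔼 f + 𝔼 g
  𝔼-+ f g = trans (sum-cong (λ ω → distribˡ (weight ω) (f ω) (g ω)))
      (∑-distrib-+ (λ ω → weight ω * f ω) (λ ω → weight ω * g ω))

  𝔼-* : ∀ c (f : Ω → ℝ) → 𝔼 (λ ω → c * f ω) ≡ c * 𝔼 f
  𝔼-* c f = trans (sum-cong (λ ω → solve 3 (λ w c f → w :* (c :* f) := c :* (w :* f))
      refl (weight ω) c (f ω)))
    (sym (*-distribˡ-sum c (λ ω → weight ω * f ω)))

  𝔼-const : ∀ c → 𝔼 (λ _ → c) ≡ c
  𝔼-const c = trans (sym (*-distribʳ-sum c weight))
      (trans (cong (_* c) weight-total) (*-identityˡ c))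

  𝔼-sum : ∀ {m} (f : Fin m → Ω → ℝ) → 𝔼 (λ ω → sum (λ i → f i ω)) ≡ sum (λ i → 𝔼 (f i))
  𝔼-sum f = trans (sum-cong (λ ω → *-distribˡ-sum (weight ω) (λ i → f i ω)))
      (∑-comm (λ ω i → weight ω * f i ω))

-- Exchangeability of the arrival order.

module RandomOrder (R : RealNumbers) (inst : Model.Instance R) (run : Model.Execution R inst) where
  open RealNumbers R
  open OrderedField R
  open FiniteSums R
  open Exponential R
  open Model R
  open Instance inst
  open Execution run
  open Expectation R space

  J : Ω → Fin N → Fin n
  J ω = timeOf (I ω)

  J∈RO : ∀ ω i → J ω i ∈ RO
  J∈RO ω i = proj₂ (Inverse.from (I ω) i)

  itemAt-J : ∀ ω {s} (s∈RO : s ∈ RO) → J ω (itemAt (I ω) s∈RO) ≡ s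
  itemAt-J ω s∈RO = cong proj₁ (Inverse.inverseʳ (I ω) refl)

  J⇒itemAt : ∀ ω {s} (s∈RO : s ∈ RO) {i} → J ω i ≡ s → itemAt (I ω) s∈RO ≡ i
  J⇒itemAt ω {s} s∈RO {i} refl = trans
    (cong (λ p → Inverse.to (I ω) (s , p)) ([]=-irrelevant s∈RO (J∈RO ω i)))
    (Inverse.inverseˡ (I ω) refl)

  J-injective : ∀ ω {i j} → J ω i ≡ J ω j → i ≡ j
  J-injective ω {i} {j} eq = trans (sym (J⇒itemAt ω (J∈RO ω j) eq)) (J⇒itemAt ω (J∈RO ω j) refl)

  -- The flip makes item `i` take over the arrival time of item `π ⟨$⟩ʳ i`, so that the vector of
  -- arrival times is precomposed with `π`.
  permuted : Permutation′ N → Arrival → Arrival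
  permuted π σ = Perm.flip π ↔-∘ σ

  -- `same` identifies arrivals pointwise only, so a functional can be carried along it just when it
  -- respects pointwise equality.
  Extensional : ((Fin N → Fin n) → ℝ) → Set
  Extensional f = ∀ {x y} → (∀ i → x i ≡ y i) → f x ≡ f y

  -- I-uniform says that the law of I is constant on atoms.  Writing the
  -- constant 1 / N! as Pr (same _ σ) turns both sides into sums over a second,
  -- independent copy of I, where the permutation can be moved across.
  exchangeable : ∀ {f} → Extensional f → (π : Permutation′ N) →
                 𝔼 (λ ω → f (J ω ∘ (π ⟨$⟩ʳ_))) ≡ 𝔼 (f ∘ J)
  exchangeable {f} f-ext π =
      ≤-antisym (cancel (≤-reflexive scaled)) (cancel (≤-reflexive (sym scaled)))
    where
    open ≡-Reasoning
    κ : ℝ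
    κ = 1# / fromℕ (N !)
    0<κ : 0# < κ
    0<κ = /-pos 0<1 (fromℕ-pos (ℕ.1≤n! N))
    cancel : ∀ {x y} → κ * x ≤ κ * y → x ≤ y
    cancel = *-cancelˡ-≤ 0<κ
    expand : (g : Ω → ℝ) (σ : Ω → Arrival) →
             κ * 𝔼 g ≡ sum (λ ω → sum (λ ω' → weight ω * weight ω' * (𝟙 (same (I ω') (σ ω)) * g ω)))
    expand g σ = trans (*-distribˡ-sum κ (λ ω → weight ω * g ω)) (sum-cong {size} λ ω → begin
      κ * (weight ω * g ω)
        ≡⟨ cong (_* (weight ω * g ω)) (sym (I-uniform (σ ω))) ⟩
      Pr (λ ω' → same (I ω') (σ ω)) * (weight ω * g ω)
        ≡⟨ *-distribʳ-sum (weight ω * g ω) (λ ω' → weight ω' * 𝟙 (same (I ω') (σ ω))) ⟩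
      sum (λ ω' → weight ω' * 𝟙 (same (I ω') (σ ω)) * (weight ω * g ω))
        ≡⟨ sum-cong {size} (λ ω' → solve 4 (λ a b c d → a :* b :* (c :* d) := c :* a :* (b :* d))
            refl
            (weight ω') (𝟙 (same (I ω') (σ ω))) (weight ω) (g ω)) ⟩
      sum (λ ω' → weight ω * weight ω' * (𝟙 (same (I ω') (σ ω)) * g ω)) ∎)
    π⁻¹ : Permutation′ N
    π⁻¹ = Perm.flip π
    -- Both indicators express that `J ω'` is `J ω` precomposed with `π`; on that event the two
    -- values of `f` agree.
    π-move : ∀ ω ω' → 𝟙 (same (I ω') (permuted π (I ω))) * f (J ω ∘ (π ⟨$⟩ʳ_))
                    ≡ 𝟙 (same (I ω) (permuted π⁻¹ (I ω'))) * f (J ω')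
    π-move ω ω' with Fin.all? (λ i → timeOf (I ω') i Fin.≟ timeOf (permuted π (I ω)) i)
    ... | yes eq = cong₂ _*_
      (sym (𝟙-yes (Fin.all? (λ i → timeOf (I ω) i Fin.≟ timeOf (permuted π⁻¹ (I ω')) i))
        (λ i → trans (cong (J ω) (sym (Perm.inverseʳ π))) (sym (eq (π ⟨$⟩ˡ i))))))
      (f-ext (λ i → sym (eq i)))
    ... | no ¬eq = trans (zeroˡ _) (sym (trans (cong (_* f (J ω'))
      (𝟙-no (Fin.all? (λ i → timeOf (I ω) i Fin.≟ timeOf (permuted π⁻¹ (I ω')) i))
        (λ eq → ¬eq (λ i → trans (cong (J ω') (sym (Perm.inverseˡ π))) (sym (eq (π ⟨$⟩ʳ i)))))))
      (zeroˡ (f (J ω')))))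
    scaled : κ * 𝔼 (λ ω → f (J ω ∘ (π ⟨$⟩ʳ_))) ≡ κ * 𝔼 (f ∘ J)
    scaled = begin
      κ * 𝔼 (λ ω → f (J ω ∘ (π ⟨$⟩ʳ_)))
        ≡⟨ expand (λ ω → f (J ω ∘ (π ⟨$⟩ʳ_))) (λ ω → permuted π (I ω)) ⟩
      sum (λ ω → sum (λ ω'
          → weight ω * weight ω' * (𝟙 (same (I ω') (permuted π (I ω))) * f (J ω ∘ (π ⟨$⟩ʳ_)))))
        ≡⟨ sum-cong (λ ω → sum-cong λ ω' →
            cong₂ _*_ (*-comm (weight ω) (weight ω')) (π-move ω ω')) ⟩
      sum (λ ω → sum (λ ω'
          → weight ω' * weight ω * (𝟙 (same (I ω) (permuted π⁻¹ (I ω'))) * f (J ω'))))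
        ≡⟨ ∑-comm (λ ω ω' →
            weight ω' * weight ω * (𝟙 (same (I ω) (permuted π⁻¹ (I ω'))) * f (J ω'))) ⟩
      sum (λ ω' → sum (λ ω
          → weight ω' * weight ω * (𝟙 (same (I ω) (permuted π⁻¹ (I ω'))) * f (J ω'))))
        ≡⟨ expand (f ∘ J) (λ ω' → permuted π⁻¹ (I ω')) ⟨
      κ * 𝔼 (f ∘ J) ∎

-- Chernoff bound for weights of items arriving in a set of times.

module Concentration (R : RealNumbers) (inst : Model.Instance R) (run : Model.Execution R inst)
  (t : Fin (Model.Instance.n inst)) where
  open RealNumbers R
  open OrderedField R
  open FiniteSums R
  open Exponential R
  open Model R
  open Instance inst
  open Execution run
  open Expectation R space
  open RandomOrder R inst run

  -- Multiplication by `E i` plays the role of conditioning on item `i` arriving at `t`. It is a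
  -- functional of the arrival vector, so that `exchangeable` applies to products with it.
  E : Fin N → (Fin N → Fin n) → ℝ
  E i x = 𝟙 ⌊ x i Fin.≟ t ⌋

  E-ext : ∀ i → Extensional (E i)
  E-ext i x≗y = cong (λ s → 𝟙 ⌊ s Fin.≟ t ⌋) (x≗y i)

  E-nonneg : ∀ i x → 0# ≤ E i x
  E-nonneg i x = 𝟙-nonneg ⌊ x i Fin.≟ t ⌋

  -- Transposing two items shows all of them equally likely at `t`, and exactly one of them is
  -- there.
  arrival-uniform : t ∈ RO → ∀ i → 𝔼 (E i ∘ J) ≡ 1# / fromℕ N
  arrival-uniform t∈RO i = *≡⇒≡/ 0<N (trans (*-comm _ _) (begin
    fromℕ N * 𝔼 (E i ∘ J)          ≡⟨ sum-const N _ ⟨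
    sum {N} (λ _ → 𝔼 (E i ∘ J))    ≡⟨ sum-cong same-law ⟩
    sum (λ j → 𝔼 (E j ∘ J))        ≡⟨ 𝔼-sum (λ j → E j ∘ J) ⟨
    𝔼 (λ ω → sum (λ j → E j (J ω))) ≡⟨ 𝔼-cong exactly-one ⟩
    𝔼 (λ _ → 1#)                   ≡⟨ 𝔼-const 1# ⟩
    1#                             ∎))
    where
    open ≡-Reasoning
    0<N : 0# < fromℕ N
    0<N = fromℕ-pos (ℕ.≤-<-trans ℕ.z≤n (Fin.toℕ<n i))
    same-law : ∀ j → 𝔼 (E i ∘ J) ≡ 𝔼 (E j ∘ J)
    same-law j = trans
      (𝔼-cong (λ ω → cong (λ l → 𝟙 ⌊ J ω l Fin.≟ t ⌋) (sym (transpose-ʳ i j))))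
      (exchangeable (E-ext j) (transpose i j))
    exactly-one : ∀ ω → sum (λ j → E j (J ω)) ≡ 1#
    exactly-one ω = trans
      (sum-single i₀ (λ j j≢i₀ → 𝟙-no (J ω j Fin.≟ t) (λ eq → j≢i₀ (sym (J⇒itemAt ω t∈RO eq)))))
      (𝟙-yes (J ω i₀ Fin.≟ t) (itemAt-J ω t∈RO))
      where i₀ = itemAt (I ω) t∈RO

  module _ (A : Fin n → Bool) where

    Z : Fin N → (Fin N → Fin n) → ℝ
    Z j x = 𝟙 (A (x j))

    Z-ext : ∀ j → Extensional (Z j)
    Z-ext j x≗y = cong (𝟙 ∘ A) (x≗y j)

    Z-nonneg : ∀ j x → 0# ≤ Z j x
    Z-nonneg j x = 𝟙-nonneg (A (x j))

    -- A multilinear moment generating function: as a product of factors that are affine in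
    -- indicators, it can be expanded one item at a time. `g` lists the items that occur, so that an
    -- induction can remove them.
    G : ∀ {m} → (Fin m → ℝ) → (Fin m → Fin N) → (Fin N → Fin n) → ℝ
    G u g x = product (λ l → 1# + u l * Z (g l) x)

    G-ext : ∀ {m} (u : Fin m → ℝ) g → Extensional (G u g)
    G-ext u g x≗y = product-cong (λ l → cong (λ z → 1# + u l * z) (Z-ext (g l) x≗y))

    module _ {m} {u : Fin m → ℝ} (0≤u : ∀ l → 0# ≤ u l) (g : Fin m → Fin N) where

      factor-nonneg : ∀ l x → 0# ≤ 1# + u l * Z (g l) x
      factor-nonneg l x = +-nonneg 0≤1 (*-nonneg (0≤u l) (Z-nonneg (g l) x))

      G-nonneg : ∀ x → 0# ≤ G u g x
      G-nonneg x = product-nonneg (λ l → factor-nonneg l x)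

      G-mono : ∀ {x y} → (∀ l → Z (g l) x ≤ Z (g l) y) → G u g x ≤ G u g y
      G-mono {x} Zx≤Zy =
          product-mono (λ l → factor-nonneg l x)
          (λ l → +-mono-≤ ≤-refl (*-monoˡ-≤ (0≤u l) (Zx≤Zy l)))

      -- Among the items with Z = 1 some already boost G; so Z j is less
      -- correlated with G for j outside the range of g than for any other item.
      -- Adding to each side its image under the exchange of j and j' makes the
      -- comparison hold pointwise.
      fresh-least-correlated : ∀ {i j} j' → j ≢ i → j' ≢ i → (∀ l → g l ≢ j) →
        𝔼 (λ ω → E i (J ω) * (Z j (J ω) * G u g (J ω)))
            ≤ 𝔼 (λ ω → E i (J ω) * (Z j' (J ω) * G u g (J ω)))
      fresh-least-correlated {i} {j} j' j≢i j'≢i j∉g = halve (begin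
        𝔼 (f j ∘ J) + 𝔼 (f j ∘ J)             ≡⟨ double j ⟩
        𝔼 (λ ω → f j (J ω) + f j (σ (J ω)))   ≤⟨ 𝔼-mono (λ ω → pointwise (J ω)) ⟩
        𝔼 (λ ω → f j' (J ω) + f j' (σ (J ω))) ≡⟨ double j' ⟨
        𝔼 (f j' ∘ J) + 𝔼 (f j' ∘ J)           ∎)
        where
        open ≤-Reasoning
        π : Permutation′ N
        π = transpose j j'
        σ : (Fin N → Fin n) → (Fin N → Fin n)
        σ x = x ∘ (π ⟨$⟩ʳ_)
        f : Fin N → (Fin N → Fin n) → ℝ
        f l x = E i x * (Z l x * G u g x)
        double : ∀ l → 𝔼 (f l ∘ J) + 𝔼 (f l ∘ J) ≡ 𝔼 (λ ω → f l (J ω) + f l (σ (J ω)))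
        double l = trans (cong (𝔼 (f l ∘ J) +_) (sym (exchangeable
            (λ x≗y → cong₂ _*_ (E-ext i x≗y) (cong₂ _*_ (Z-ext l x≗y) (G-ext u g x≗y))) π)))
          (sym (𝔼-+ (f l ∘ J) (f l ∘ σ ∘ J)))
        halve : ∀ {x y} → x + x ≤ y + y → x ≤ y
        halve {x} {y} 2x≤2y =
            *-cancelˡ-≤ (fromℕ-pos {2} ℕ.z<s) (subst₂ _≤_ (twice x) (twice y) 2x≤2y)
          where
          twice : ∀ x → x + x ≡ fromℕ 2 * x
          twice = solve 1 (λ x → x :+ x := num 2 :* x) refl
        pointwise : ∀ x → f j x + f j (σ x) ≤ f j' x + f j' (σ x)
        pointwise x = begin
          f j x + f j (σ x)
            ≡⟨ cong₂ (λ e z → E i x * (Z j x * G u g x) + e * (z * G u g (σ x))) E-σ Zj-σ ⟩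
          E i x * (Z j x * G u g x) + E i x * (Z j' x * G u g (σ x))
            ≡⟨ distribˡ _ _ _ ⟨
          E i x * (Z j x * G u g x + Z j' x * G u g (σ x))
            ≤⟨ *-monoˡ-≤ (E-nonneg i x) crossed ⟩
          E i x * (Z j' x * G u g x + Z j x * G u g (σ x))
            ≡⟨ distribˡ _ _ _ ⟩
          E i x * (Z j' x * G u g x) + E i x * (Z j x * G u g (σ x))
            ≡⟨ cong₂ (λ e z → E i x * (Z j' x * G u g x) + e * (z * G u g (σ x))) E-σ Zj'-σ ⟨
          f j' x + f j' (σ x) ∎
          where
          E-σ : E i (σ x) ≡ E i x
          E-σ = cong (λ l → 𝟙 ⌊ x l Fin.≟ t ⌋) (transpose-fixes j j' (j≢i ∘ sym) (j'≢i ∘ sym))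
          Zj-σ : Z j (σ x) ≡ Z j' x
          Zj-σ = cong (𝟙 ∘ A ∘ x) (transpose-ˡ j j')
          Zj'-σ : Z j' (σ x) ≡ Z j x
          Zj'-σ = cong (𝟙 ∘ A ∘ x) (transpose-ʳ j j')
          -- The exchange affects only the factor of `j'`, which then sees the arrival time of `j`;
          -- the item `j` itself has no factor.
          Zg-σ : ∀ l → (g l ≡ j' × Z (g l) (σ x) ≡ Z j x) ⊎ Z (g l) (σ x) ≡ Z (g l) x
          Zg-σ l with g l Fin.≟ j'
          ... | yes gl≡j' = inj₁ (gl≡j' , trans (cong (λ l → Z l (σ x)) gl≡j') Zj'-σ)
          ... | no  gl≢j' = inj₂ (cong (𝟙 ∘ A ∘ x) (transpose-fixes j j' (j∉g l) gl≢j'))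
          G≤Gσ : Z j x ≡ 1# → G u g x ≤ G u g (σ x)
          G≤Gσ Zj≡1 = G-mono {x} {σ x} λ l → case (Zg-σ l)
            where
            case : ∀ {l} → (g l ≡ j' × Z (g l) (σ x) ≡ Z j x) ⊎ Z (g l) (σ x)
                ≡ Z (g l) x → Z (g l) x ≤ Z (g l) (σ x)
            case {l} (inj₁ (_ , eq)) = subst (Z (g l) x ≤_) (sym (trans eq Zj≡1))
                (𝟙≤1 (A (x (g l))))
            case (inj₂ eq)       = ≤-reflexive (sym eq)
          Gσ≤G : Z j x ≡ 0# → G u g (σ x) ≤ G u g x
          Gσ≤G Zj≡0 = G-mono {σ x} {x} λ l → case (Zg-σ l)
            where
            case : ∀ {l} → (g l ≡ j' × Z (g l) (σ x) ≡ Z j x) ⊎ Z (g l) (σ x)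
                ≡ Z (g l) x → Z (g l) (σ x) ≤ Z (g l) x
            case {l} (inj₁ (_ , eq)) = subst (_≤ Z (g l) x) (sym (trans eq Zj≡0)) (Z-nonneg (g l) x)
            case (inj₂ eq)       = ≤-reflexive eq
          -- This is `(Z j x - Z j' x) * (G u g (σ x) - G u g x) ≥ 0`: whenever the indicators
          -- differ, the two brackets have the same sign.
          crossed : Z j x * G u g x + Z j' x * G u g (σ x) ≤ Z j' x * G u g x + Z j x * G u g (σ x)
          crossed with A (x j) in Axj | A (x j') in Axj'
          ... | true  | true  = ≤-refl
          ... | false | false = ≤-refl
          ... | true  | false = begin
            1# * G u g x + 0# * G u g (σ x) ≡⟨ solve 2 (λ a b → num 1 :* a :+ num 0 :* b := a)
                refl (G u g x) (G u g (σ x)) ⟩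
            G u g x                         ≤⟨ G≤Gσ (cong 𝟙 Axj) ⟩
            G u g (σ x)                     ≡⟨ solve 2 (λ a b → num 0 :* a :+ num 1 :* b := b)
                refl (G u g x) (G u g (σ x)) ⟨
            0# * G u g x + 1# * G u g (σ x) ∎
          ... | false | true  = begin
            0# * G u g x + 1# * G u g (σ x) ≡⟨ solve 2 (λ a b → num 0 :* a :+ num 1 :* b := b)
                refl (G u g x) (G u g (σ x)) ⟩
            G u g (σ x)                     ≤⟨ Gσ≤G (cong 𝟙 Axj) ⟩
            G u g x                         ≡⟨ solve 2 (λ a b → num 1 :* a :+ num 0 :* b := a)
                refl (G u g x) (G u g (σ x)) ⟨
            1# * G u g x + 0# * G u g (σ x) ∎

    module _ (A-t : A t ≡ false) {m q : ℝ} (0≤q : 0# ≤ q) (0<N-1 : 0# < fromℕ N - 1#) (m≤q[N-1] : m ≤ q * (fromℕ N - 1#))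
             (ΣZ≤m : ∀ ω → sum (λ j → Z j (J ω)) ≤ m) where

      -- Averaging: the fresh item is the least correlated of the `N - 1` items other than `i`,
      -- while all items together contribute at most `m` times the right-hand expectation. For
      -- `j = i` the left side vanishes, since item `i` sits at `t` and `t` is outside `A`.
      fresh-bound : ∀ {k} {u : Fin k → ℝ} → (∀ l → 0# ≤ u l) → (g : Fin k → Fin N) → ∀ {j} →
          (∀ l → g l ≢ j) → ∀ i →
        𝔼 (λ ω → E i (J ω) * (Z j (J ω) * G u g (J ω))) ≤ q * 𝔼 (λ ω → E i (J ω) * G u g (J ω))
      fresh-bound {u = u} 0≤u g {j} j∉g i with j Fin.≟ i
      ... | yes refl = ≤-trans (≤-reflexive (trans (𝔼-cong vanish) (𝔼-const 0#)))
          (*-nonneg 0≤q (𝔼-nonneg EG-nonneg))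
        where
        EG-nonneg : ∀ ω → 0# ≤ E i (J ω) * G u g (J ω)
        EG-nonneg ω = *-nonneg (E-nonneg i (J ω)) (G-nonneg 0≤u g (J ω))
        vanish : ∀ ω → E i (J ω) * (Z i (J ω) * G u g (J ω)) ≡ 0#
        vanish ω with J ω i Fin.≟ t
        ... | no _   = zeroˡ _
        ... | yes eq =
            trans (*-identityˡ _) (trans (cong (_* G u g (J ω)) (cong 𝟙 (trans (cong A eq) A-t)))
            (zeroˡ _))
      ... | no j≢i = *-cancelˡ-≤ 0<N-1 (begin
        (fromℕ N - 1#) * C    ≡⟨ solve 2 (λ c x → (c :- num 1) :* x := c :* x :- x)
            refl (fromℕ N) C ⟩
        fromℕ N * C - C       ≤⟨ +-mono-≤ N*C≤ ≤-refl ⟩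
        (m * Y + C) - C       ≡⟨ solve 3 (λ m x y → (m :* y :+ x) :- x := m :* y) refl m C Y ⟩
        m * Y                 ≤⟨ *-monoʳ-≤ (𝔼-nonneg EG-nonneg) m≤q[N-1] ⟩
        q * (fromℕ N - 1#) * Y ≡⟨ solve 3 (λ q c y → q :* c :* y := c :* (q :* y))
            refl q (fromℕ N - 1#) Y ⟩
        (fromℕ N - 1#) * (q * Y) ∎)
        where
        open ≤-Reasoning
        C′ : Fin N → ℝ
        C′ j' = 𝔼 (λ ω → E i (J ω) * (Z j' (J ω) * G u g (J ω)))
        C = C′ j
        Y = 𝔼 (λ ω → E i (J ω) * G u g (J ω))
        EG-nonneg : ∀ ω → 0# ≤ E i (J ω) * G u g (J ω)
        EG-nonneg ω = *-nonneg (E-nonneg i (J ω)) (G-nonneg 0≤u g (J ω))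
        C′-nonneg : ∀ j' → 0# ≤ C′ j'
        C′-nonneg j' =
            𝔼-nonneg (λ ω → *-nonneg (E-nonneg i (J ω))
            (*-nonneg (Z-nonneg j' (J ω)) (G-nonneg 0≤u g (J ω))))
        -- At `j' = i` the comparison may fail, so this one index is charged a full `C`; the extra
        -- `C` is what turns `N` into `N - 1`.
        compare-with : ∀ j' → C ≤ C′ j' + 𝟙 ⌊ i Fin.≟ j' ⌋ * C
        compare-with j' with i Fin.≟ j'
        ... | yes _   = ≤-cert (C′ j') (C′-nonneg j') (solve 2 (λ x y → x :+ y := y :+ num 1 :* x)
            refl C (C′ j'))
        ... | no i≢j' = ≤-trans (fresh-least-correlated 0≤u g j' j≢i (i≢j' ∘ sym) j∉g)
                          (≤-reflexive (solve 2 (λ x y → y := y :+ num 0 :* x) refl C (C′ j')))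
        regroup : ∀ ω → sum (λ j' → E i (J ω) * (Z j' (J ω) * G u g (J ω)))
            ≡ sum (λ j' → Z j' (J ω)) * (E i (J ω) * G u g (J ω))
        regroup ω = trans
          (sum-cong (λ j' → solve 3 (λ a b c → a :* (b :* c) := b :* (a :* c))
              refl (E i (J ω)) (Z j' (J ω)) (G u g (J ω))))
          (sym (*-distribʳ-sum (E i (J ω) * G u g (J ω)) (λ j' → Z j' (J ω))))
        N*C≤ : fromℕ N * C ≤ m * Y + C
        N*C≤ = begin
          fromℕ N * C                               ≡⟨ sum-const N C ⟨
          sum {N} (λ _ → C)                         ≤⟨ sum-mono compare-with ⟩
          sum (λ j' → C′ j' + 𝟙 ⌊ i Fin.≟ j' ⌋ * C) ≡⟨ ∑-distrib-+ C′
              (λ j' → 𝟙 ⌊ i Fin.≟ j' ⌋ * C) ⟩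
          sum C′ + sum (λ j' → 𝟙 ⌊ i Fin.≟ j' ⌋ * C) ≡⟨ cong (sum C′ +_) (sum-δ (λ _ → C) i) ⟩
          sum C′ + C                                ≡⟨ cong (_+ C)
              (𝔼-sum (λ j' ω → E i (J ω) * (Z j' (J ω) * G u g (J ω)))) ⟨
          𝔼 (λ ω → sum (λ j' → E i (J ω) * (Z j' (J ω) * G u g (J ω)))) + C
            ≤⟨ +-mono-≤ (𝔼-mono
                (λ ω → ≤-trans (≤-reflexive (regroup ω))
                (*-monoʳ-≤ (EG-nonneg ω) (ΣZ≤m ω)))) ≤-refl ⟩
          𝔼 (λ ω → m * (E i (J ω) * G u g (J ω))) + C ≡⟨ cong (_+ C) (𝔼-* m _) ⟩
          m * Y + C ∎

      -- Expand the first factor: its indicator is replaced by `q` through `fresh-bound`.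
      -- Injectivity of `g` is what makes the item fresh with respect to the remaining factors.
      mgf-bound : ∀ {k} {u : Fin k → ℝ} → (∀ l → 0# ≤ u l) → (g : Fin k → Fin N) →
          (∀ {l l'} → g l ≡ g l' → l ≡ l') → ∀ i →
        𝔼 (λ ω → E i (J ω) * G u g (J ω)) ≤ product (λ l → 1# + u l * q) * 𝔼 (E i ∘ J)
      mgf-bound {zero}  0≤u g g-inj i =
          ≤-reflexive (trans (𝔼-cong (λ ω → *-identityʳ (E i (J ω)))) (sym (*-identityˡ _)))
      mgf-bound {suc k} {u} 0≤u g g-inj i = begin
        𝔼 (λ ω → E i (J ω) * ((1# + u₀ * Z₀ ω) * G' ω))
          ≡⟨ 𝔼-cong (λ ω → solve 4 (λ e u z g → e :* ((num 1 :+ u :* z) :* g)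
              := e :* g :+ u :* (e :* (z :* g))) refl (E i (J ω)) u₀ (Z₀ ω) (G' ω)) ⟩
        𝔼 (λ ω → E i (J ω) * G' ω + u₀ * (E i (J ω) * (Z₀ ω * G' ω)))
          ≡⟨ trans (𝔼-+ (λ ω → E i (J ω) * G' ω) _)
              (cong (𝔼 (λ ω → E i (J ω) * G' ω) +_) (𝔼-* u₀ _)) ⟩
        Y + u₀ * 𝔼 (λ ω → E i (J ω) * (Z₀ ω * G' ω))
          ≤⟨ +-mono-≤ ≤-refl
              (*-monoˡ-≤ (0≤u zero)
              (fresh-bound (0≤u ∘ suc) (g ∘ suc) (λ l eq → 1+l≢0 (g-inj eq)) i)) ⟩
        Y + u₀ * (q * Y)
          ≡⟨ solve 3 (λ u q y → y :+ u :* (q :* y) := (num 1 :+ u :* q) :* y) refl u₀ q Y ⟩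
        (1# + u₀ * q) * Y
          ≤⟨ *-monoˡ-≤ (+-nonneg 0≤1 (*-nonneg (0≤u zero) 0≤q))
              (mgf-bound (0≤u ∘ suc) (g ∘ suc) (Fin.suc-injective ∘ g-inj) i) ⟩
        (1# + u₀ * q) * (product (λ l → 1# + u (suc l) * q) * 𝔼 (E i ∘ J))
          ≡⟨ *-assoc _ _ _ ⟨
        product (λ l → 1# + u l * q) * 𝔼 (E i ∘ J) ∎
        where
        open ≤-Reasoning
        u₀ = u zero
        Z₀ : Ω → ℝ
        Z₀ ω = Z (g zero) (J ω)
        G' : Ω → ℝ
        G' ω = G (u ∘ suc) (g ∘ suc) (J ω)
        Y = 𝔼 (λ ω → E i (J ω) * G' ω)
        1+l≢0 : ∀ {l : Fin k} → suc l ≢ zero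
        1+l≢0 ()

      -- Markov's inequality for `G` in place of the exponential. The hypothesis `exponent` says
      -- that the bound `P` on the generating function satisfies `P * k ≤ exp (λ′ * a)`, so only a
      -- fraction `1 / k` of the event that item `i` is at `t` survives.
      tail-bound : ∀ {y : Fin N → ℝ} {λ′ a} → (∀ j → 0# ≤ y j) → (∀ j → y j ≤ 1#) →
        0# ≤ λ′ → fromℕ 2 * λ′ ≤ 1# → 0# < k → 0# ≤ ln k →
        ln k + (λ′ + fromℕ 2 * (λ′ * λ′)) * (q * sum y) ≤ λ′ * a → ∀ i →
        𝔼 (λ ω → E i (J ω) * 𝟙 ⌊ a ≤? sum (λ j → y j * Z j (J ω)) ⌋) * k ≤ 𝔼 (E i ∘ J)
      tail-bound {y} {λ′} {a} 0≤y y≤1 0≤λ 2λ≤1 0<k 0≤lnk exponent i = *-cancelˡ-≤ 0<P (begin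
        P * (B * k)                                ≡⟨ solve 3 (λ p b k → p :* (b :* k)
            := b :* (p :* k)) refl P B k ⟩
        B * (P * k)                                ≤⟨ *-monoˡ-≤ 0≤B P*k≤ ⟩
        B * exp (λ′ * a)                           ≡⟨ *-comm B (exp (λ′ * a)) ⟩
        exp (λ′ * a) * B                           ≡⟨ 𝔼-* (exp (λ′ * a)) _ ⟨
        𝔼 (λ ω → exp (λ′ * a) * (E i (J ω) * 𝟙 (over ω))) ≤⟨ 𝔼-mono markov ⟩
        𝔼 (λ ω → E i (J ω) * G u id (J ω))         ≤⟨ mgf-bound 0≤u id id i ⟩
        P * 𝔼 (E i ∘ J)                            ∎)
        where
        open ≤-Reasoning
        -- From `exp x ≤ 1 + x + 2x²` at `x = λ′ y z`: since `y z ≤ 1`, the square of `y z` is at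
        -- most `y z`, and the bound becomes linear in the indicator `z`.
        c′ = λ′ + fromℕ 2 * (λ′ * λ′)
        u : Fin N → ℝ
        u j = c′ * y j
        over : Ω → Bool
        over ω = ⌊ a ≤? sum (λ j → y j * Z j (J ω)) ⌋
        B = 𝔼 (λ ω → E i (J ω) * 𝟙 (over ω))
        P = product (λ j → 1# + u j * q)
        0≤c′ : 0# ≤ c′
        0≤c′ = +-nonneg 0≤λ (*-nonneg (fromℕ-nonneg 2) (*-nonneg 0≤λ 0≤λ))
        0≤u : ∀ j → 0# ≤ u j
        0≤u j = *-nonneg 0≤c′ (0≤y j)
        0≤uq : ∀ j → 0# ≤ u j * q
        0≤uq j = *-nonneg (0≤u j) 0≤q
        0<P : 0# < P
        0<P = <-≤-trans 0<1 (product≥1 0≤uq)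
        0≤B : 0# ≤ B
        0≤B = 𝔼-nonneg (λ ω → *-nonneg (E-nonneg i (J ω)) (𝟙-nonneg (over ω)))
        Σuq : sum (λ j → u j * q) ≡ c′ * (q * sum y)
        Σuq = trans (sum-cong (λ j → solve 3 (λ c y q → c :* y :* q := c :* q :* y)
            refl c′ (y j) q))
          (trans (sym (*-distribˡ-sum (c′ * q) y)) (*-assoc c′ q (sum y)))
        0≤λa : 0# ≤ λ′ * a
        0≤λa = ≤-trans (+-nonneg 0≤lnk (*-nonneg 0≤c′ (*-nonneg 0≤q (sum-nonneg 0≤y)))) exponent
        P*k≤ : P * k ≤ exp (λ′ * a)
        P*k≤ = begin
          P * k                              ≡⟨ cong (P *_) (exp-ln 0<k) ⟨
          P * exp (ln k)                     ≤⟨ exp-product-lower 0≤lnk 0≤uq ⟩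
          exp (ln k + sum (λ j → u j * q))   ≤⟨ exp-mono (+-nonneg 0≤lnk (sum-nonneg 0≤uq))
              (subst (λ s → ln k + s ≤ λ′ * a) (sym Σuq) exponent) ⟩
          exp (λ′ * a)                       ∎
        markov : ∀ ω → exp (λ′ * a) * (E i (J ω) * 𝟙 (over ω)) ≤ E i (J ω) * G u id (J ω)
        markov ω with a ≤? sum (λ j → y j * Z j (J ω))
        ... | no _     =
            ≤-trans (≤-reflexive (solve 2 (λ a b → a :* (b :* num 0) := num 0)
            refl (exp (λ′ * a)) (E i (J ω))))
                           (*-nonneg (E-nonneg i (J ω)) (G-nonneg 0≤u id (J ω)))
        ... | yes a≤S =
            ≤-trans (≤-reflexive (solve 2 (λ a b → a :* (b :* num 1) := b :* a)
            refl (exp (λ′ * a)) (E i (J ω))))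
                          (*-monoˡ-≤ (E-nonneg i (J ω)) (begin
          exp (λ′ * a)                                             ≤⟨ exp-mono 0≤λa
              (*-monoˡ-≤ 0≤λ a≤S) ⟩
          exp (λ′ * sum (λ j
              → y j * z j))                         ≡⟨ cong exp (*-distribˡ-sum λ′ (λ j
              → y j * z j)) ⟩
          exp (sum x)                                              ≤⟨ exp-product-upper 0≤x 2x≤1 ⟩
          product (λ j → 1# + (x j + fromℕ 2 * (x j * x j)))       ≤⟨ product-mono
              (λ j → +-nonneg 0≤1
              (+-nonneg (0≤x j) (*-nonneg (fromℕ-nonneg 2) (square-nonneg (x j)))))
              (λ j → +-mono-≤ ≤-refl (linear j)) ⟩
          G u id (J ω)                                             ∎))
          where
          z : Fin N → ℝ
          z j = Z j (J ω)
          x : Fin N → ℝ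
          x j = λ′ * (y j * z j)
          0≤yz : ∀ j → 0# ≤ y j * z j
          0≤yz j = *-nonneg (0≤y j) (Z-nonneg j (J ω))
          yz≤1 : ∀ j → y j * z j ≤ 1#
          yz≤1 j = subst (y j * z j ≤_) (*-identityˡ 1#)
              (*-mono-≤ (0≤y j) (Z-nonneg j (J ω)) (y≤1 j) (𝟙≤1 (A (J ω j))))
          0≤x : ∀ j → 0# ≤ x j
          0≤x j = *-nonneg 0≤λ (0≤yz j)
          2x≤1 : ∀ j → fromℕ 2 * x j ≤ 1#
          2x≤1 j = ≤-trans (≤-reflexive (sym (*-assoc _ _ _)))
            (subst (fromℕ 2 * λ′ * (y j * z j) ≤_) (*-identityˡ 1#)
                (*-mono-≤ (*-nonneg (fromℕ-nonneg 2) 0≤λ) (0≤yz j) 2λ≤1 (yz≤1 j)))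
          linear : ∀ j → x j + fromℕ 2 * (x j * x j) ≤ u j * z j
          linear j = ≤-cert (fromℕ 2 * (λ′ * λ′) * (y j * z j * (1# - y j * z j)))
            (*-nonneg (*-nonneg (fromℕ-nonneg 2) (*-nonneg 0≤λ 0≤λ))
                (*-nonneg (0≤yz j) (x≤y⇒0≤y-x (yz≤1 j))))
            (solve 3 (λ l y z
                → l :* (y :* z) :+ num 2 :* (l :* (y :* z) :* (l :* (y :* z))) :+ num 2 :* (l :* l) :* (y :* z :* (num 1 :- y :* z))
                     := (l :+ num 2 :* (l :* l)) :* y :* z) refl λ′ (y j) (z j))

-- Counting times by windows.

module Counting (R : RealNumbers) (inst : Model.Instance R) where
  open RealNumbers R
  open OrderedField R
  open FiniteSums R
  open Model R
  open Instance inst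

  card-sum : ∀ {m} (S : Subset m) → fromℕ ∣ S ∣ ≡ sum (λ s → 𝟙 ⌊ s ∈? S ⌋)
  card-sum []          = refl
  card-sum (true ∷ S)  =
      cong (1# +_) (trans (card-sum S)
      (sum-cong (λ s → 𝟙-⇔ (s ∈? S) (suc s ∈? true ∷ S) there drop-there)))
  card-sum (false ∷ S) =
      trans (trans (card-sum S)
      (sum-cong (λ s → 𝟙-⇔ (s ∈? S) (suc s ∈? false ∷ S) there drop-there)))
    (sym (+-identityˡ _))

  window-residue : ∀ {s s'} → window s ≡ window s' → toℕ s ℕ.% ℓ ≡ toℕ s' ℕ.% ℓ → s ≡ s'
  window-residue {s} {s'} same %≡ = Fin.toℕ-injective (begin
    toℕ s                                    ≡⟨ ℕ.m≡m%n+[m/n]*n (toℕ s) ℓ ⟩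
    toℕ s ℕ.% ℓ ℕ.+ toℕ s ℕ./ ℓ ℕ.* ℓ        ≡⟨ cong₂ (λ r d → r ℕ.+ d ℕ.* ℓ) %≡ /≡ ⟩
    toℕ s' ℕ.% ℓ ℕ.+ toℕ s' ℕ./ ℓ ℕ.* ℓ      ≡⟨ ℕ.m≡m%n+[m/n]*n (toℕ s') ℓ ⟨
    toℕ s'                                   ∎)
    where
    open ≡-Reasoning
    /≡ : toℕ s ℕ./ ℓ ≡ toℕ s' ℕ./ ℓ
    /≡ = trans (sym (Fin.toℕ-fromℕ< (toℕ/ℓ<#windows s)))
        (trans (cong toℕ same) (Fin.toℕ-fromℕ< (toℕ/ℓ<#windows s')))

  -- Times of one window have distinct residues modulo `ℓ`. The factor `1#` gives the count the
  -- shape required by `adversarial-windows` for the constant weight one.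
  window-length : ∀ b → sum (λ s → 𝟙 ⌊ window s Fin.≟ b ⌋ * 1#) ≤ fromℕ ℓ
  window-length b =
      subst (_≤ fromℕ ℓ) (sum-cong {n} (λ s → sym (*-identityʳ (𝟙 ⌊ window s Fin.≟ b ⌋))))
    (count≤ (λ s → ⌊ window s Fin.≟ b ⌋) (λ s → toℕ s ℕ.% ℓ) (λ s _ → ℕ.m%n<n (toℕ s) ℓ) unique)
    where
    unique : ∀ s s' → ⌊ window s Fin.≟ b ⌋ ≡ true → ⌊ window s' Fin.≟ b ⌋ ≡ true →
             toℕ s ℕ.% ℓ ≡ toℕ s' ℕ.% ℓ → s ≡ s'
    unique s s' eq eq' =
        window-residue
        (trans (⌊⌋-true (window s Fin.≟ b) eq) (sym (⌊⌋-true (window s' Fin.≟ b) eq')))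

  -- Sort the times by window; at most `Γ` windows occur. It is applied both to the number of times
  -- and to the weight that the LP puts on them.
  adversarial-windows : ∀ {f : Fin n → ℝ} {cap} → 0# ≤ cap →
    (∀ b → sum (λ s → 𝟙 ⌊ window s Fin.≟ b ⌋ * f s) ≤ cap) →
    sum (λ s → 𝟙 ⌊ window s ∈? 𝕎adv ⌋ * f s) ≤ fromℕ Γ * cap
  adversarial-windows {f} {cap} 0≤cap windowwise = begin
    sum (λ s → χ (window s) * f s)
      ≡⟨ sum-cong (λ s → sym (sum-δ (λ b → χ b * f s) (window s))) ⟩
    sum (λ s → sum (λ b → 𝟙 ⌊ window s Fin.≟ b ⌋ * (χ b * f s)))
      ≡⟨ ∑-comm (λ s b → 𝟙 ⌊ window s Fin.≟ b ⌋ * (χ b * f s)) ⟩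
    sum (λ b → sum (λ s → 𝟙 ⌊ window s Fin.≟ b ⌋ * (χ b * f s)))
      ≡⟨ sum-cong (λ b → trans
           (sum-cong (λ s → solve 3 (λ d c f → d :* (c :* f) := c :* (d :* f))
               refl (𝟙 ⌊ window s Fin.≟ b ⌋) (χ b) (f s)))
           (sym (*-distribˡ-sum (χ b) (λ s → 𝟙 ⌊ window s Fin.≟ b ⌋ * f s)))) ⟩
    sum (λ b → χ b * sum (λ s → 𝟙 ⌊ window s Fin.≟ b ⌋ * f s))
      ≤⟨ sum-mono (λ b → *-monoˡ-≤ (𝟙-nonneg ⌊ b ∈? 𝕎adv ⌋) (windowwise b)) ⟩
    sum (λ b → χ b * cap)
      ≡⟨ *-distribʳ-sum cap χ ⟨
    sum χ * cap
      ≡⟨ cong (_* cap) (card-sum 𝕎adv) ⟨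
    fromℕ ∣ 𝕎adv ∣ * cap
      ≤⟨ *-monoʳ-≤ 0≤cap (fromℕ-mono-≤ ∣𝕎adv∣≤Γ) ⟩
    fromℕ Γ * cap ∎
    where
    open ≤-Reasoning
    χ : Fin #windows → ℝ
    χ b = 𝟙 ⌊ b ∈? 𝕎adv ⌋

  n≤N+Γℓ : fromℕ n ≤ fromℕ N + fromℕ Γ * fromℕ ℓ
  n≤N+Γℓ = begin
    fromℕ n                                     ≡⟨ cong fromℕ (ℕ.m∸n+n≡m (∣p∣≤n Adv)) ⟨
    fromℕ (n ℕ.∸ ∣ Adv ∣ ℕ.+ ∣ Adv ∣)           ≡⟨ fromℕ-+ (n ℕ.∸ ∣ Adv ∣) ∣ Adv ∣ ⟩
    fromℕ (n ℕ.∸ ∣ Adv ∣) + fromℕ ∣ Adv ∣       ≡⟨ cong₂ (λ a b → fromℕ a + b)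
        (sym (∣∁p∣≡n∸∣p∣ Adv)) (card-sum Adv) ⟩
    fromℕ N + sum (λ s → 𝟙 ⌊ s ∈? Adv ⌋)        ≤⟨ +-mono-≤ ≤-refl (sum-mono covered) ⟩
    fromℕ N + sum (λ s → 𝟙 ⌊ window s ∈? 𝕎adv ⌋ * 1#) ≤⟨ +-mono-≤ ≤-refl
        (adversarial-windows (fromℕ-nonneg ℓ) window-length) ⟩
    fromℕ N + fromℕ Γ * fromℕ ℓ                 ∎
    where
    open ≤-Reasoning
    covered : ∀ s → 𝟙 ⌊ s ∈? Adv ⌋ ≤ 𝟙 ⌊ window s ∈? 𝕎adv ⌋ * 1#
    covered s with s ∈? Adv
    ... | no _       = *-nonneg (𝟙-nonneg ⌊ window s ∈? 𝕎adv ⌋) 0≤1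
    ... | yes s∈Adv =
        ≤-reflexive (sym (trans (*-identityʳ _) (𝟙-yes (window s ∈? 𝕎adv) (Adv⊆⋃𝕎adv s∈Adv))))

-- Exchange arguments for an optimal solution of the LP that omits time t.

module Exchange (R : RealNumbers) (inst : Model.Instance R) (t : Fin (Model.Instance.n inst))
  (V W X : Fin (Model.Instance.n inst) → RealNumbers.ℝ R) where
  open RealNumbers R
  open OrderedField R
  open FiniteSums R
  open Model R
  open Instance inst
  open LP V W t

  total : ℝ
  total = sumOver (Fin._≤? t) (λ s → W s * X s)

  windowTotal : Fin n → ℝ
  windowTotal s = sumOver (λ s' → (s' Fin.≤? t) ×-dec (window s' Fin.≟ window s))
      (λ s' → W s' * X s')

  budget : ℝ
  budget = c t * (time t / fromℕ n) * k

  cap : ℝ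
  cap = a₁ * ℓ/n * k

  -- One computation for the objective and all constraints: `χ` selects the times of a constraint,
  -- and `U` is `V` or `W`. The perturbation moves `α` into `t` and `β` out of `s`, where `s = t` is
  -- allowed.
  sum-shift : ∀ (χ U : Fin n → ℝ) s α β →
          sum (λ r → χ r * (U r * (X r + (𝟙 ⌊ t Fin.≟ r ⌋ * α - 𝟙 ⌊ s Fin.≟ r ⌋ * β))))
          ≡ sum (λ r → χ r * (U r * X r)) + (χ t * (U t * α) - χ s * (U s * β))
  sum-shift χ U s α β = begin
    sum (λ r → χ r * (U r * (X r + (δ t r * α - δ s r * β))))
      ≡⟨ sum-cong (λ r → solve 7 (λ c u x d a e b → c :* (u :* (x :+ (d :* a :- e :* b)))
           := c :* (u :* x) :+ (d :* (c :* (u :* a)) :+ e :* (:- (c :* (u :* b)))))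
               refl (χ r) (U r) (X r) (δ t r) α (δ s r) β) ⟩
    sum (λ r → χ r * (U r * X r) + (δ t r * (χ r * (U r * α)) + δ s r * (- (χ r * (U r * β)))))
      ≡⟨ ∑-distrib-+ (λ r → χ r * (U r * X r)) _ ⟩
    sum (λ r → χ r * (U r * X r))
        + sum (λ r → δ t r * (χ r * (U r * α)) + δ s r * (- (χ r * (U r * β))))
      ≡⟨ cong (sum (λ r → χ r * (U r * X r)) +_)
          (trans (∑-distrib-+ (λ r → δ t r * (χ r * (U r * α))) _)
           (cong₂ _+_ (sum-δ (λ r → χ r * (U r * α)) t) (sum-δ (λ r → - (χ r * (U r * β))) s))) ⟩
    sum (λ r → χ r * (U r * X r)) + (χ t * (U t * α) - χ s * (U s * β)) ∎
    where
    open ≡-Reasoning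
    δ : Fin n → Fin n → ℝ
    δ s r = 𝟙 ⌊ s Fin.≟ r ⌋

  module _ (optimal : Optimal X) (Xt≡0 : X t ≡ 0#) (0≤W : ∀ s → 0# ≤ W s) (W≤1 : ∀ s → W s ≤ 1#) where
    open Feasible (proj₁ optimal) using (window-budget; box)

    -- Optimality tested against the perturbed vector. Only the overall budget and the window of `t`
    -- have to be checked for it, because every other window can only lose weight; `X t = 0` leaves
    -- room for any `α ≤ 1`.
    no-improvement : ∀ s → s Fin.≤ t → ∀ {α β} → 0# ≤ α → α ≤ 1# → 0# ≤ β → β ≤ X s →
      total + (W t * α - W s * β) ≤ budget →
      windowTotal t + (W t * α - 𝟙 ⌊ window s Fin.≟ window t ⌋ * (W s * β)) ≤ cap →
      V t * α ≤ V s * β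
    no-improvement s s≤t {α} {β} 0≤α α≤1 0≤β β≤Xs budget-ok window-ok =
      ≤-cert (value X - value Y) (x≤y⇒0≤y-x (proj₂ optimal Y feasible)) (trans
        (cong (λ y → V t * α + (value X - y)) value-Y)
        (solve 3 (λ a b x → a :+ (x :- (x :+ (a :- b))) := b) refl (V t * α) (V s * β) (value X)))
      where
      Y : Fin n → ℝ
      Y r = X r + (𝟙 ⌊ t Fin.≟ r ⌋ * α - 𝟙 ⌊ s Fin.≟ r ⌋ * β)
      drop-units : ∀ {x y : ℝ} → x ≡ 1# → y ≡ 1# → ∀ a b → x * a - y * b ≡ a - b
      drop-units refl refl a b = cong₂ _-_ (*-identityˡ a) (*-identityˡ b)
      value-Y : value Y ≡ value X + (V t * α - V s * β)
      value-Y = trans (sum-shift (λ r → 𝟙 ⌊ r Fin.≤? t ⌋) V s α β) (cong (value X +_)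
        (drop-units (𝟙-yes (t Fin.≤? t) ℕ.≤-refl) (𝟙-yes (s Fin.≤? t) s≤t) (V t * α) (V s * β)))
      0≤Wβ : 0# ≤ W s * β
      0≤Wβ = *-nonneg (0≤W s) 0≤β
      feasible : Feasible Y
      feasible .Feasible.budget =
          subst (_≤ budget)
          (sym (trans (sum-shift (λ r → 𝟙 ⌊ r Fin.≤? t ⌋) W s α β) (cong (total +_)
        (drop-units (𝟙-yes (t Fin.≤? t) ℕ.≤-refl) (𝟙-yes (s Fin.≤? t) s≤t) (W t * α)
            (W s * β))))) budget-ok
      feasible .Feasible.window-budget r r≤t = subst (_≤ cap) (sym (sum-shift χ W s α β)) bound
        where
        χ : Fin n → ℝ
        χ s' = 𝟙 ⌊ (s' Fin.≤? t) ×-dec (window s' Fin.≟ window r) ⌋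
        bound : windowTotal r + (χ t * (W t * α) - χ s * (W s * β)) ≤ cap
        bound with t Fin.≤? t | window t Fin.≟ window r
        ... | no t≰t | _ = contradiction ℕ.≤-refl t≰t
        ... | yes _ | no _ = ≤-trans
          (≤-cert (χ s * (W s * β)) (*-nonneg (𝟙-nonneg _) 0≤Wβ)
            (solve 3 (λ a b c → c :+ (num 0 :* a :- b) :+ b := c)
                refl (W t * α) (χ s * (W s * β)) (windowTotal r)))
          (window-budget r r≤t)
        ... | yes _ | yes eq =
            subst (_≤ cap)
            (cong₂ _+_ wins
            (cong₂ (λ x y → x - y * (W s * β)) (sym (*-identityˡ _)) indicators)) window-ok
          where
          wins : windowTotal t ≡ windowTotal r
          wins = cong (λ b → sumOver (λ s' → (s' Fin.≤? t) ×-dec (window s' Fin.≟ b))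
              (λ s' → W s' * X s')) eq
          indicators : 𝟙 ⌊ window s Fin.≟ window t ⌋ ≡ χ s
          indicators = 𝟙-⇔ (window s Fin.≟ window t) ((s Fin.≤? t) ×-dec (window s Fin.≟ window r))
            (λ eq' → s≤t , trans eq' eq) (λ eq' → trans (proj₂ eq') (sym eq))
      feasible .Feasible.box r r≤t with t Fin.≟ r | s Fin.≟ r
      ... | no _ | no _ =
          subst (λ x → 0# ≤ x × x ≤ 1#) (solve 3 (λ x a b → x := x :+ (num 0 :* a :- num 0 :* b))
          refl (X r) α β) (box r r≤t)
      ... | no _ | yes refl =
          ≤-cert (X s - β) (x≤y⇒0≤y-x β≤Xs)
              (solve 3 (λ x a b → num 0 :+ (x :- b) := x :+ (num 0 :* a :- num 1 :* b))
              refl (X s) α β)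
        , ≤-trans (≤-cert β 0≤β (solve 3 (λ x a b → x :+ (num 0 :* a :- num 1 :* b) :+ b := x)
            refl (X s) α β)) (proj₂ (box r r≤t))
      ... | yes refl | no _ = subst (λ x → 0# ≤ x × x ≤ 1#)
          (trans (solve 2 (λ a b → a := num 0 :+ (num 1 :* a :- num 0 :* b)) refl α β)
              (cong (_+ (1# * α - 0# * β)) (sym Xt≡0))) (0≤α , α≤1)
      -- For `s = t` the bound `β ≤ X t = 0` forces `β = 0`.
      ... | yes refl | yes refl = subst (λ x → 0# ≤ x × x ≤ 1#)
          (trans (solve 1 (λ a → a := num 0 :+ (num 1 :* a :- num 1 :* num 0)) refl α)
            (cong₂ (λ x b → x + (1# * α - 1# * b)) (sym Xt≡0)
                (≤-antisym 0≤β (subst (β ≤_) Xt≡0 β≤Xs)))) (0≤α , α≤1)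

    -- An exchange within the window of `t` leaves its weight unchanged; only an exchange from
    -- outside has to fit into the slack of that window.
    step-size : ∀ s → 0# < X s → window s ≡ window t ⊎ windowTotal t < cap →
      ∃ λ a → 0# < a × a ≤ X s × (window s ≢ window t → a ≤ cap - windowTotal t)
    step-size s 0<Xs (inj₁ same)  = X s , 0<Xs , ≤-refl , λ ≢ → contradiction same ≢
    step-size s 0<Xs (inj₂ w<cap) = X s ⊓ (cap - windowTotal t) , ⊓-pos 0<Xs (x<y⇒0<y-x w<cap) ,
      ⊓≤ˡ (X s) (cap - windowTotal t) , λ _ → ⊓≤ʳ (X s) (cap - windowTotal t)

    -- Moving `α = a * W s` in and `β = a * W t` out keeps the total weight fixed, so optimality
    -- compares the values alone. The conclusion says that `s` is at least as dense as `t`, with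
    -- denominators cleared.
    used-dominates : ∀ s → s Fin.≤ t → 0# < X s → window s ≡ window t ⊎ windowTotal t < cap →
        V t * W s ≤ V s * W t
    used-dominates s s≤t 0<Xs slack =
        *-cancelˡ-≤ 0<a (subst₂ _≤_ (swap (V t) (W s)) (swap (V s) (W t))
      (no-improvement s s≤t (*-nonneg (<⇒≤ 0<a) (0≤W s))
        (≤-trans (x*y≤x (<⇒≤ 0<a) (W≤1 s)) (≤-trans a≤Xs (proj₂ (box s s≤t))))
        (*-nonneg (<⇒≤ 0<a) (0≤W t)) (≤-trans (x*y≤x (<⇒≤ 0<a) (W≤1 t)) a≤Xs)
        (subst (_≤ budget) (solve 4 (λ x wt ws a → x := x :+ (wt :* (a :* ws) :- ws :* (a :* wt)))
            refl total (W t) (W s) a) (Feasible.budget (proj₁ optimal)))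
        (window-ok (window s Fin.≟ window t))))
      where
      scale = step-size s 0<Xs slack
      a = proj₁ scale
      0<a = proj₁ (proj₂ scale)
      a≤Xs = proj₁ (proj₂ (proj₂ scale))
      a≤slack = proj₂ (proj₂ (proj₂ scale))
      swap : ∀ v w → v * (a * w) ≡ a * (v * w)
      swap v w = solve 3 (λ v a w → v :* (a :* w) := a :* (v :* w)) refl v a w
      window-ok : (same? : Dec (window s ≡ window t)) →
                  windowTotal t + (W t * (a * W s) - 𝟙 ⌊ same? ⌋ * (W s * (a * W t))) ≤ cap
      window-ok (yes _) = subst (_≤ cap)
        (solve 4 (λ x wt ws a → x := x :+ (wt :* (a :* ws) :- num 1 :* (ws :* (a :* wt))))
            refl (windowTotal t) (W t) (W s) a) (window-budget t ℕ.≤-refl)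
      window-ok (no ≢) = ≤-cert (cap - windowTotal t - a * W s * W t)
        (x≤y⇒0≤y-x (≤-trans
            (≤-trans (x*y≤x (*-nonneg (<⇒≤ 0<a) (0≤W s)) (W≤1 t)) (x*y≤x (<⇒≤ 0<a) (W≤1 s)))
            (a≤slack ≢)))
        (solve 5 (λ x wt ws a c
            → x :+ (wt :* (a :* ws) :- num 0 :* (ws :* (a :* wt))) :+ (c :- x :- a :* ws :* wt)
            := c)
          refl (windowTotal t) (W t) (W s) a cap)

    -- With slack in both budgets, raising `X t` alone would gain `V t * a > 0`; this is the case
    -- `s = t`, `β = 0` of `no-improvement`. The `1#` in `a` keeps the raised entry in the box.
    some-budget-tight : 0# < V t → windowTotal t < cap → budget ≤ total
    some-budget-tight 0<Vt w<cap = ≮⇒≥ λ total<budget →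
      let 0<a = ⊓-pos 0<1 (⊓-pos (x<y⇒0<y-x total<budget) (x<y⇒0<y-x w<cap)) in
      <⇒≱ (*-pos 0<Vt 0<a) (subst (V t * a ≤_) (zeroʳ (V t))
        (no-improvement t ℕ.≤-refl (<⇒≤ 0<a) (⊓≤ˡ 1# _) ≤-refl (≤-reflexive (sym Xt≡0))
          (fits (<⇒≤ 0<a) (≤-trans (⊓≤ʳ 1# _) (⊓≤ˡ (budget - total) (cap - windowTotal t)))
              (zeroʳ (W t)))
          (fits (<⇒≤ 0<a) (≤-trans (⊓≤ʳ 1# _) (⊓≤ʳ (budget - total) (cap - windowTotal t)))
            (trans (cong (𝟙 ⌊ window t Fin.≟ window t ⌋ *_) (zeroʳ (W t))) (zeroʳ _)))))
      where
      a : ℝ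
      a = 1# ⊓ ((budget - total) ⊓ (cap - windowTotal t))
      fits : ∀ {x y z} → 0# ≤ a → a ≤ y - x → z ≡ 0# → x + (W t * a - z) ≤ y
      fits {x} {y} 0≤a a≤y-x refl =
          ≤-cert (y - x - a * W t) (x≤y⇒0≤y-x (≤-trans (x*y≤x 0≤a (W≤1 t)) a≤y-x))
        (solve 4 (λ x y a w → x :+ (w :* a :- num 0) :+ (y :- x :- a :* w) := y) refl x y a (W t))

-- Greedy bound for the fractional knapsack.

module Knapsack (R : RealNumbers) (inst : Model.Instance R) where
  open RealNumbers R
  open OrderedField R
  open FiniteSums R
  open Model R
  open Instance inst

  -- Items are indexed by decreasing density, so `j < i` means that `j` is denser. As a weight
  -- vector over all items it is the `y` of `tail-bound`.
  denser : Fin N → Fin N → ℝ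
  denser i j = 𝟙 ⌊ j Fin.<? i ⌋ * w j

  denser-nonneg : ∀ i j → 0# ≤ denser i j
  denser-nonneg i j = *-nonneg (𝟙-nonneg ⌊ j Fin.<? i ⌋) (<⇒≤ (w-pos j))

  cross : ∀ i j → v j / w j < v i / w i → v j * w i < v i * w j
  cross i j lt = subst₂ _<_
    (trans (solve 3 (λ a b d → a :* b :* d := d :* a :* b) refl (w j) (w i) (v j / w j))
        (cong (_* w i) (/-*-cancel (v j) (w-pos j))))
    (trans (solve 3 (λ a b d → a :* b :* d := d :* b :* a) refl (w j) (w i) (v i / w i))
        (cong (_* w j) (/-*-cancel (v i) (w-pos i))))
    (*-monoˡ-< (*-pos (w-pos j) (w-pos i)) lt)

  denser⇒≤ : ∀ i j → v i * w j ≤ v j * w i → j Fin.≤ i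
  denser⇒≤ i j vw≤ = ℕ.≮⇒≥ λ i<j → <⇒≱ (cross i j (v/w-decr i<j)) vw≤

  prefix : Fin N → ℝ
  prefix i = sum (denser i)

  prefix-mono : ∀ {i i'} → i Fin.≤ i' → prefix i ≤ prefix i'
  prefix-mono {i} {i'} i≤i' = sum-mono λ j → *-monoʳ-≤ (<⇒≤ (w-pos j)) (more j)
    where
    more : ∀ j → 𝟙 ⌊ j Fin.<? i ⌋ ≤ 𝟙 ⌊ j Fin.<? i' ⌋
    more j with j Fin.<? i
    ... | no _    = 𝟙-nonneg ⌊ j Fin.<? i' ⌋
    ... | yes j<i = ≤-reflexive (sym (𝟙-yes (j Fin.<? i') (ℕ.<-≤-trans j<i i≤i')))

  θx≤1 : ∀ {θ} {x : Fin N → ℝ} → 0# ≤ θ → θ ≤ 1# → (∀ i → 0# ≤ x i × x i ≤ 1#) → ∀ i → θ * x i ≤ 1#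
  θx≤1 {θ} {x} 0≤θ θ≤1 x-box i =
      subst (θ * x i ≤_) (*-identityˡ 1#) (*-mono-≤ 0≤θ (proj₁ (x-box i)) θ≤1 (proj₂ (x-box i)))

  -- The greedy items beat θ x against the weights v / v_g - w / w_g, where g is
  -- the first item that is not greedy; all denominators are multiplied out.
  greedy : ∀ {θ OPT} → 0# ≤ θ → θ ≤ 1# → KnapsackValue OPT →
           θ * OPT ≤ sum (λ i → 𝟙 ⌊ prefix i <? θ * k ⌋ * v i)
  greedy {θ} 0≤θ θ≤1 (x , x-box , wx≤k , refl) with first-failure (λ i → prefix i <? θ * k)
  ... | inj₁ all = ≤-trans (≤-reflexive (*-distribˡ-sum θ (λ i → v i * x i))) (sum-mono taken)
    where
    taken : ∀ i → θ * (v i * x i) ≤ 𝟙 ⌊ prefix i <? θ * k ⌋ * v i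
    taken i = ≤-cert (v i * (1# - θ * x i))
        (*-nonneg (<⇒≤ (v-pos i)) (x≤y⇒0≤y-x (θx≤1 0≤θ θ≤1 x-box i)))
      (trans (solve 3 (λ t v x → t :* (v :* x) :+ v :* (num 1 :- t :* x) := num 1 :* v)
          refl θ (v i) (x i))
        (cong (_* v i) (sym (𝟙-yes (prefix i <? θ * k) (all i)))))
  ... | inj₂ (g , g-fails , before) = *-cancelˡ-≤ (w-pos g) (≤-cert d 0≤d sum-eq)
    where
    χ : Fin N → ℝ
    χ i = 𝟙 ⌊ prefix i <? θ * k ⌋
    term : Fin N → ℝ
    term i = w g * (χ i * v i)
        + v g * (θ * (w i * x i)) - (w g * (θ * (v i * x i)) + v g * (χ i * w i))
    term-nonneg : ∀ i → 0# ≤ term i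
    term-nonneg i with prefix i <? θ * k | Fin.<-cmp i g
    ... | no ¬p | tri< i<g _ _ = contradiction (before i i<g) ¬p
    ... | yes p | tri≈ _ refl _ = contradiction p g-fails
    ... | yes p | tri> _ _ g<i = contradiction (≤-<-trans (prefix-mono (ℕ.<⇒≤ g<i)) p) g-fails
    ... | yes p | tri< i<g _ _ = subst (0# ≤_)
      (solve 6 (λ t x vi wi vg wg → (num 1 :- t :* x) :* (vi :* wg :- vg :* wi)
         := wg :* (num 1 :* vi) :+ vg :* (t :* (wi :* x)) :- (wg :* (t :* (vi :* x)) :+ vg :* (num 1 :* wi))) refl θ (x i) (v i) (w i) (v g) (w g))
      (*-nonneg (x≤y⇒0≤y-x (θx≤1 0≤θ θ≤1 x-box i)) (<⇒≤ (x<y⇒0<y-x (cross i g (v/w-decr i<g)))))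
    ... | no _ | tri≈ _ refl _ = ≤-reflexive
      (solve 4 (λ t x v w → num 0
          := w :* (num 0 :* v) :+ v :* (t :* (w :* x)) :- (w :* (t :* (v :* x)) :+ v :* (num 0 :* w))) refl θ (x i) (v i) (w i))
    ... | no _ | tri> _ _ g<i = subst (0# ≤_)
      (solve 6 (λ t x vi wi vg wg → t :* x :* (vg :* wi :- vi :* wg)
         := wg :* (num 0 :* vi) :+ vg :* (t :* (wi :* x)) :- (wg :* (t :* (vi :* x)) :+ vg :* (num 0 :* wi))) refl θ (x i) (v i) (w i) (v g) (w g))
      (*-nonneg (*-nonneg 0≤θ (proj₁ (x-box i))) (<⇒≤ (x<y⇒0<y-x (cross g i (v/w-decr g<i)))))
    -- By monotonicity of `prefix` the greedy items are exactly those before `g`; since `g` fails,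
    -- they weigh at least `θ * k`.
    Σχw≡prefix : sum (λ i → χ i * w i) ≡ prefix g
    Σχw≡prefix = sum-cong λ i → cong (_* w i) (𝟙-⇔ (prefix i <? θ * k) (i Fin.<? g)
      (λ p → ℕ.≰⇒> λ g≤i → g-fails (≤-<-trans (prefix-mono g≤i) p)) (before i))
    Σχv = sum (λ i → χ i * v i)
    Σvx = sum (λ i → v i * x i)
    Σwx = sum (λ i → w i * x i)
    Σχw = sum (λ i → χ i * w i)
    d = sum term + v g * (Σχw - θ * Σwx)
    0≤d : 0# ≤ d
    0≤d = +-nonneg (sum-nonneg term-nonneg) (*-nonneg (<⇒≤ (v-pos g)) (x≤y⇒0≤y-x
      (≤-trans (*-monoˡ-≤ 0≤θ wx≤k) (subst (θ * k ≤_) (sym Σχw≡prefix) (≮⇒≥ g-fails)))))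
    Σterm : sum term ≡ (w g * Σχv + v g * θ * Σwx) + (- (w g * θ) * Σvx + - v g * Σχw)
    Σterm = trans
      (sum-cong (λ i → solve 7
          (λ wg vg t cv wx vx cw → wg :* cv :+ vg :* (t :* wx) :- (wg :* (t :* vx) :+ vg :* cw)
           := (wg :* cv :+ vg :* t :* wx) :+ (:- (wg :* t) :* vx :+ :- vg :* cw))
               refl (w g) (v g) θ (χ i * v i) (w i * x i) (v i * x i) (χ i * w i)))
      (trans (∑-distrib-+ (λ i → w g * (χ i * v i) + v g * θ * (w i * x i))
          (λ i → - (w g * θ) * (v i * x i) + - v g * (χ i * w i)))
        (cong₂ _+_ (sum-linear (w g) (λ i → χ i * v i) (v g * θ) (λ i → w i * x i))
                   (sum-linear (- (w g * θ)) (λ i → v i * x i) (- v g) (λ i → χ i * w i))))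
    sum-eq : w g * (θ * Σvx) + d ≡ w g * Σχv
    sum-eq = trans (cong (λ s → w g * (θ * Σvx) + (s + v g * (Σχw - θ * Σwx))) Σterm)
      (solve 7 (λ wg vg t cv wx vx cw
          → wg :* (t :* vx) :+ ((wg :* cv :+ vg :* t :* wx) :+ (:-
          (wg :* t) :* vx :+ :- vg :* cw) :+ vg :* (cw :- t :* wx))
         := wg :* cv) refl (w g) (v g) θ Σχv Σwx Σvx Σχw)

-- What an item left out by the LP says about denser arrivals.

module Missed (R : RealNumbers) (inst : Model.Instance R) (run : Model.Execution R inst)
  (t : Fin (Model.Instance.n inst)) where
  open RealNumbers R
  open OrderedField R
  open FiniteSums R
  open Model R
  open Instance inst
  open Execution run
  open RandomOrder R inst run
  open Concentration R inst run t
  open Counting R inst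
  open Knapsack R inst

  W-bounds : ∀ ω s → 0# ≤ W ω s × W ω s ≤ 1#
  W-bounds ω s with s ∈? Adv
  ... | yes s∈Adv = W-Adv ω s∈Adv
  ... | no s∉Adv  = subst (λ x → 0# ≤ x × x ≤ 1#) (sym (W-RO ω (x∉p⇒x∈∁p s∉Adv)))
      (<⇒≤ (w-pos _) , w≤1 _)

  -- Strictly before `t`: the entry at `t` is zero when its item is left out, and `tail-bound` asks
  -- for a set of times without `t`.
  earlier inWindow : Fin n → Bool
  earlier s  = ⌊ s Fin.<? t ⌋
  inWindow s = earlier s ∧ ⌊ window s Fin.≟ window t ⌋

  earlier-t : earlier t ≡ false
  earlier-t with t Fin.<? t
  ... | yes t<t = contradiction t<t (ℕ.<-irrefl refl)
  ... | no _    = refl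

  inWindow-t : inWindow t ≡ false
  inWindow-t = cong (_∧ ⌊ window t Fin.≟ window t ⌋) earlier-t

  -- Passes from sums over times, as in the LP, to sums over items, as in `tail-bound`.
  weight-by-arrival : ∀ (A : Fin n → Bool) (y : Fin N → ℝ) (x : Fin N → Fin n) →
    sum (λ s → 𝟙 (A s) * sum (λ j → 𝟙 ⌊ x j Fin.≟ s ⌋ * y j)) ≡ sum (λ j → y j * 𝟙 (A (x j)))
  weight-by-arrival A y x = begin
    sum (λ s → 𝟙 (A s) * sum (λ j → 𝟙 ⌊ x j Fin.≟ s ⌋ * y j))
      ≡⟨ sum-cong (λ s → *-distribˡ-sum (𝟙 (A s)) (λ j → 𝟙 ⌊ x j Fin.≟ s ⌋ * y j)) ⟩
    sum (λ s → sum (λ j → 𝟙 (A s) * (𝟙 ⌊ x j Fin.≟ s ⌋ * y j)))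
      ≡⟨ ∑-comm (λ s j → 𝟙 (A s) * (𝟙 ⌊ x j Fin.≟ s ⌋ * y j)) ⟩
    sum (λ j → sum (λ s → 𝟙 (A s) * (𝟙 ⌊ x j Fin.≟ s ⌋ * y j)))
      ≡⟨ sum-cong (λ j → sum-cong (λ s → solve 3 (λ a d y → a :* (d :* y) := d :* (y :* a))
          refl (𝟙 (A s)) (𝟙 ⌊ x j Fin.≟ s ⌋) (y j))) ⟩
    sum (λ j → sum (λ s → 𝟙 ⌊ x j Fin.≟ s ⌋ * (y j * 𝟙 (A s))))
      ≡⟨ sum-cong (λ j → sum-δ (λ s → y j * 𝟙 (A s)) (x j)) ⟩
    sum (λ j → y j * 𝟙 (A (x j))) ∎
    where open ≡-Reasoning

  module _ (t-free : Free t) (ω : Ω) {i : Fin N} (Ji≡t : J ω i ≡ t) (T≡false : T ω t ≡ false) where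
    open LP (V ω) (W ω) t
    open Exchange R inst t (V ω) (W ω) (X ω t)

    private
      x : Fin n → ℝ
      x = X ω t

      0≤W : ∀ s → 0# ≤ W ω s
      0≤W s = proj₁ (W-bounds ω s)

      W≤1 : ∀ s → W ω s ≤ 1#
      W≤1 s = proj₂ (W-bounds ω s)

    module _ (0≤budget : 0# ≤ budget) (0≤cap : 0# ≤ cap) where

      optimal : Optimal x
      -- The zero vector is feasible once both budgets are nonnegative, so the LP solution is a
      -- genuine optimum.
      optimal = X-optimal ω t ((λ _ → 0#) , record
        { budget        = subst (_≤ budget) (sym (sum-zero {n} (λ s → vanish _ (W ω s)))) 0≤budget
        ; window-budget = λ s _ → subst (_≤ cap) (sym (sum-zero {n} (λ s → vanish _ (W ω s)))) 0≤cap
        ; box           = λ _ _ → ≤-refl , 0≤1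
        })
        where
        vanish : ∀ a b → a * (b * 0#) ≡ 0#
        vanish a b = trans (cong (a *_) (zeroʳ b)) (zeroʳ a)

      open Feasible (proj₁ optimal) using (window-budget; box)

      Xt≡0 : x t ≡ 0#
      Xt≡0 = ≤-antisym (≮⇒≥ (⌊⌋-false (0# <? x t) T≡false)) (proj₁ (box t ℕ.≤-refl))

      Vt≡ : V ω t ≡ v i
      Vt≡ = trans (V-RO ω (free⇒RO t-free)) (cong v (J⇒itemAt ω (free⇒RO t-free) Ji≡t))

      Wt≡ : W ω t ≡ w i
      Wt≡ = trans (W-RO ω (free⇒RO t-free)) (cong w (J⇒itemAt ω (free⇒RO t-free) Ji≡t))

      -- Written as a sum over items so that it makes sense at adversarial times too, where it is
      -- zero.
      arrivedDenser : Fin n → ℝ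
      arrivedDenser s = sum (λ j → 𝟙 ⌊ J ω j Fin.≟ s ⌋ * denser i j)

      arrivedDenser-nonneg : ∀ s → 0# ≤ arrivedDenser s
      arrivedDenser-nonneg s =
          sum-nonneg (λ j → *-nonneg (𝟙-nonneg ⌊ J ω j Fin.≟ s ⌋) (denser-nonneg i j))

      -- If the LP uses `s`, the exchange argument makes the item there at least as dense as `i`. It
      -- differs from `i`, because `i` sits at `t` and `X t = 0`; hence it is strictly denser and
      -- strictly earlier.
      covered : ∀ s → s ∈ RO → s Fin.≤ t → (0# < x s → window s ≡ window t ⊎ windowTotal t < cap) →
                W ω s * x s ≤ 𝟙 (earlier s) * arrivedDenser s
      covered s s∈RO s≤t slack with box s s≤t
      ... | inj₂ 0≡xs , _ = ≤-trans (≤-reflexive (trans (cong (W ω s *_) (sym 0≡xs)) (zeroʳ _)))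
                              (*-nonneg (𝟙-nonneg (earlier s)) (arrivedDenser-nonneg s))
      ... | inj₁ 0<xs , xs≤1 = begin
          W ω s * x s                          ≤⟨ x*y≤x (0≤W s) xs≤1 ⟩
          W ω s                                ≡⟨ W-RO ω s∈RO ⟩
          w j                                  ≡⟨ *-identityˡ (w j) ⟨
          1# * w j                             ≡⟨ cong (_* w j) (𝟙-yes (j Fin.<? i) j<i) ⟨
          denser i j                           ≡⟨ *-identityˡ _ ⟨
          1# * denser i j                      ≡⟨ cong (_* denser i j)
              (𝟙-yes (J ω j Fin.≟ s) (itemAt-J ω s∈RO)) ⟨
          𝟙 ⌊ J ω j Fin.≟ s ⌋ * denser i j     ≤⟨ term≤sum
              (λ j → *-nonneg (𝟙-nonneg ⌊ J ω j Fin.≟ s ⌋) (denser-nonneg i j)) j ⟩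
          arrivedDenser s                      ≡⟨ *-identityˡ _ ⟨
          1# * arrivedDenser s                 ≡⟨ cong (_* arrivedDenser s)
              (𝟙-yes (s Fin.<? t) (Fin.≤∧≢⇒< s≤t s≢t)) ⟨
          𝟙 (earlier s) * arrivedDenser s      ∎
        where
        open ≤-Reasoning
        j = itemAt (I ω) s∈RO
        s≢t : s ≢ t
        s≢t refl = <-irrefl (sym Xt≡0) 0<xs
        j≢i : j ≢ i
        j≢i j≡i = s≢t (trans (sym (itemAt-J ω s∈RO)) (trans (cong (J ω) j≡i) Ji≡t))
        j<i : j Fin.< i
        j<i = Fin.≤∧≢⇒<
            (denser⇒≤ i j (subst₂ _≤_ (cong₂ _*_ Vt≡ (W-RO ω s∈RO)) (cong₂ _*_ (V-RO ω s∈RO) Wt≡)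
          (used-dominates optimal Xt≡0 0≤W W≤1 s s≤t 0<xs (slack 0<xs)))) j≢i

      window≡⇒RO : ∀ {s} → window s ≡ window t → s ∈ RO
      window≡⇒RO {s} eq = free⇒RO (subst (_∉ 𝕎adv) (sym eq) t-free)

      uncounted : ∀ b s → 0# * (W ω s * x s) ≤ 𝟙 b * arrivedDenser s
      uncounted b s =
          ≤-trans (≤-reflexive (zeroˡ _)) (*-nonneg (𝟙-nonneg b) (arrivedDenser-nonneg s))

      -- Exchanges inside the window of `t` need no slack there, so `covered` applies even though
      -- this window is exhausted.
      window-full : cap ≤ windowTotal t → cap ≤ sum (λ j → denser i j * 𝟙 (inWindow (J ω j)))
      window-full cap≤ = ≤-trans cap≤ (≤-trans (sum-mono pointwise)
        (≤-reflexive (weight-by-arrival inWindow (denser i) (J ω))))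
        where
        pointwise : ∀ s → 𝟙 ⌊ (s Fin.≤? t) ×-dec (window s Fin.≟ window t) ⌋ * (W ω s * x s)
            ≤ 𝟙 (inWindow s) * arrivedDenser s
        pointwise s with s Fin.≤? t | window s Fin.≟ window t
        ... | no _    | d      = uncounted (earlier s ∧ ⌊ d ⌋) s
        ... | yes _   | no _   = uncounted (earlier s ∧ false) s
        ... | yes s≤t | yes eq = subst₂ _≤_ (sym (*-identityˡ _))
          (cong (_* arrivedDenser s) (sym (trans (𝟙-∧ (earlier s) true) (*-identityʳ _))))
          (covered s (window≡⇒RO eq) s≤t (λ _ → inj₁ eq))

      -- Slack in the window of `t` permits an exchange with every free time. Times in adversarial
      -- windows, including the random-order ones among them, are bounded by their window budgets
      -- alone.
      budget-full : windowTotal t < cap → budget ≤ total →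
                    budget ≤ fromℕ Γ * cap + sum (λ j → denser i j * 𝟙 (earlier (J ω j)))
      budget-full w<cap budget≤ = begin
        budget
          ≤⟨ budget≤ ⟩
        sum f
          ≤⟨ sum-mono pointwise ⟩
        sum (λ s → 𝟙 ⌊ window s ∈? 𝕎adv ⌋ * f s + 𝟙 (earlier s) * arrivedDenser s)
          ≡⟨ ∑-distrib-+ (λ s → 𝟙 ⌊ window s ∈? 𝕎adv ⌋ * f s)
              (λ s → 𝟙 (earlier s) * arrivedDenser s) ⟩
        sum (λ s → 𝟙 ⌊ window s ∈? 𝕎adv ⌋ * f s) + sum (λ s → 𝟙 (earlier s) * arrivedDenser s)
          ≤⟨ +-mono-≤ (adversarial-windows 0≤cap windowwise)
              (≤-reflexive (weight-by-arrival earlier (denser i) (J ω))) ⟩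
        fromℕ Γ * cap + sum (λ j → denser i j * 𝟙 (earlier (J ω j))) ∎
        where
        open ≤-Reasoning
        f : Fin n → ℝ
        f s = 𝟙 ⌊ s Fin.≤? t ⌋ * (W ω s * x s)
        windowwise : ∀ b → sum (λ s → 𝟙 ⌊ window s Fin.≟ b ⌋ * f s) ≤ cap
        -- The LP has a constraint only for windows containing some time up to `t`; any other window
        -- contributes nothing to `f`.
        windowwise b with Fin.any? (λ s → (s Fin.≤? t) ×-dec (window s Fin.≟ b))
        ... | yes (s , s≤t , refl) = ≤-trans (≤-reflexive (sum-cong merge)) (window-budget s s≤t)
          where
          merge : ∀ s' → 𝟙 ⌊ window s' Fin.≟ window s ⌋ * f s'
              ≡ 𝟙 ⌊ (s' Fin.≤? t) ×-dec (window s' Fin.≟ window s) ⌋ * (W ω s' * x s')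
          merge s' with s' Fin.≤? t | window s' Fin.≟ window s
          ... | yes _ | yes _ = *-identityˡ _
          ... | yes _ | no _  = trans (zeroˡ _) (sym (zeroˡ _))
          ... | no _  | d     =
              trans (cong (𝟙 ⌊ d ⌋ *_) (zeroˡ _)) (trans (zeroʳ _) (sym (zeroˡ _)))
        ... | no ∄ = ≤-trans (≤-reflexive (sum-zero absent)) 0≤cap
          where
          absent : ∀ s → 𝟙 ⌊ window s Fin.≟ b ⌋ * f s ≡ 0#
          absent s with s Fin.≤? t | window s Fin.≟ b
          ... | yes s≤t | yes eq = contradiction (s , s≤t , eq) ∄
          ... | yes _   | no _   = zeroˡ _
          ... | no _    | d      = trans (cong (𝟙 ⌊ d ⌋ *_) (zeroˡ _)) (zeroʳ _)
        free-term : ∀ s → window s ∉ 𝕎adv → f s ≤ 𝟙 (earlier s) * arrivedDenser s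
        free-term s s-free with s Fin.≤? t
        ... | no _    = uncounted (earlier s) s
        ... | yes s≤t =
            ≤-trans (≤-reflexive (*-identityˡ _))
            (covered s (free⇒RO s-free) s≤t (λ _ → inj₂ w<cap))
        pointwise : ∀ s → f s ≤ 𝟙 ⌊ window s ∈? 𝕎adv ⌋ * f s + 𝟙 (earlier s) * arrivedDenser s
        pointwise s with window s ∈? 𝕎adv
        ... | yes _ =
            ≤-cert (𝟙 (earlier s) * arrivedDenser s)
            (*-nonneg (𝟙-nonneg (earlier s)) (arrivedDenser-nonneg s))
                        (cong (_+ 𝟙 (earlier s) * arrivedDenser s) (sym (*-identityˡ (f s))))
        ... | no s-free = subst (f s ≤_) (solve 2 (λ a b → b := num 0 :* a :+ b)
            refl (f s) (𝟙 (earlier s) * arrivedDenser s)) (free-term s s-free)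

      missed⇒overfull : budget - fromℕ Γ * cap ≤ sum (λ j → denser i j * 𝟙 (earlier (J ω j)))
                      ⊎ cap ≤ sum (λ j → denser i j * 𝟙 (inWindow (J ω j)))
      missed⇒overfull with cap ≤? windowTotal t
      ... | yes cap≤ = inj₂ (window-full cap≤)
      ... | no cap≰  = inj₁ (≤-cert (fromℕ Γ * cap + S - budget)
          (x≤y⇒0≤y-x (budget-full (≰⇒> cap≰) (some-budget-tight optimal Xt≡0 0≤W W≤1
            (subst (0# <_) (sym Vt≡) (v-pos i)) (≰⇒> cap≰))))
          (solve 3 (λ b g s → b :- g :+ (g :+ s :- b) := s) refl budget (fromℕ Γ * cap) S))
        where S = sum (λ j → denser i j * 𝟙 (earlier (J ω j)))

-- Numerical constants and the exponents of the two tail bounds.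

module Parameters (R : RealNumbers) (inst : Model.Instance R) (t : Fin (Model.Instance.n inst))
  (t-large : 1212 ℕ.* Model.Instance.Γ inst ℕ.* Model.Instance.ℓ inst ℕ.≤ suc (toℕ t)) where
  open RealNumbers R
  open OrderedField R
  open Model R
  open Instance inst
  open Counting R inst

  -- `e` compares the length of `Γ` windows with the elapsed time, `M` is the share of the knapsack
  -- due by time `t`, and `D` is the deviation term of `ε t`. The relations `eM≡γL` and `DDM≡20L`
  -- tie them to `L = ln k`.
  n′ ℓ′ γ τ L e M D : ℝ
  n′ = fromℕ n
  ℓ′ = fromℕ ℓ
  γ = fromℕ Γ
  τ = time t
  L = ln k
  e = γ * ℓ′ / τ
  M = τ / n′ * k
  D = √ (fromℕ 10 * L) * √ (fromℕ 2 * n′ / (τ * k))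

  0<k : 0# < k
  0<k = <-≤-trans (fromℕ-pos {80} ℕ.z<s) 80≤k

  2k≤n : fromℕ 2 * k ≤ n′
  2k≤n = subst (fromℕ 2 * k ≤_) (trans (*-comm _ _) (/-*-cancel n′ (fromℕ-pos {2} ℕ.z<s)))
      (*-monoˡ-≤ (fromℕ-nonneg 2) k≤n/2)

  0<n : 0# < n′
  0<n = <-≤-trans (*-pos (fromℕ-pos {2} ℕ.z<s) 0<k) 2k≤n

  160≤n : fromℕ 160 ≤ n′
  160≤n = ≤-trans (≤-reflexive (fromℕ-* 2 80)) (≤-trans (*-monoˡ-≤ (fromℕ-nonneg 2) 80≤k) 2k≤n)

  0<ℓ : 0# < ℓ′
  0<ℓ = fromℕ-pos (ℕ.>-nonZero⁻¹ ℓ)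

  0<τ : 0# < τ
  0<τ = fromℕ-pos {suc (toℕ t)} ℕ.z<s

  τ≤n : τ ≤ n′
  τ≤n = fromℕ-mono-≤ (Fin.toℕ<n t)

  ℓk≡nL : ℓ′ * k ≡ n′ * L
  ℓk≡nL = trans (cong (_* k) ℓ-def) (/-*-cancel (n′ * L) 0<k)

  -- Read off from `ℓ′ * k ≡ n′ * L`, whose left side is positive.
  0<L : 0# < L
  0<L = ≰⇒> λ L≤0 →
      <⇒≱ (*-pos 0<ℓ 0<k) (subst₂ _≤_ (sym ℓk≡nL) (zeroʳ n′) (*-monoˡ-≤ (<⇒≤ 0<n) L≤0))

  -- `Γ = 0` would force `√ k = 0` and so `k = 0`.
  1≤γ : 1# ≤ γ
  1≤γ = subst (_≤ γ) (+-identityʳ 1#) (fromℕ-mono-≤ {1} {Γ} (ℕ.n≢0⇒n>0 λ Γ≡0 →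
    <-irrefl (sym
        (k≡0 (≤-antisym (subst (√ k ≤_) (cong fromℕ Γ≡0) √k≤Γ) (√-nonneg (<⇒≤ 0<k))))) 0<k))
    where
    k≡0 : √ k ≡ 0# → k ≡ 0#
    k≡0 √k≡0 = trans (sym (√-square (<⇒≤ 0<k))) (trans (cong (√ k *_) √k≡0) (zeroʳ (√ k)))

  0≤γ : 0# ≤ γ
  0≤γ = fromℕ-nonneg Γ

  eτ≡γℓ : e * τ ≡ γ * ℓ′
  eτ≡γℓ = /-*-cancel (γ * ℓ′) 0<τ

  0≤e : 0# ≤ e
  0≤e = /-nonneg (*-nonneg 0≤γ (<⇒≤ 0<ℓ)) 0<τ

  1212*e≤1 : fromℕ 1212 * e ≤ 1#
  1212*e≤1 = *-cancelˡ-≤ 0<τ (subst₂ _≤_ lhs (sym (*-identityʳ τ)) (fromℕ-mono-≤ t-large))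
    where
    lhs : fromℕ (1212 ℕ.* Γ ℕ.* ℓ) ≡ τ * (fromℕ 1212 * e)
    lhs = trans (trans (fromℕ-* (1212 ℕ.* Γ) ℓ) (cong (_* ℓ′) (fromℕ-* 1212 Γ)))
      (trans (*-assoc (fromℕ 1212) γ ℓ′) (trans (cong (fromℕ 1212 *_) (sym eτ≡γℓ))
        (solve 3 (λ a e t → a :* (e :* t) := t :* (a :* e)) refl (fromℕ 1212) e τ)))

  1212γℓ≤n : fromℕ 1212 * (γ * ℓ′) ≤ n′
  1212γℓ≤n = ≤-trans (subst₂ _≤_ (trans (*-assoc _ e τ) (cong (fromℕ 1212 *_) eτ≡γℓ))
      (*-identityˡ τ) (*-monoʳ-≤ (<⇒≤ 0<τ) 1212*e≤1)) τ≤n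

  c≡ : c t ≡ 1# - fromℕ 4 * e
  c≡ = solve 4 (λ f g l r → num 1 :- f :* g :* l :* r := num 1 :- f :* (g :* l :* r))
      refl (fromℕ 4) γ ℓ′ (τ ⁻¹)

  M*n≡τk : M * n′ ≡ τ * k
  M*n≡τk = trans (solve 3 (λ a k n → a :* k :* n := a :* n :* k) refl (τ / n′) k n′)
      (cong (_* k) (/-*-cancel τ 0<n))

  0<M : 0# < M
  0<M = *-pos (/-pos 0<τ 0<n) 0<k

  cancel-n : ∀ {x y} → x * n′ ≡ y * n′ → x ≡ y
  cancel-n eq = trans (*≡⇒≡/ 0<n eq) (sym (*≡⇒≡/ 0<n refl))

  -- The window length is chosen so that `ℓ k / n = ln k`. Hence a loss of `e` in time is a loss of
  -- `Γ ln k` in budget, and window budgets can be measured in units of `e * M`.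
  eM≡γL : e * M ≡ γ * L
  eM≡γL = cancel-n (begin
    e * M * n′        ≡⟨ trans (*-assoc e M n′) (cong (e *_) M*n≡τk) ⟩
    e * (τ * k)      ≡⟨ trans (sym (*-assoc e τ k)) (cong (_* k) eτ≡γℓ) ⟩
    γ * ℓ′ * k        ≡⟨ trans (*-assoc γ ℓ′ k) (cong (γ *_) ℓk≡nL) ⟩
    γ * (n′ * L)      ≡⟨ solve 3 (λ g n l → g :* (n :* l) := g :* l :* n) refl γ n′ L ⟩
    γ * L * n′        ∎)
    where open ≡-Reasoning

  1212L≤M : fromℕ 1212 * L ≤ M
  1212L≤M = begin
    fromℕ 1212 * L           ≤⟨ *-monoˡ-≤ (fromℕ-nonneg 1212)
        (subst (_≤ γ * L) (*-identityˡ L) (*-monoʳ-≤ (<⇒≤ 0<L) 1≤γ)) ⟩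
    fromℕ 1212 * (γ * L)     ≡⟨ cong (fromℕ 1212 *_) eM≡γL ⟨
    fromℕ 1212 * (e * M)     ≡⟨ *-assoc _ e M ⟨
    fromℕ 1212 * e * M       ≤⟨ *-monoʳ-≤ (<⇒≤ 0<M) 1212*e≤1 ⟩
    1# * M                   ≡⟨ *-identityˡ M ⟩
    M                        ∎
    where open ≤-Reasoning

  0≤D : 0# ≤ D
  0≤D = *-nonneg (√-nonneg (*-nonneg (fromℕ-nonneg 10) (<⇒≤ 0<L)))
    (√-nonneg (/-nonneg (*-nonneg (fromℕ-nonneg 2) (<⇒≤ 0<n)) (*-pos 0<τ 0<k)))

  DDM≡20L : D * D * M ≡ fromℕ 20 * L
  DDM≡20L = cancel-n (begin
    D * D * M * n′
      ≡⟨ trans (*-assoc (D * D) M n′) (cong (D * D *_) M*n≡τk) ⟩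
    D * D * (τ * k)
      ≡⟨ cong (_* (τ * k)) (solve 2 (λ a b → a :* b :* (a :* b) := a :* a :* (b :* b)) refl A B) ⟩
    A * A * (B * B) * (τ * k)
      ≡⟨ cong₂ (λ x y → x * y * (τ * k)) (√-square (*-nonneg (fromℕ-nonneg 10) (<⇒≤ 0<L)))
           (√-square (/-nonneg (*-nonneg (fromℕ-nonneg 2) (<⇒≤ 0<n)) (*-pos 0<τ 0<k))) ⟩
    fromℕ 10 * L * (fromℕ 2 * n′ / (τ * k)) * (τ * k)
      ≡⟨ trans (*-assoc (fromℕ 10 * L) _ _)
          (cong (fromℕ 10 * L *_) (/-*-cancel (fromℕ 2 * n′) (*-pos 0<τ 0<k))) ⟩
    fromℕ 10 * L * (fromℕ 2 * n′)
      ≡⟨ solve 2 (λ l n → num 10 :* l :* (num 2 :* n) := num 20 :* l :* n) refl L n′ ⟩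
    fromℕ 20 * L * n′ ∎)
    where
    open ≡-Reasoning
    A = √ (fromℕ 10 * L)
    B = √ (fromℕ 2 * n′ / (τ * k))

  ℓ/n*k≡L : ℓ/n * k ≡ L
  ℓ/n*k≡L = cancel-n (trans (solve 3 (λ a k n → a :* k :* n := a :* n :* k) refl ℓ/n k n′)
    (trans (cong (_* k) (/-*-cancel ℓ′ 0<n)) (trans ℓk≡nL (*-comm n′ L))))

  cap≡ : a₁ * ℓ/n * k ≡ fromℕ 601 * L
  cap≡ = trans (*-assoc a₁ ℓ/n k) (cong (a₁ *_) ℓ/n*k≡L)

  budget≡ : c t * (τ / n′) * k ≡ (1# - fromℕ 4 * e) * M
  budget≡ = trans (*-assoc (c t) (τ / n′) k) (cong (_* M) c≡)

  θ : ℝ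
  θ = c t - ε t

  θ≡ : θ ≡ 1# - fromℕ 608 * e - D
  θ≡ = trans (cong (_- ε t) c≡)
    (solve 2 (λ e d → num 1 :- num 4 :* e :- ((num 601 :+ num 3) :* e :+ d)
        := num 1 :- num 608 :* e :- d) refl e D)

  θ≤1 : θ ≤ 1#
  θ≤1 = ≤-cert (fromℕ 608 * e + D) (+-nonneg (*-nonneg (fromℕ-nonneg 608) 0≤e) 0≤D)
    (trans (cong (_+ (fromℕ 608 * e + D)) θ≡)
        (solve 2 (λ e d → num 1 :- num 608 :* e :- d :+ (num 608 :* e :+ d) := num 1) refl e D))

  g : ℝ
  g = γ * ℓ′

  0≤g : 0# ≤ g
  0≤g = *-nonneg 0≤γ (<⇒≤ 0<ℓ)

  4g≤n : fromℕ 4 * g ≤ n′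
  4g≤n = ≤-trans (*-monoʳ-≤ 0≤g (fromℕ-mono-≤ {4} {1212} (ℕ.m≤m+n 4 1208))) 1212γℓ≤n

  -- At most a quarter of the times are adversarial, and `n ≥ 160` absorbs the missing one.
  n≤2[N-1] : n′ ≤ fromℕ 2 * (fromℕ N - 1#)
  n≤2[N-1] = *-cancelˡ-≤ (fromℕ-pos {2} ℕ.z<s) (≤-cert
    (fromℕ 4 * (fromℕ N + g - n′) + (n′ - fromℕ 4 * g) + (n′ - fromℕ 160) + fromℕ 156)
    (+-nonneg (+-nonneg (+-nonneg (*-nonneg (fromℕ-nonneg 4) (x≤y⇒0≤y-x n≤N+Γℓ)) (x≤y⇒0≤y-x 4g≤n))
        (x≤y⇒0≤y-x 160≤n)) (fromℕ-nonneg 156))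
    (solve 3 (λ N g n
        → num 2 :* n :+ (num 4 :* (N :+ g :- n) :+ (n :- num 4 :* g) :+ (n :- num 160) :+ num 156)
       := num 2 :* (num 2 :* (N :- num 1))) refl (fromℕ N) g n′))

  0<N-1 : 0# < fromℕ N - 1#
  0<N-1 = ≰⇒> λ N-1≤0 →
      <⇒≱ 0<n (≤-trans n≤2[N-1]
      (subst (fromℕ 2 * (fromℕ N - 1#) ≤_) (zeroʳ _) (*-monoˡ-≤ (fromℕ-nonneg 2) N-1≤0)))

  -- Bounds on the fractions of the items other than the one at t that arrive
  -- before t, resp. before t in its window.
  qA qB : ℝ
  qA = τ / n′ * (1# + fromℕ 3 * e)
  qB = fromℕ 2 * ℓ/n

  0≤qA : 0# ≤ qA
  0≤qA = *-nonneg (/-nonneg (<⇒≤ 0<τ) 0<n) (+-nonneg 0≤1 (*-nonneg (fromℕ-nonneg 3) 0≤e))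

  0≤qB : 0# ≤ qB
  0≤qB = *-nonneg (fromℕ-nonneg 2) (/-nonneg (<⇒≤ 0<ℓ) 0<n)

  -- After clearing `n` this follows from `N ≥ n - g`: the summand `3 * g` outweighs the loss in the
  -- second factor, because `3n - τ - 3g - 3` is nonnegative. Only `toℕ t = τ - 1` times precede
  -- `t`, which matches `N - 1`.
  t≤qA[N-1] : fromℕ (toℕ t) ≤ qA * (fromℕ N - 1#)
  t≤qA[N-1] = *-cancelˡ-≤ 0<n (≤-cert d 0≤d (trans
    (solve 4 (λ n s N g
        → n :* s :+ ((num 1 :+ s :+ num 3 :* g) :* (N :+ g :- n) :+ (n :- (num 1 :+ s))
         :+ g :* ((n :- (num 1 :+ s)) :+ (n :- num 4 :* g) :+ (n :- num 160) :+ g :+ num 157))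
       := (num 1 :+ s :+ num 3 :* g) :* (N :- num 1)) refl n′ (fromℕ (toℕ t)) (fromℕ N) g)
    (trans (cong (_* (fromℕ N - 1#)) n*qA) (*-assoc n′ qA _))))
    where
    d = (τ + fromℕ 3 * g) * (fromℕ N + g - n′) + (n′ - τ)
        + g * ((n′ - τ) + (n′ - fromℕ 4 * g) + (n′ - fromℕ 160) + g + fromℕ 157)
    0≤n-τ = x≤y⇒0≤y-x τ≤n
    0≤d : 0# ≤ d
    0≤d = +-nonneg
        (+-nonneg (*-nonneg (+-nonneg (<⇒≤ 0<τ) (*-nonneg (fromℕ-nonneg 3) 0≤g))
        (x≤y⇒0≤y-x n≤N+Γℓ)) 0≤n-τ)
      (*-nonneg 0≤g
          (+-nonneg (+-nonneg (+-nonneg (+-nonneg 0≤n-τ (x≤y⇒0≤y-x 4g≤n)) (x≤y⇒0≤y-x 160≤n)) 0≤g)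
          (fromℕ-nonneg 157)))
    n*qA : τ + fromℕ 3 * g ≡ n′ * qA
    n*qA = trans (cong (λ g → τ + fromℕ 3 * g) (sym eτ≡γℓ))
      (trans (solve 2 (λ t e → t :+ num 3 :* (e :* t) := t :* (num 1 :+ num 3 :* e)) refl τ e)
      (trans (cong (_* (1# + fromℕ 3 * e)) (sym (/-*-cancel τ 0<n)))
        (solve 3 (λ a n b → a :* n :* b := n :* (a :* b)) refl (τ / n′) n′ (1# + fromℕ 3 * e))))

  ℓ≤qB[N-1] : ℓ′ ≤ qB * (fromℕ N - 1#)
  ℓ≤qB[N-1] = subst₂ _≤_ (/-*-cancel ℓ′ 0<n)
    (solve 3 (λ a b c → a :* (b :* c) := b :* a :* c) refl ℓ/n (fromℕ 2) (fromℕ N - 1#))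
    (*-monoˡ-≤ (/-nonneg (<⇒≤ 0<ℓ) 0<n) n≤2[N-1])

  -- The parameters of the two Chernoff bounds.  With D² M = 20 ln k the choice
  -- λA = D / 4 leaves λA D M - 2 λA² M = (5 / 2) ln k.
  λA λB : ℝ
  λA = D / fromℕ 4
  λB = 1# / fromℕ 2

  4λA≡D : fromℕ 4 * λA ≡ D
  4λA≡D = trans (*-comm _ λA) (/-*-cancel D (fromℕ-pos {4} ℕ.z<s))

  2λB≡1 : fromℕ 2 * λB ≡ 1#
  2λB≡1 = trans (*-comm _ λB) (/-*-cancel 1# (fromℕ-pos {2} ℕ.z<s))

  0≤λA : 0# ≤ λA
  0≤λA = /-nonneg 0≤D (fromℕ-pos {4} ℕ.z<s)

  0≤λB : 0# ≤ λB
  0≤λB = /-nonneg 0≤1 (fromℕ-pos {2} ℕ.z<s)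

  16λλM≡20L : fromℕ 16 * (λA * λA) * M ≡ fromℕ 20 * L
  16λλM≡20L = trans (solve 2 (λ l m → num 16 :* (l :* l) :* m := num 4 :* l :* (num 4 :* l) :* m)
      refl λA M)
    (trans (cong (λ d → d * d * M) 4λA≡D) DDM≡20L)

  -- Otherwise `16 * λA² * M` would exceed `4 * M`, far more than `20 * L`, as `M ≥ 1212 * L`. The
  -- factor 303 makes both `303 * 4 = 1212` and `303 * 20 = 5 * 1212`.
  2λA≤1 : fromℕ 2 * λA ≤ 1#
  2λA≤1 = ≮⇒≥ λ 1<2λ → <⇒≱ 0<M (≤-trans (≤-cert
    (fromℕ 303 * (fromℕ 4 * ((fromℕ 2 * λA - 1#) * (fromℕ 2 * λA + 1#)) * M)
        + fromℕ 5 * (M - fromℕ 1212 * L) + fromℕ 1206 * M)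
    (+-nonneg (+-nonneg
        (*-nonneg (fromℕ-nonneg 303)
        (*-nonneg (*-nonneg (fromℕ-nonneg 4) (*-nonneg (<⇒≤ (x<y⇒0<y-x 1<2λ))
      (+-nonneg (*-nonneg (fromℕ-nonneg 2) 0≤λA) 0≤1))) (<⇒≤ 0<M)))
          (*-nonneg (fromℕ-nonneg 5) (x≤y⇒0≤y-x 1212L≤M))) (*-nonneg (fromℕ-nonneg 1206) (<⇒≤ 0<M)))
    (solve 3 (λ l m L
        → m :+ (num 303 :* (num 4 :* ((num 2 :* l :- num 1) :* (num 2 :* l :+ num 1)) :* m)
             :+ num 5 :* (m :- num 1212 :* L) :+ num 1206 :* m)
       := num 303 :* (num 16 :* (l :* l) :* m :- num 20 :* L)) refl λA M L))
    (≤-reflexive (trans (cong (λ x → fromℕ 303 * (x - fromℕ 20 * L)) 16λλM≡20L)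
        (solve 1 (λ L → num 303 :* (num 20 :* L :- num 20 :* L) := num 0) refl L))))

  thresholdA : ℝ
  thresholdA = c t * (τ / n′) * k - γ * (a₁ * ℓ/n * k)

  thresholdA≡ : thresholdA ≡ (1# - fromℕ 605 * e) * M
  thresholdA≡ = trans (cong₂ (λ b x → b - γ * x) budget≡ cap≡) (trans
    (solve 4 (λ e m g L → (num 1 :- num 4 :* e) :* m :- g :* (num 601 :* L)
        := (num 1 :- num 4 :* e) :* m :- num 601 :* (g :* L)) refl e M γ L)
    (trans (cong (λ x → (1# - fromℕ 4 * e) * M - fromℕ 601 * x) (sym eM≡γL))
      (solve 2 (λ e m → (num 1 :- num 4 :* e) :* m :- num 601 :* (e :* m)
          := (num 1 :- num 605 :* e) :* m) refl e M)))

  -- The mean `qA * P` lies `D * M = 4 * λA * M` below the threshold. The resulting gain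
  -- `4 * λA² * M` pays for `L` and for the quadratic part of the exponent.
  exponentA : ∀ {P} → P ≤ θ * k → L + (λA + fromℕ 2 * (λA * λA)) * (qA * P) ≤ λA * thresholdA
  exponentA {P} P≤θk = *-cancelˡ-≤ (fromℕ-pos {8} ℕ.z<s) (≤-cert d 0≤d (trans
    (solve 6 (λ L l Q m e d → num 8 :* (L :+ (l :+ num 2 :* (l :* l)) :* Q)
         :+ (num 8 :* (l :+ num 2 :* (l :* l)) :* (m :* (num 1 :- num 605 :* e :- num 4 :* l) :- Q)
         :+ num 16 :* (l :* l) :* (m :* (num 605 :* e :+ num 4 :* l)) :+ num 12 :* L)
       := num 8 :* (l :* ((num 1 :- num 605 :* e) :* m)) :- num 16 :* (l :* l) :* m :+ num 20 :* L)
       refl L λA (qA * P) M e D)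
    (trans (cong (λ x → fromℕ 8 * (λA * ((1# - fromℕ 605 * e) * M)) - x + fromℕ 20 * L) 16λλM≡20L)
    (trans (solve 2 (λ x y → x :- y :+ y := x)
        refl (fromℕ 8 * (λA * ((1# - fromℕ 605 * e) * M))) (fromℕ 20 * L))
      (cong (λ x → fromℕ 8 * (λA * x)) (sym thresholdA≡))))))
    where
    -- Everything is multiplied by 8, to use `16 * λA² * M = 20 * L`; after paying `8 * L` a surplus
    -- of `12 * L` is left.
    d = fromℕ 8 * (λA + fromℕ 2 * (λA * λA)) * (M * (1# - fromℕ 605 * e - fromℕ 4 * λA) - qA * P)
      + fromℕ 16 * (λA * λA) * (M * (fromℕ 605 * e + fromℕ 4 * λA)) + fromℕ 12 * L
    -- As `θ ≤ 1`, the product `(1 + 3e) * θ` is at most `θ + 3e`, which turns 608 into 605.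
    qA*P≤ : qA * P ≤ M * (1# - fromℕ 605 * e - fromℕ 4 * λA)
    qA*P≤ = ≤-trans (*-monoˡ-≤ 0≤qA P≤θk) (≤-cert (M * (fromℕ 3 * e * (1# - θ)))
      (*-nonneg (<⇒≤ 0<M) (*-nonneg (*-nonneg (fromℕ-nonneg 3) 0≤e) (x≤y⇒0≤y-x θ≤1)))
      (trans (solve 4
          (λ a e th k →
          a :* (num 1 :+ num 3 :* e) :* (th :* k) :+ a :* k :* (num 3 :* e :* (num 1 :- th))
          := a :* k :* (th :+ num 3 :* e)) refl (τ / n′) e θ k)
        (cong (M *_) (trans
            (cong (_+ fromℕ 3 * e) (trans θ≡ (cong (λ d → 1# - fromℕ 608 * e - d) (sym 4λA≡D))))
          (solve 2 (λ e l → num 1 :- num 608 :* e :- num 4 :* l :+ num 3 :* e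
              := num 1 :- num 605 :* e :- num 4 :* l) refl e λA)))))
    0≤λλ : 0# ≤ λA * λA
    0≤λλ = square-nonneg λA
    0≤d : 0# ≤ d
    0≤d = +-nonneg (+-nonneg
      (*-nonneg (*-nonneg (fromℕ-nonneg 8) (+-nonneg 0≤λA (*-nonneg (fromℕ-nonneg 2) 0≤λλ)))
          (x≤y⇒0≤y-x qA*P≤))
      (*-nonneg (*-nonneg (fromℕ-nonneg 16) 0≤λλ)
          (*-nonneg (<⇒≤ 0<M)
          (+-nonneg (*-nonneg (fromℕ-nonneg 605) 0≤e) (*-nonneg (fromℕ-nonneg 4) 0≤λA)))))
      (*-nonneg (fromℕ-nonneg 12) (<⇒≤ 0<L))

  -- The mean is at most `2 * L`, and `λB = 1/2` makes `λB + 2 * λB²` equal to 1. So `L + 2 * L` has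
  -- to stay below half of `601 * L`.
  exponentB : ∀ {P} → P ≤ θ * k → L + (λB + fromℕ 2 * (λB * λB)) * (qB * P) ≤ λB * (a₁ * ℓ/n * k)
  exponentB {P} P≤θk = *-cancelˡ-≤ (fromℕ-pos {2} ℕ.z<s) (begin
    fromℕ 2 * (L + (λB + fromℕ 2 * (λB * λB)) * (qB * P))
      ≡⟨ solve 3 (λ L h Q → num 2 :* (L :+ (h :+ num 2 :* (h :* h)) :* Q)
          := num 2 :* L :+ (num 2 :* h :+ num 2 :* h :* (num 2 :* h)) :* Q) refl L λB (qB * P) ⟩
    fromℕ 2 * L + (fromℕ 2 * λB + fromℕ 2 * λB * (fromℕ 2 * λB)) * (qB * P)
      ≡⟨ cong (λ x → fromℕ 2 * L + (x + x * x) * (qB * P)) 2λB≡1 ⟩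
    fromℕ 2 * L + (1# + 1# * 1#) * (qB * P)
      ≤⟨ +-mono-≤ ≤-refl (*-monoˡ-≤ (+-nonneg 0≤1 (*-nonneg 0≤1 0≤1)) qB*P≤) ⟩
    fromℕ 2 * L + (1# + 1# * 1#) * (fromℕ 2 * L)
      ≤⟨ ≤-cert (fromℕ 595 * L) (*-nonneg (fromℕ-nonneg 595) (<⇒≤ 0<L))
           (solve 1 (λ L → num 2 :* L :+ (num 1 :+ num 1 :* num 1) :* (num 2 :* L) :+ num 595 :* L
               := num 1 :* (num 601 :* L)) refl L) ⟩
    1# * (fromℕ 601 * L)
      ≡⟨ cong₂ _*_ (sym 2λB≡1) (sym cap≡) ⟩
    fromℕ 2 * λB * (a₁ * ℓ/n * k)
      ≡⟨ *-assoc _ λB _ ⟩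
    fromℕ 2 * (λB * (a₁ * ℓ/n * k)) ∎)
    where
    open ≤-Reasoning
    qB*P≤ : qB * P ≤ fromℕ 2 * L
    qB*P≤ = begin
      qB * P                  ≤⟨ *-monoˡ-≤ 0≤qB
          (≤-trans P≤θk (subst (θ * k ≤_) (*-identityˡ k) (*-monoʳ-≤ (<⇒≤ 0<k) θ≤1))) ⟩
      qB * k                  ≡⟨ trans (*-assoc (fromℕ 2) ℓ/n k) (cong (fromℕ 2 *_) ℓ/n*k≡L) ⟩
      fromℕ 2 * L             ∎

-- Probability of packing a greedy item, and the expected gain.

module Selection (R : RealNumbers) (inst : Model.Instance R) (run : Model.Execution R inst)
  (t : Fin (Model.Instance.n inst))
  (t-large : 1212 ℕ.* Model.Instance.Γ inst ℕ.* Model.Instance.ℓ inst ℕ.≤ suc (toℕ t))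
  (t-free : Model.Instance.Free inst t) where
  open RealNumbers R
  open OrderedField R
  open FiniteSums R
  open Model R
  open Instance inst
  open Execution run
  open Expectation R space
  open RandomOrder R inst run
  open Concentration R inst run t
  open Counting R inst
  open Knapsack R inst
  open Missed R inst run t
  open Parameters R inst t t-large

  t∈RO : t ∈ RO
  t∈RO = free⇒RO t-free

  0<N : 0# < fromℕ N
  0<N = ≤-<-trans 0≤1 (<-cert (fromℕ N - 1#) 0<N-1 (solve 1 (λ N → num 1 :+ (N :- num 1) := N)
      refl (fromℕ N)))

  E-itemAt : ∀ i ω → E i (J ω) ≡ 𝟙 ⌊ itemAt (I ω) t∈RO Fin.≟ i ⌋
  E-itemAt i ω = 𝟙-⇔ (J ω i Fin.≟ t) (itemAt (I ω) t∈RO Fin.≟ i) (J⇒itemAt ω t∈RO)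
      (λ { refl → itemAt-J ω t∈RO })

  arrivals-before : ∀ ω → sum (λ j → 𝟙 (earlier (J ω j))) ≤ fromℕ (toℕ t)
  arrivals-before ω = count≤ (earlier ∘ J ω) (toℕ ∘ J ω) (λ j → ⌊⌋-true (J ω j Fin.<? t))
    (λ i j _ _ eq → J-injective ω (Fin.toℕ-injective eq))

  arrivals-in-window : ∀ ω → sum (λ j → 𝟙 (inWindow (J ω j))) ≤ fromℕ ℓ
  arrivals-in-window ω = count≤ (inWindow ∘ J ω) (λ j → toℕ (J ω j) ℕ.% ℓ)
      (λ j _ → ℕ.m%n<n (toℕ (J ω j)) ℓ)
    (λ i j in-i in-j eq →
        J-injective ω (window-residue (trans (in-window i in-i) (sym (in-window j in-j))) eq))
    where
    in-window : ∀ j → inWindow (J ω j) ≡ true → window (J ω j) ≡ window t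
    in-window j eq with earlier (J ω j)
    ... | true = ⌊⌋-true (window (J ω j) Fin.≟ window t) eq

  module _ (0≤θ : 0# ≤ θ) {i : Fin N} (i-greedy : prefix i < θ * k) where

    denser≤1 : ∀ j → denser i j ≤ 1#
    denser≤1 j = subst (denser i j ≤_) (*-identityˡ 1#)
        (*-mono-≤ (𝟙-nonneg ⌊ j Fin.<? i ⌋) (<⇒≤ (w-pos j)) (𝟙≤1 ⌊ j Fin.<? i ⌋) (w≤1 j))

    overfull-early overfull-window missed : Ω → Bool
    overfull-early ω  = ⌊ thresholdA ≤? sum (λ j → denser i j * 𝟙 (earlier (J ω j))) ⌋
    overfull-window ω = ⌊ a₁ * ℓ/n * k ≤? sum (λ j → denser i j * 𝟙 (inWindow (J ω j))) ⌋
    missed ω = not (T ω t)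

    early-unlikely : 𝔼 (λ ω → E i (J ω) * 𝟙 (overfull-early ω)) * k ≤ 𝔼 (E i ∘ J)
    early-unlikely = tail-bound earlier earlier-t 0≤qA 0<N-1 t≤qA[N-1] arrivals-before
      (denser-nonneg i) denser≤1 0≤λA 2λA≤1 0<k (<⇒≤ 0<L) (exponentA (<⇒≤ i-greedy)) i

    window-unlikely : 𝔼 (λ ω → E i (J ω) * 𝟙 (overfull-window ω)) * k ≤ 𝔼 (E i ∘ J)
    window-unlikely = tail-bound inWindow inWindow-t 0≤qB 0<N-1 ℓ≤qB[N-1] arrivals-in-window
      (denser-nonneg i) denser≤1 0≤λB (≤-reflexive 2λB≡1) 0<k (<⇒≤ 0<L) (exponentB (<⇒≤ i-greedy)) i

    0≤budget : 0# ≤ c t * (time t / fromℕ n) * k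
    0≤budget = subst (0# ≤_) (sym budget≡) (*-nonneg (≤-trans (x≤y⇒0≤y-x 1212*e≤1)
      (≤-cert (fromℕ 1208 * e) (*-nonneg (fromℕ-nonneg 1208) 0≤e)
        (solve 1 (λ e → num 1 :- num 1212 :* e :+ num 1208 :* e := num 1 :- num 4 :* e) refl e)))
            (<⇒≤ 0<M))

    0≤cap : 0# ≤ a₁ * ℓ/n * k
    0≤cap = subst (0# ≤_) (sym cap≡) (*-nonneg (fromℕ-nonneg 601) (<⇒≤ 0<L))

    -- Union bound over the two ways in which a budget can be exhausted, on the event that item `i`
    -- is at `t`.
    missed-split : ∀ ω → E i (J ω) * 𝟙 (missed ω)
        ≤ E i (J ω) * 𝟙 (overfull-early ω) + E i (J ω) * 𝟙 (overfull-window ω)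
    missed-split ω = ≤-trans (𝟙-*-mono (J ω i Fin.≟ t) (bound (T ω t) refl))
        (≤-reflexive (distribˡ _ _ _))
      where
      bound : ∀ b → T ω t ≡ b → J ω i ≡ t → 𝟙 (not b) ≤ 𝟙 (overfull-early ω) + 𝟙 (overfull-window ω)
      bound true  _ _ = +-nonneg (𝟙-nonneg (overfull-early ω)) (𝟙-nonneg (overfull-window ω))
      bound false T≡false Ji≡t =
          [ (λ early≥ → ≤-trans (≤-reflexive (sym (𝟙-yes (thresholdA ≤? _) early≥)))
                                     (≤-cert _ (𝟙-nonneg (overfull-window ω)) refl))
                                 , (λ window≥ →
                                     ≤-trans (≤-reflexive (sym (𝟙-yes (a₁ * ℓ/n * k ≤? _) window≥)))
                                     (≤-cert _ (𝟙-nonneg (overfull-early ω)) (+-comm _ _)))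
                                 ]′ (missed⇒overfull t-free ω Ji≡t T≡false 0≤budget 0≤cap)

    missed-unlikely : 𝔼 (λ ω → E i (J ω) * 𝟙 (missed ω)) ≤ fromℕ 2 / k * 𝔼 (E i ∘ J)
    missed-unlikely = *-cancelˡ-≤ 0<k (begin
      k * 𝔼 (λ ω → E i (J ω) * 𝟙 (missed ω))
        ≤⟨ *-monoˡ-≤ (<⇒≤ 0<k)
            (≤-trans (𝔼-mono missed-split)
            (≤-reflexive (𝔼-+ (λ ω → E i (J ω) * 𝟙 (overfull-early ω)) _))) ⟩
      k * (𝔼 (λ ω → E i (J ω) * 𝟙 (overfull-early ω)) + 𝔼 (λ ω → E i (J ω) * 𝟙 (overfull-window ω)))
        ≡⟨ trans (*-comm k _) (distribʳ k _ _) ⟩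
      𝔼 (λ ω → E i (J ω) * 𝟙 (overfull-early ω)) * k + 𝔼 (λ ω →
          E i (J ω) * 𝟙 (overfull-window ω)) * k
        ≤⟨ +-mono-≤ early-unlikely window-unlikely ⟩
      𝔼 (E i ∘ J) + 𝔼 (E i ∘ J)
        ≡⟨ solve 1 (λ x → x :+ x := num 2 :* x) refl (𝔼 (E i ∘ J)) ⟩
      fromℕ 2 * 𝔼 (E i ∘ J)
        ≡⟨ cong (_* 𝔼 (E i ∘ J)) (/-*-cancel (fromℕ 2) 0<k) ⟨
      fromℕ 2 / k * k * 𝔼 (E i ∘ J)
        ≡⟨ solve 3 (λ a k x → a :* k :* x := k :* (a :* x)) refl (fromℕ 2 / k) k (𝔼 (E i ∘ J)) ⟩
      k * (fromℕ 2 / k * 𝔼 (E i ∘ J)) ∎)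
      where open ≤-Reasoning

  module _ {p : ℝ} (0≤p : 0# ≤ p)
    (blocked≤p : ∀ i → 0# < Pr (arrives t∈RO i) →
        Pr[ (λ ω → not (F ω t)) ∣ arrives t∈RO i ] ≤ p) where

    -- The hypothesis on `p` with its denominator cleared; the denominator is positive because it
    -- equals `1 / N`.
    blocked-unlikely : ∀ i → 𝔼 (λ ω → E i (J ω) * 𝟙 (not (F ω t))) ≤ p * 𝔼 (E i ∘ J)
    blocked-unlikely i = begin
      𝔼 (λ ω → E i (J ω) * 𝟙 (not (F ω t)))
        ≡⟨ 𝔼-cong (λ ω →
            trans (*-comm _ _)
            (trans (cong (𝟙 (not (F ω t)) *_) (E-itemAt i ω)) (sym (𝟙-∧ (not (F ω t)) _)))) ⟩
      Pr (λ ω → not (F ω t) ∧ arrives t∈RO i ω)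
        ≡⟨ /-*-cancel _ 0<Pr ⟨
      Pr[ (λ ω → not (F ω t)) ∣ arrives t∈RO i ] * Pr (arrives t∈RO i)
        ≤⟨ *-monoʳ-≤ (<⇒≤ 0<Pr) (blocked≤p i 0<Pr) ⟩
      p * Pr (arrives t∈RO i)
        ≡⟨ cong (p *_) Pr≡ ⟨
      p * 𝔼 (E i ∘ J) ∎
      where
      open ≤-Reasoning
      Pr≡ : 𝔼 (E i ∘ J) ≡ Pr (arrives t∈RO i)
      Pr≡ = 𝔼-cong (E-itemAt i)
      0<Pr : 0# < Pr (arrives t∈RO i)
      0<Pr = subst (0# <_) (trans (sym (arrival-uniform t∈RO i)) Pr≡) (/-pos 0<1 0<N)

    packed : Ω → ℝ
    packed ω = 𝟙 (T ω t) * 𝟙 (F ω t)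

    packed-nonneg : ∀ ω → 0# ≤ packed ω
    packed-nonneg ω = *-nonneg (𝟙-nonneg (T ω t)) (𝟙-nonneg (F ω t))

    -- Lower bound for the probability, given that a greedy item is at `t`, that it is packed:
    -- blocked costs `p`, missed costs `2 / k`.
    B : ℝ
    B = 1# - p - fromℕ 2 / k

    packed-likely : 0# ≤ θ → ∀ i → prefix i < θ * k → B * (1# / fromℕ N)
        ≤ 𝔼 (λ ω → E i (J ω) * packed ω)
    packed-likely 0≤θ i i-greedy = subst (λ x → B * x ≤ 𝔼 (λ ω → E i (J ω) * packed ω))
        (arrival-uniform t∈RO i)
      (≤-cert (e₁ + m + b - e₀ + (fromℕ 2 / k * e₀ - m) + (p * e₀ - b))
        (+-nonneg (+-nonneg (x≤y⇒0≤y-x union) (x≤y⇒0≤y-x (missed-unlikely 0≤θ i-greedy)))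
            (x≤y⇒0≤y-x (blocked-unlikely i)))
        (solve 6 (λ p q e e₁ m b →
            (num 1 :- p :- q) :* e :+ (e₁ :+ m :+ b :- e :+ (q :* e :- m) :+ (p :* e :- b)) := e₁)
            refl p (fromℕ 2 / k) e₀ e₁ m b))
      where
      e₀ = 𝔼 (E i ∘ J)
      e₁ = 𝔼 (λ ω → E i (J ω) * packed ω)
      m = 𝔼 (λ ω → E i (J ω) * 𝟙 (not (T ω t)))
      b = 𝔼 (λ ω → E i (J ω) * 𝟙 (not (F ω t)))
      some : ∀ a b → 1# ≤ 𝟙 a * 𝟙 b + 𝟙 (not a) + 𝟙 (not b)
      some true  true  = ≤-reflexive (solve 0 (num 1 := num 1 :* num 1 :+ num 0 :+ num 0) refl)
      some true  false = ≤-reflexive (solve 0 (num 1 := num 1 :* num 0 :+ num 0 :+ num 1) refl)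
      some false true  = ≤-reflexive (solve 0 (num 1 := num 0 :* num 1 :+ num 1 :+ num 0) refl)
      some false false =
          ≤-cert 1# 0≤1 (solve 0 (num 1 :+ num 1 := num 0 :* num 0 :+ num 1 :+ num 1) refl)
      union : e₀ ≤ e₁ + m + b
      union = ≤-trans (𝔼-mono pointwise) (≤-reflexive (trans
        (𝔼-+ (λ ω → E i (J ω) * packed ω + E i (J ω) * 𝟙 (not (T ω t))) _)
        (cong (_+ b) (𝔼-+ (λ ω → E i (J ω) * packed ω) _))))
        where
        pointwise : ∀ ω → E i (J ω)
            ≤ E i (J ω) * packed ω + E i (J ω) * 𝟙 (not (T ω t)) + E i (J ω) * 𝟙 (not (F ω t))
        pointwise ω = subst₂ _≤_ (*-identityʳ _)
          (solve 4 (λ e a b c → e :* (a :+ b :+ c) := e :* a :+ e :* b :+ e :* c)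
              refl (E i (J ω)) (packed ω) (𝟙 (not (T ω t))) (𝟙 (not (F ω t))))
          (*-monoˡ-≤ (𝟙-nonneg ⌊ J ω i Fin.≟ t ⌋) (some (T ω t) (F ω t)))

    -- Splits by the item at `t`, whose value is then a constant that leaves the expectation.
    gain-by-item : 𝔼 (λ ω → V ω t * 𝟙 (T ω t) * 𝟙 (F ω t))
        ≡ sum (λ i → v i * 𝔼 (λ ω → E i (J ω) * packed ω))
    gain-by-item = begin
      𝔼 (λ ω → V ω t * 𝟙 (T ω t) * 𝟙 (F ω t))
        ≡⟨ 𝔼-cong (λ ω →
            trans (*-assoc _ _ _)
            (trans (cong (_* packed ω) (V-RO ω t∈RO))
            (sym (sum-δ (λ i → v i * packed ω) (itemAt (I ω) t∈RO))))) ⟩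
      𝔼 (λ ω → sum (λ i → 𝟙 ⌊ itemAt (I ω) t∈RO Fin.≟ i ⌋ * (v i * packed ω)))
        ≡⟨ 𝔼-cong (λ ω → sum-cong (λ i → trans (cong (_* (v i * packed ω)) (sym (E-itemAt i ω)))
             (solve 3 (λ e v a → e :* (v :* a) := v :* (e :* a))
                 refl (E i (J ω)) (v i) (packed ω)))) ⟩
      𝔼 (λ ω → sum (λ i → v i * (E i (J ω) * packed ω)))
        ≡⟨ 𝔼-sum (λ i ω → v i * (E i (J ω) * packed ω)) ⟩
      sum (λ i → 𝔼 (λ ω → v i * (E i (J ω) * packed ω)))
        ≡⟨ sum-cong (λ i → 𝔼-* (v i) (λ ω → E i (J ω) * packed ω)) ⟩
      sum (λ i → v i * 𝔼 (λ ω → E i (J ω) * packed ω)) ∎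
      where open ≡-Reasoning

    -- Since `θ ≤ 1`, the factor `θ - p - 2/k` is at most `B * θ`, a packing probability times the
    -- greedy share of `OPT`. If the factor is not positive, the claim holds because all gains are
    -- nonnegative; otherwise `θ` and `B` are nonnegative, as the product needs. Items that are not
    -- greedy are bounded below by zero.
    gain-bound : ∀ {OPT} → KnapsackValue OPT →
                 (θ - p - fromℕ 2 / k) * (OPT / fromℕ N) ≤ 𝔼 (λ ω → V ω t * 𝟙 (T ω t) * 𝟙 (F ω t))
    gain-bound {OPT} value = subst ((θ - p - fromℕ 2 / k) * (OPT / fromℕ N) ≤_) (sym gain-by-item)
        (cases (≤-total (θ - p - fromℕ 2 / k) 0#))
      where
      open ≤-Reasoning
      gain : Fin N → ℝ
      gain i = v i * 𝔼 (λ ω → E i (J ω) * packed ω)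
      gain-nonneg : ∀ i → 0# ≤ gain i
      gain-nonneg i =
          *-nonneg (<⇒≤ (v-pos i))
          (𝔼-nonneg (λ ω → *-nonneg (𝟙-nonneg ⌊ J ω i Fin.≟ t ⌋) (packed-nonneg ω)))
      0≤OPT : 0# ≤ OPT
      0≤OPT = nonneg value
        where
        nonneg : ∀ {z} → KnapsackValue z → 0# ≤ z
        nonneg (x , x-box , _ , refl) =
            sum-nonneg (λ i → *-nonneg (<⇒≤ (v-pos i)) (proj₁ (x-box i)))
      0≤OPT/N : 0# ≤ OPT / fromℕ N
      0≤OPT/N = /-nonneg 0≤OPT 0<N
      0≤1/N : 0# ≤ 1# / fromℕ N
      0≤1/N = /-nonneg 0≤1 0<N
      0≤p+2/k : 0# ≤ p + fromℕ 2 / k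
      0≤p+2/k = +-nonneg 0≤p (/-nonneg (fromℕ-nonneg 2) 0<k)
      cases : θ - p - fromℕ 2 / k ≤ 0# ⊎ 0#
          ≤ θ - p - fromℕ 2 / k → (θ - p - fromℕ 2 / k) * (OPT / fromℕ N) ≤ sum gain
      cases (inj₁ ≤0) =
          ≤-trans (subst ((θ - p - fromℕ 2 / k) * (OPT / fromℕ N) ≤_) (zeroˡ _)
          (*-monoʳ-≤ 0≤OPT/N ≤0)) (sum-nonneg gain-nonneg)
      cases (inj₂ 0≤) = begin
        (θ - p - fromℕ 2 / k) * (OPT / fromℕ N)
          ≤⟨ *-monoʳ-≤ 0≤OPT/N
              (≤-cert ((p + fromℕ 2 / k) * (1# - θ)) (*-nonneg 0≤p+2/k (x≤y⇒0≤y-x θ≤1))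
               (solve 3 (λ th p q → th :- p :- q :+ (p :+ q) :* (num 1 :- th)
                   := (num 1 :- p :- q) :* th) refl θ p (fromℕ 2 / k))) ⟩
        B * θ * (OPT / fromℕ N)
          ≡⟨ solve 4 (λ b th o r → b :* th :* (o :* r) := b :* (num 1 :* r) :* (th :* o))
              refl B θ OPT (fromℕ N ⁻¹) ⟩
        B * (1# / fromℕ N) * (θ * OPT)
          ≤⟨ *-monoˡ-≤ (*-nonneg 0≤B 0≤1/N) (greedy 0≤θ θ≤1 value) ⟩
        B * (1# / fromℕ N) * sum (λ i → 𝟙 ⌊ prefix i <? θ * k ⌋ * v i)
          ≡⟨ *-distribˡ-sum (B * (1# / fromℕ N)) (λ i → 𝟙 ⌊ prefix i <? θ * k ⌋ * v i) ⟩
        sum (λ i → B * (1# / fromℕ N) * (𝟙 ⌊ prefix i <? θ * k ⌋ * v i))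
          ≤⟨ sum-mono itemwise ⟩
        sum gain ∎
        where
        0≤θ : 0# ≤ θ
        0≤θ = ≤-trans 0≤
            (≤-cert (p + fromℕ 2 / k) 0≤p+2/k (solve 3 (λ th p q → th :- p :- q :+ (p :+ q) := th)
            refl θ p (fromℕ 2 / k)))
        0≤B : 0# ≤ B
        0≤B = ≤-trans 0≤
            (≤-cert (1# - θ) (x≤y⇒0≤y-x θ≤1)
            (solve 3 (λ th p q → th :- p :- q :+ (num 1 :- th) := num 1 :- p :- q)
            refl θ p (fromℕ 2 / k)))
        itemwise : ∀ i → B * (1# / fromℕ N) * (𝟙 ⌊ prefix i <? θ * k ⌋ * v i) ≤ gain i
        itemwise i = ≤-trans
          (≤-reflexive (solve 3 (λ b d v → b :* (d :* v) := d :* (v :* b))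
              refl (B * (1# / fromℕ N)) (𝟙 ⌊ prefix i <? θ * k ⌋) (v i)))
          (𝟙-*-≤ (prefix i <? θ * k) (gain-nonneg i)
              (λ i-greedy → *-monoˡ-≤ (<⇒≤ (v-pos i)) (packed-likely 0≤θ i i-greedy)))

mainTheorem13 :
    (R : RealNumbers) →
    let open RealNumbers R
        open Model R in
    (inst : Instance) →
    let open Instance inst in
    (run : Execution inst) →
    let open Execution run in
    (OPT : ℝ) → IsOPT-RO OPT →
    (t : Fin n) → 1212 ℕ.* Γ ℕ.* ℓ ℕ.≤ suc (toℕ t) → (t-free : Free t) →
    (p : ℝ) → 0# ≤ p → p ≤ 1# →
    (∀ i → 0# < Pr (arrives (free⇒RO t-free) i) →
      Pr[ (λ ω → not (F ω t)) ∣ arrives (free⇒RO t-free) i ] ≤ p) →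
    (c t - ε t - p - fromℕ 2 / k) * (OPT / fromℕ N)
      ≤ 𝔼 (λ ω → V ω t * 𝟙 (T ω t) * 𝟙 (F ω t))
mainTheorem13 R inst run OPT (value , _) t t-large t-free p 0≤p _ blocked≤p =
    Selection.gain-bound R inst run t t-large t-free 0≤p blocked≤p value
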